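{- In $\mathbb{Z}[t][[u]]$, \[ \sum_{n=1}^\infty Z_{W^n}(t) u^{n}=\frac{1}{\sqrt{(1-(t+1) u)^2-4 t u^2}}-1, \] where the square root is the power series in $u$ with constant term $1$.
   Context: For a matroid $M$ let $L(M)$ be its lattice of flats, $\mathrm{rk}\, M$ its rank, $\chi_M(t)$ its characteristic polynomial; for a flat $F$, $M_F$ is the localization (restriction to $F$) and $M^F$ the contraction at $F$. The Kazhdan–Lusztig polynomial is the unique assignment of $P_M(t)\in\mathbb{Z}[t]$ to each loopless matroid $M$ with: $P_M=1$ if $\mathrm{rk}\, M=0$; $\deg P_M<\frac12\mathrm{rk}\, M$ if $\mathrm{rk}\, M>0$; $t^{\mathrm{rk}\, M}P_M(t^{ -1})=\sum_{F\in L(M)}\chi_{M_F}(t)P_{M^F}(t)$. The $Z$-polynomial is $Z_M(t)=\sum_{F\in L(M)}t^{\mathrm{rk}\, M_F}P_{M^F}(t)$. For $n\ge3$ let $W_n$ be the wheel graph (vertices $0,\dots,n$, edges of the cycle $1,2,\dots,n,1$ forming the set $O_n$, and edges $\{0,i\}$), and the whirl matroid $W^n$ the matroid on $E(W_n)$ whose independent sets are the edge sets of forests of $W_n$ together with $O_n$. $W^1$ is the graphic matroid of a single edge, and $W^2$ is the matroid obtained from the graphic matroid of the multigraph on $\{0,1,2\}$ with edges $(0,1),(0,2)$ and two parallel edges $e_1,e_2$ between $1$ and $2$ by declaring $\{e_1,e_2\}$ independent, i.e. the uniform matroid of rank $2$ on $4$ elements. -}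

module Defs where

open import Data.Bool using (Bool; true; false; if_then_else_; _∧_; _∨_; not)
open import Data.Nat as ℕ using (ℕ; zero; suc; _∸_; _≤_; _<_; _≡ᵇ_; _≤ᵇ_; _<ᵇ_; _⊔_)
open import Data.Integer as ℤ using (ℤ; +_; -_)
open import Data.Fin using (Fin; toℕ)
open import Data.Vec as V using (Vec; []; _∷_; lookup; tabulate)
open import Data.List as L using (List; []; _∷_; _++_)
open import Data.Bool.ListAction using (all; any)
open import Data.Product using (_×_; _,_; proj₁; proj₂)
open import Data.Fin.Subset
open import Relation.Binary.PropositionalEquality using (_≡_)

filterᵇ : {A : Set} → (A → Bool) → List A → List A
filterᵇ p [] = []
filterᵇ p (x ∷ xs) = if p x then x ∷ filterᵇ p xs else filterᵇ p xs

sumℤ : List ℤ → ℤ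
sumℤ = L.foldr ℤ._+_ (+ 0)

maxℕ : List ℕ → ℕ
maxℕ = L.foldr _⊔_ 0

subsets : ∀ m → List (Subset m)
subsets zero = [] ∷ []
subsets (suc m) = L.map (outside ∷_) (subsets m) ++ L.map (inside ∷_) (subsets m)

_⊆ᵇ_ : ∀ {m} → Subset m → Subset m → Bool
[] ⊆ᵇ [] = true
(x ∷ xs) ⊆ᵇ (y ∷ ys) = (not x ∨ y) ∧ (xs ⊆ᵇ ys)

_==ᵇ_ : ∀ {m} → Subset m → Subset m → Bool
X ==ᵇ Y = (X ⊆ᵇ Y) ∧ (Y ⊆ᵇ X)

subsetsOf : ∀ {m} → Subset m → List (Subset m)
subsetsOf {m} X = filterᵇ (_⊆ᵇ X) (subsets m)

sign : ℕ → ℤ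
sign zero = + 1
sign (suc n) = - sign n

-- Polynomials in t with integer coefficients, as coefficient functions

Poly : Set
Poly = ℕ → ℤ

δ : Poly
δ zero = + 1
δ (suc k) = + 0

conv : Poly → Poly → Poly
conv p q k = sumℤ (L.map (λ i → p i ℤ.* q (k ∸ i)) (L.upTo (suc k)))

-- t^r p(t⁻¹) (for deg p ≤ r)
rev : ℕ → Poly → Poly
rev r p k = if k ≤ᵇ r then p (r ∸ k) else + 0

-- Matroids, given by their rank function on a ground set E ⊆ Fin size

record RMat : Set where
  constructor rmat
  field
    size : ℕ
    E    : Subset size
    rk   : Subset size → ℕ
open RMat public

record IsMatroid (M : RMat) : Set where
  field
    rk-bound : ∀ X → X ⊆ E M → rk M X ≤ ∣ X ∣
    rk-mono  : ∀ X Y → Y ⊆ E M → X ⊆ Y → rk M X ≤ rk M Y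
    rk-submod : ∀ X Y → X ⊆ E M → Y ⊆ E M →
                rk M (X ∪ Y) ℕ.+ rk M (X ∩ Y) ≤ rk M X ℕ.+ rk M Y

Loopless : RMat → Set
Loopless M = ∀ e → e ∈ E M → rk M ⁅ e ⁆ ≡ 1

rank : RMat → ℕ
rank M = rk M (E M)

restrict : (M : RMat) → Subset (size M) → RMat
restrict M F = rmat (size M) F (rk M)

contract : (M : RMat) → Subset (size M) → RMat
contract M F = rmat (size M) (E M ─ F) (λ X → rk M (X ∪ F) ∸ rk M F)

isFlatᵇ : (M : RMat) → Subset (size M) → Bool
isFlatᵇ M F = (F ⊆ᵇ E M) ∧
  all (λ e → not (lookup (E M) e ∧ not (lookup F e)) ∨ (rk M F <ᵇ rk M (F ∪ ⁅ e ⁆)))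
        (L.allFin (size M))

flats : (M : RMat) → List (Subset (size M))
flats M = filterᵇ (isFlatᵇ M) (subsets (size M))

chi : RMat → Poly
chi M k = sumℤ (L.map (λ A → if (rank M ∸ rk M A) ≡ᵇ k then sign ∣ A ∣ else + 0)
                      (subsetsOf (E M)))

-- P is the Kazhdan–Lusztig assignment (the defining properties, for all
-- loopless matroids)
IsKL : (RMat → Poly) → Set
IsKL P = ∀ M → IsMatroid M → Loopless M →
    (rank M ≡ 0 → ∀ k → P M k ≡ δ k)
  × (0 < rank M → ∀ k → rank M ≤ 2 ℕ.* k → P M k ≡ + 0)
  × (∀ k → rev (rank M) (P M) k
           ≡ sumℤ (L.map (λ F → conv (chi (restrict M F)) (P (contract M F)) k) (flats M)))

Zpoly : (RMat → Poly) → RMat → Poly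
Zpoly P M k = sumℤ (L.map (λ F → if rank (restrict M F) ≤ᵇ k
                                   then P (contract M F) (k ∸ rank (restrict M F))
                                   else + 0) (flats M))

record Graph : Set where
  constructor graph
  field
    nV   : ℕ                 -- vertices 0 … nV-1
    nE   : ℕ
    ends : Fin nE → ℕ × ℕ
open Graph public

-- degree of vertex v in the edge set C (a loop counts twice)
degree : (G : Graph) → Subset (nE G) → ℕ → ℕ
degree G C v = V.sum (tabulate (λ e → if lookup C e
  then (if proj₁ (ends G e) ≡ᵇ v then 1 else 0) ℕ.+ (if proj₂ (ends G e) ≡ᵇ v then 1 else 0)
  else 0))

-- C is a nonempty edge set with all degrees 0 or 2, i.e. a nonempty
-- disjoint union of cycles
cyclesᵇ : (G : Graph) → Subset (nE G) → Bool
cyclesᵇ G C = (0 <ᵇ ∣ C ∣) ∧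
  all (λ v → (degree G C v ≡ᵇ 0) ∨ (degree G C v ≡ᵇ 2)) (L.upTo (nV G))

isForestᵇ : (G : Graph) → Subset (nE G) → Bool
isForestᵇ G X = not (any (cyclesᵇ G) (subsetsOf X))

fromIndep : (m : ℕ) → (Subset m → Bool) → RMat
fromIndep m ind = rmat m ⊤ (λ X → maxℕ (L.map ∣_∣ (filterᵇ ind (subsetsOf X))))

-- wheel graph W_n: vertices 0 (hub), 1 … n; edge j < n is the spoke {0, j+1},
-- edge n + r (r < n) is the rim edge {r+1, r+2} (with n+1 read as 1)
wheel : ℕ → Graph
wheel n = graph (suc n) (n ℕ.+ n) (λ j →
  if toℕ j <ᵇ n then (0 , suc (toℕ j))
  else (suc (toℕ j ∸ n) , (if suc (toℕ j ∸ n) ≡ᵇ n then 1 else suc (suc (toℕ j ∸ n)))))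

rim : (n : ℕ) → Subset (n ℕ.+ n)
rim n = tabulate (λ j → n ≤ᵇ toℕ j)

edgeGraph : Graph
edgeGraph = graph 2 1 (λ _ → (0 , 1))

-- the whirl W^n (n ≥ 1); W^0 is an unused dummy
Whirl : ℕ → RMat
Whirl zero = rmat 0 [] (λ _ → 0)
Whirl (suc zero) = fromIndep 1 (isForestᵇ edgeGraph)
Whirl (suc (suc n)) = fromIndep (m ℕ.+ m) (λ X → isForestᵇ (wheel m) X ∨ (X ==ᵇ rim m))
  where m = suc (suc n)

-- Power series in u over ℤ[t]: coefficient of u^n t^k

Ser : Set
Ser = ℕ → ℕ → ℤ

_+S_ : Ser → Ser → Ser
(f +S g) n k = f n k ℤ.+ g n k

_-S_ : Ser → Ser → Ser
(f -S g) n k = f n k ℤ.- g n k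

_*S_ : Ser → Ser → Ser
(f *S g) n k = sumℤ (L.map (λ i → sumℤ (L.map (λ j → f i j ℤ.* g (n ∸ i) (k ∸ j))
                                               (L.upTo (suc k))))
                            (L.upTo (suc n)))

infixl 6 _+S_ _-S_
infixl 7 _*S_

constS : ℤ → Ser
constS c zero zero = c
constS c _ _ = + 0

oneS : Ser
oneS = constS (+ 1)

tS : Ser
tS zero (suc zero) = + 1
tS _ _ = + 0

uS : Ser
uS (suc zero) zero = + 1
uS _ _ = + 0

Dser : Ser
Dser = (oneS -S (tS +S oneS) *S uS) *S (oneS -S (tS +S oneS) *S uS)
       -S constS (+ 4) *S tS *S uS *S uS

Zgen : (RMat → Poly) → Ser
Zgen P zero k = δ k
Zgen P (suc n) k = Zpoly P (Whirl (suc n)) k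

{-# OPTIONS --safe #-}
-- The Z-polynomial of W^n turns out to be Σ C(n,k)² t^k, i.e. it counts closed cyclic walks: a word is a
-- cyclic sequence of n letters (b , a) with as many ones as zeros in total, b and a being an up or a down
-- half-step, and its weight is the number of up-steps among the b.
-- A word determines a flat of W^n: the spokes at the vertices where the walk is at its global minimum,
-- and the rim edges whose letter is a peak (1 , 0).  The words lying over a flat K, counted by weight
-- minus rank, form the Kazhdan–Lusztig polynomial of the contraction at K.  This is forced by uniqueness
-- once, for every set X of elements, the words whose flat contains X are counted by a palindromic
-- polynomial; the palindromy is seen by exchanging the two half-steps at each vertex not fixed by X.
-- The rank of W^n is that of the bicircular matroid of a cycle with a loop at each vertex, given by the
-- min–max formula (least cost of a set of rim vertices); its cycles are recognised by counting degrees.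
-- Finally F = Σ C(n,k)² t^k u^n satisfies 2 D θF + (θD) F = 0 with θ = u d/du, so θ(F² D) = 0.
module Submission where

open import Defs
open import Algebra.Bundles using (CommutativeRing)
import Algebra.Properties.CommutativeMonoid.Mult
import Algebra.Properties.Ring
import Algebra.Properties.Semiring.Mult
import Algebra.Solver.Ring.NaturalCoefficients.Default
open import Data.Bool using (Bool; true; false; if_then_else_; _∧_; _∨_; not; T)
open import Data.Bool.ListAction using (all; any)
open import Data.Bool.Properties using (T-≡; ∧-zeroʳ; ∧-identityʳ; ∧-comm; ∧-assoc; ∨-zeroʳ)
open import Data.Empty using (⊥-elim)
open import Data.Fin using (Fin; toℕ; zero; suc; inject₁; _↑ˡ_; _↑ʳ_)
import Data.Fin.Properties as FP
open import Data.Fin.Subset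
open import Data.Fin.Subset.Properties
open import Data.Integer as ℤ using (ℤ; +_)
import Data.Integer.Properties as ℤP
open import Data.Integer.Tactic.RingSolver using (solve-∀)
open import Data.List as L using (List; []; _∷_; _++_)
open import Data.List.Membership.Propositional using () renaming (_∈_ to _∈ˡ_)
open import Data.List.Membership.Propositional.Properties using (∈-++⁺ˡ; ∈-++⁺ʳ; ∈-map⁺)
import Data.List.Properties as LP
open import Data.List.Relation.Unary.Any using (here; there)
open import Data.Nat as ℕ using (ℕ; zero; suc; _∸_; _≤_; _<_; _≡ᵇ_; _≤ᵇ_; _<ᵇ_; z≤n; s≤s)
open import Data.Nat.Induction using (<-rec)
import Data.Nat.Properties as ℕP
open import Data.Nat.Tactic.RingSolver using () renaming (solve-∀ to solve-∀ℕ)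
open import Data.Product using (_×_; _,_; proj₁; proj₂; ∃)
open import Data.Sum using (_⊎_; inj₁; inj₂)
open import Data.Vec as V using (Vec; []; _∷_; lookup; tabulate; _∷ʳ_)
import Data.Vec.Properties as VP
open import Function using (_∘_; id; Equivalence)
open import Level using (0ℓ)
open import Relation.Binary.PropositionalEquality using (_≡_; _≢_; refl; sym; trans; cong; cong₂; subst; subst₂; module ≡-Reasoning)
open import Relation.Nullary using (yes; no; ¬_)
open import Relation.Nullary.Decidable using (_×-dec_)

-- Finite sums

-- Why palindromy suffices: expand the characteristic polynomials over all subsets A by Whitney's
-- formula and collect the flats above A. What remains for each A is the count of words whose flat
-- contains A ∪ G, with exponent wt - r(A ∪ G). Palindromy replaces this exponent by n - wt, which
-- is free of A, and the alternating sum over A then keeps exactly the words over G. The price is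
-- that palindromy is needed at arbitrary sets, with their true rank as its centre. For balanced
-- words n - wt is the number of up-steps among the a, so the claim is that ups among the b and r(X)
-- + ups among the a are equally distributed. The obstacle is that the flat depends on the global
-- minimum of a cyclic walk. A spoke in X can be rotated to vertex 0, where it pins the height to 0
-- and leaves a linear nonnegative walk; if X has no spoke, the heights impose no condition.
-- Half-steps allow the minimum to lie inside a rim edge, and the flat then has no spoke. A second
-- obstacle is that P acts on presentations of matroids and iterated contractions agree only
-- pointwise, so uniqueness is proved for every presentation of a contraction.

∑ : {A : Set} → List A → (A → ℤ) → ℤ
∑ xs f = sumℤ (L.map f xs)

⟦_⟧ : Bool → ℤ
⟦ true ⟧ = + 1
⟦ false ⟧ = + 0

⟦⟧-if : ∀ b (x : ℤ) → (if b then x else + 0) ≡ ⟦ b ⟧ ℤ.* x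
⟦⟧-if true x = sym (ℤP.*-identityˡ x)
⟦⟧-if false x = sym (ℤP.*-zeroˡ x)

⟦⟧-∧ : ∀ a b → ⟦ a ∧ b ⟧ ≡ ⟦ a ⟧ ℤ.* ⟦ b ⟧
⟦⟧-∧ true b = sym (ℤP.*-identityˡ ⟦ b ⟧)
⟦⟧-∧ false b = sym (ℤP.*-zeroˡ ⟦ b ⟧)

∑-cong : {A : Set} (xs : List A) {f g : A → ℤ} → (∀ x → f x ≡ g x) → ∑ xs f ≡ ∑ xs g
∑-cong [] e = refl
∑-cong (x ∷ xs) e = cong₂ ℤ._+_ (e x) (∑-cong xs e)

∑-+ : {A : Set} (xs : List A) (f g : A → ℤ) →
      ∑ xs (λ x → f x ℤ.+ g x) ≡ ∑ xs f ℤ.+ ∑ xs g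
∑-+ [] f g = refl
∑-+ (x ∷ xs) f g rewrite ∑-+ xs f g = lemma (f x) (g x) (∑ xs f) (∑ xs g)
  where
  lemma : ∀ a b c d → a ℤ.+ b ℤ.+ (c ℤ.+ d) ≡ a ℤ.+ c ℤ.+ (b ℤ.+ d)
  lemma = solve-∀

∑-*ˡ : {A : Set} (xs : List A) (c : ℤ) (f : A → ℤ) →
       ∑ xs (λ x → c ℤ.* f x) ≡ c ℤ.* ∑ xs f
∑-*ˡ [] c f = sym (ℤP.*-zeroʳ c)
∑-*ˡ (x ∷ xs) c f rewrite ∑-*ˡ xs c f = sym (ℤP.*-distribˡ-+ c (f x) (∑ xs f))

∑-zero : {A : Set} (xs : List A) → ∑ xs (λ _ → + 0) ≡ + 0
∑-zero [] = refl
∑-zero (x ∷ xs) rewrite ∑-zero xs = refl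

∑-swap : {A B : Set} (xs : List A) (ys : List B) (f : A → B → ℤ) →
         ∑ xs (λ x → ∑ ys (f x)) ≡ ∑ ys (λ y → ∑ xs (λ x → f x y))
∑-swap [] ys f = sym (∑-zero ys)
∑-swap (x ∷ xs) ys f rewrite ∑-swap xs ys f =
  sym (∑-+ ys (f x) (λ y → ∑ xs (λ x → f x y)))

∑-++ : {A : Set} (xs ys : List A) (f : A → ℤ) → ∑ (xs ++ ys) f ≡ ∑ xs f ℤ.+ ∑ ys f
∑-++ [] ys f = sym (ℤP.+-identityˡ _)
∑-++ (x ∷ xs) ys f rewrite ∑-++ xs ys f = sym (ℤP.+-assoc (f x) (∑ xs f) (∑ ys f))

∑-map : {A B : Set} (h : A → B) (xs : List A) (f : B → ℤ) → ∑ (L.map h xs) f ≡ ∑ xs (f ∘ h)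
∑-map h [] f = refl
∑-map h (x ∷ xs) f = cong (λ s → f (h x) ℤ.+ s) (∑-map h xs f)

∑-filter : {A : Set} (p : A → Bool) (xs : List A) (f : A → ℤ) →
           ∑ (filterᵇ p xs) f ≡ ∑ xs (λ x → ⟦ p x ⟧ ℤ.* f x)
∑-filter p [] f = refl
∑-filter p (x ∷ xs) f with p x
... | true = cong₂ ℤ._+_ (sym (ℤP.*-identityˡ (f x))) (∑-filter p xs f)
... | false = trans (∑-filter p xs f)
   (trans (sym (ℤP.+-identityˡ _)) (cong (λ z → z ℤ.+ ∑ xs (λ y → ⟦ p y ⟧ ℤ.* f y)) (sym (ℤP.*-zeroˡ (f x)))))

∑-subsets-suc : ∀ m (f : Subset (suc m) → ℤ) →
  ∑ (subsets (suc m)) f ≡ ∑ (subsets m) (λ X → f (false ∷ X)) ℤ.+ ∑ (subsets m) (λ X → f (true ∷ X))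
∑-subsets-suc m f = trans (∑-++ (L.map (outside ∷_) (subsets m)) _ f)
  (cong₂ ℤ._+_ (∑-map (outside ∷_) (subsets m) f) (∑-map (inside ∷_) (subsets m) f))

∑-zero′ : {A : Set} (xs : List A) {f : A → ℤ} → (∀ x → f x ≡ + 0) → ∑ xs f ≡ + 0
∑-zero′ xs e = trans (∑-cong xs e) (∑-zero xs)

∑-δ : ∀ m (Y : Subset m) (f : Subset m → ℤ) →
      ∑ (subsets m) (λ X → ⟦ X ==ᵇ Y ⟧ ℤ.* f X) ≡ f Y
∑-δ zero [] f = lemma (f [])
  where
  lemma : ∀ a → (+ 1 ℤ.* a) ℤ.+ + 0 ≡ a
  lemma = solve-∀
∑-δ (suc m) (false ∷ Y) f = trans (∑-subsets-suc m _) (trans (cong₂ ℤ._+_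
   (∑-δ m Y (f ∘ (false ∷_)))
   (∑-zero′ (subsets m) λ X → ℤP.*-zeroˡ (f (true ∷ X)))) (ℤP.+-identityʳ _))
∑-δ (suc m) (true ∷ Y) f = trans (∑-subsets-suc m _) (trans (cong₂ ℤ._+_
   (∑-zero′ (subsets m) λ X → trans (cong (λ b → ⟦ b ⟧ ℤ.* f (false ∷ X)) (lem (X ⊆ᵇ Y))) (ℤP.*-zeroˡ (f (false ∷ X))))
   (∑-δ m Y (f ∘ (true ∷_)))) (ℤP.+-identityˡ _))
  where
  lem : ∀ b → b ∧ false ≡ false
  lem true = refl
  lem false = refl

-- Inclusion-exclusion: this is where the signs of the characteristic polynomials cancel.
∑-sign : ∀ m (D : Subset m) → ∑ (subsets m) (λ A → ⟦ A ⊆ᵇ D ⟧ ℤ.* sign ∣ A ∣) ≡ ⟦ D ==ᵇ ⊥ ⟧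
∑-sign zero [] = refl
∑-sign (suc m) (false ∷ D) = trans (∑-subsets-suc m _) (trans (cong₂ ℤ._+_ (∑-sign m D)
  (∑-zero′ (subsets m) λ X → ℤP.*-zeroˡ (sign (suc ∣ X ∣)))) (ℤP.+-identityʳ _))
∑-sign (suc m) (true ∷ D) = trans (∑-subsets-suc m _) (trans (sym (∑-+ (subsets m) _ _))
  (∑-zero′ (subsets m) λ X → lemma ⟦ X ⊆ᵇ D ⟧ (sign ∣ X ∣)))
  where
  lemma : ∀ a b → a ℤ.* b ℤ.+ a ℤ.* (ℤ.- b) ≡ + 0
  lemma = solve-∀

sub-refl : ∀ {m} (X : Subset m) → (X ⊆ᵇ X) ≡ true
sub-refl [] = refl
sub-refl (true ∷ X) = sub-refl X
sub-refl (false ∷ X) = sub-refl X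

∈-lookup : ∀ {m} {X : Subset m} {x} → x ∈ X → lookup X x ≡ true
∈-lookup V.here = refl
∈-lookup (V.there p) = ∈-lookup p

lookup-∈ : ∀ {m} (X : Subset m) x → lookup X x ≡ true → x ∈ X
lookup-∈ (true ∷ X) zero refl = V.here
lookup-∈ (_ ∷ X) (suc x) e = V.there (lookup-∈ X x e)

∧-true : ∀ {a b} → a ∧ b ≡ true → a ≡ true × b ≡ true
∧-true {true} {true} refl = refl , refl

⊆ᵇ⇒⊆ : ∀ {m} {X Y : Subset m} → (X ⊆ᵇ Y) ≡ true → X ⊆ Y
⊆ᵇ⇒⊆ {X = true ∷ X} {true ∷ Y} e V.here = V.here
⊆ᵇ⇒⊆ {X = x ∷ X} {y ∷ Y} e (V.there p) = V.there (⊆ᵇ⇒⊆ (proj₂ (∧-true {not x ∨ y} e)) p)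

⊆⇒⊆ᵇ : ∀ {m} {X Y : Subset m} → X ⊆ Y → (X ⊆ᵇ Y) ≡ true
⊆⇒⊆ᵇ {X = []} {[]} s = refl
⊆⇒⊆ᵇ {X = true ∷ X} {y ∷ Y} s with s V.here
... | V.here = ⊆⇒⊆ᵇ (drop-∷-⊆ s)
⊆⇒⊆ᵇ {X = false ∷ X} {y ∷ Y} s = ⊆⇒⊆ᵇ (drop-∷-⊆ s)

==ᵇ⇒≡ : ∀ {m} {X Y : Subset m} → (X ==ᵇ Y) ≡ true → X ≡ Y
==ᵇ⇒≡ {X = []} {[]} e = refl
==ᵇ⇒≡ {X = true ∷ X} {true ∷ Y} e = cong (true ∷_) (==ᵇ⇒≡ e)
==ᵇ⇒≡ {X = false ∷ X} {false ∷ Y} e = cong (false ∷_) (==ᵇ⇒≡ e)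
==ᵇ⇒≡ {X = true ∷ X} {false ∷ Y} ()
==ᵇ⇒≡ {X = false ∷ X} {true ∷ Y} e with () ← proj₂ (∧-true {X ⊆ᵇ Y} e)

==ᵇ-refl : ∀ {m} (X : Subset m) → (X ==ᵇ X) ≡ true
==ᵇ-refl X rewrite sub-refl X = refl

-- Flats and contractions

true≢false : true ≢ false
true≢false ()

bool-ext : ∀ {a b} → (a ≡ true → b ≡ true) → (b ≡ true → a ≡ true) → a ≡ b
bool-ext {true} {true} f g = refl
bool-ext {true} {false} f g = sym (f refl)
bool-ext {false} {true} f g = g refl
bool-ext {false} {false} f g = refl

≡ᵇ⇒≡ : ∀ {a b} → (a ≡ᵇ b) ≡ true → a ≡ b
≡ᵇ⇒≡ {a} {b} e = ℕP.≡ᵇ⇒≡ a b (subst T (sym e) _)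

≡⇒≡ᵇ : ∀ {a b} → a ≡ b → (a ≡ᵇ b) ≡ true
≡⇒≡ᵇ {a} {b} e = Equivalence.to T-≡ (ℕP.≡⇒≡ᵇ a b e)

≤ᵇ⇒≤ : ∀ {a b} → (a ≤ᵇ b) ≡ true → a ≤ b
≤ᵇ⇒≤ {a} {b} e = ℕP.≤ᵇ⇒≤ a b (subst T (sym e) _)

≤⇒≤ᵇ : ∀ {a b} → a ≤ b → (a ≤ᵇ b) ≡ true
≤⇒≤ᵇ {a} {b} e = Equivalence.to T-≡ (ℕP.≤⇒≤ᵇ e)

<ᵇ⇒< : ∀ {a b} → (a <ᵇ b) ≡ true → a < b
<ᵇ⇒< {a} {b} e = ℕP.<ᵇ⇒< a b (subst T (sym e) _)

<⇒<ᵇ : ∀ {a b} → a < b → (a <ᵇ b) ≡ true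
<⇒<ᵇ {a} {b} e = Equivalence.to T-≡ (ℕP.<⇒<ᵇ e)

∑-cong-if : {A : Set} (xs : List A) (p : A → Bool) {f g : A → ℤ} →
  (∀ x → p x ≡ true → f x ≡ g x) → ∑ xs (λ x → ⟦ p x ⟧ ℤ.* f x) ≡ ∑ xs (λ x → ⟦ p x ⟧ ℤ.* g x)
∑-cong-if xs p {f} {g} h = ∑-cong xs λ x → go x (p x) refl
  where
  go : ∀ x b → p x ≡ b → ⟦ b ⟧ ℤ.* f x ≡ ⟦ b ⟧ ℤ.* g x
  go x true e = cong (λ z → + 1 ℤ.* z) (h x e)
  go x false e = trans (ℤP.*-zeroˡ (f x)) (sym (ℤP.*-zeroˡ (g x)))

∑-upTo-suc : ∀ n (f : ℕ → ℤ) → ∑ (L.upTo (suc n)) f ≡ f 0 ℤ.+ ∑ (L.upTo n) (f ∘ suc)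
∑-upTo-suc n f = cong (λ s → f 0 ℤ.+ s)
  (trans (cong (λ l → ∑ l f) (sym (LP.map-upTo suc n))) (∑-map suc (L.upTo n) f))

∑-upTo-δ : ∀ n d (f : ℕ → ℤ) → ∑ (L.upTo n) (λ i → ⟦ d ≡ᵇ i ⟧ ℤ.* f i) ≡ ⟦ d <ᵇ n ⟧ ℤ.* f d
∑-upTo-δ zero d f = sym (ℤP.*-zeroˡ (f d))
∑-upTo-δ (suc n) zero f = trans (∑-upTo-suc n (λ i → ⟦ 0 ≡ᵇ i ⟧ ℤ.* f i))
  (trans (cong (λ s → + 1 ℤ.* f 0 ℤ.+ s) (∑-zero′ (L.upTo n) λ i → ℤP.*-zeroˡ (f (suc i))))
         (ℤP.+-identityʳ _))
∑-upTo-δ (suc n) (suc d) f = trans (∑-upTo-suc n (λ i → ⟦ suc d ≡ᵇ i ⟧ ℤ.* f i))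
  (trans (cong (λ s → + 0 ℤ.* f 0 ℤ.+ s) (∑-upTo-δ n d (f ∘ suc)))
   (trans (cong (λ z → z ℤ.+ ⟦ d <ᵇ n ⟧ ℤ.* f (suc d)) (ℤP.*-zeroˡ (f 0))) (ℤP.+-identityˡ _)))

shift : ℕ → Poly → Poly
shift d q j = ⟦ d ≤ᵇ j ⟧ ℤ.* q (j ∸ d)

<ᵇ-suc : ∀ d j → (d <ᵇ suc j) ≡ (d ≤ᵇ j)
<ᵇ-suc zero j = refl
<ᵇ-suc (suc d) j = refl

-- Whitney's subset expansion turns the product with a characteristic polynomial into signed shifts
-- of `q`, so no Möbius function of the lattice of flats enters.
conv-chi : ∀ (N : RMat) F q j →
  conv (chi (restrict N F)) q j ≡
  ∑ (subsets (size N)) (λ A → ⟦ A ⊆ᵇ F ⟧ ℤ.* (sign ∣ A ∣ ℤ.* shift (rk N F ∸ rk N A) q j))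
conv-chi N F q j = begin
  ∑ (L.upTo (suc j)) (λ i → chi (restrict N F) i ℤ.* q (j ∸ i))
    ≡⟨ ∑-cong (L.upTo (suc j)) (λ i → trans (ℤP.*-comm (chi (restrict N F) i) (q (j ∸ i)))
         (sym (∑-*ˡ (subsetsOf F) (q (j ∸ i)) _))) ⟩
  ∑ (L.upTo (suc j)) (λ i → ∑ (subsetsOf F) (λ A → q (j ∸ i) ℤ.* (if dd A ≡ᵇ i then sign ∣ A ∣ else + 0)))
    ≡⟨ ∑-swap (L.upTo (suc j)) (subsetsOf F) _ ⟩
  ∑ (subsetsOf F) (λ A → ∑ (L.upTo (suc j)) (λ i → q (j ∸ i) ℤ.* (if dd A ≡ᵇ i then sign ∣ A ∣ else + 0)))
    ≡⟨ ∑-cong (subsetsOf F) (λ A → trans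
         (∑-cong (L.upTo (suc j)) (λ i → trans (cong (λ z → q (j ∸ i) ℤ.* z) (⟦⟧-if (dd A ≡ᵇ i) (sign ∣ A ∣)))
                                   (rearr (q (j ∸ i)) ⟦ dd A ≡ᵇ i ⟧ (sign ∣ A ∣))))
         (trans (∑-*ˡ (L.upTo (suc j)) (sign ∣ A ∣) _)
                (cong (λ z → sign ∣ A ∣ ℤ.* z) (trans (∑-upTo-δ (suc j) (dd A) (λ i → q (j ∸ i)))
                   (cong (λ b → ⟦ b ⟧ ℤ.* q (j ∸ dd A)) (<ᵇ-suc (dd A) j)))))) ⟩
  ∑ (subsetsOf F) (λ A → sign ∣ A ∣ ℤ.* shift (dd A) q j)
    ≡⟨ ∑-filter (_⊆ᵇ F) (subsets (size N)) _ ⟩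
  ∑ (subsets (size N)) (λ A → ⟦ A ⊆ᵇ F ⟧ ℤ.* (sign ∣ A ∣ ℤ.* shift (dd A) q j)) ∎
  where
  open ≡-Reasoning
  dd : Subset (size N) → ℕ
  dd A = rk N F ∸ rk N A
  rearr : ∀ a b c → a ℤ.* (b ℤ.* c) ≡ c ℤ.* (b ℤ.* a)
  rearr = solve-∀

⊆ᵇ-∪-─ : ∀ {m} (A G K : Subset m) →
  (G ⊆ᵇ K) ∧ (A ⊆ᵇ (K ─ G)) ≡ (A ⊆ᵇ (⊤ ─ G)) ∧ ((A ∪ G) ⊆ᵇ K)
⊆ᵇ-∪-─ [] [] [] = refl
⊆ᵇ-∪-─ (false ∷ A) (false ∷ G) (k ∷ K) = ⊆ᵇ-∪-─ A G K
⊆ᵇ-∪-─ (false ∷ A) (true ∷ G) (true ∷ K) = ⊆ᵇ-∪-─ A G K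
⊆ᵇ-∪-─ (false ∷ A) (true ∷ G) (false ∷ K) = sym (∧-zeroʳ _)
⊆ᵇ-∪-─ (true ∷ A) (false ∷ G) (true ∷ K) = ⊆ᵇ-∪-─ A G K
⊆ᵇ-∪-─ (true ∷ A) (false ∷ G) (false ∷ K) = trans (∧-zeroʳ _) (sym (∧-zeroʳ _))
⊆ᵇ-∪-─ (true ∷ A) (true ∷ G) (true ∷ K) = ∧-zeroʳ _
⊆ᵇ-∪-─ (true ∷ A) (true ∷ G) (false ∷ K) = refl

==ᵇ-─⊥ : ∀ {m} (G K : Subset m) → (G ⊆ᵇ K) ∧ ((K ─ G) ==ᵇ ⊥) ≡ (K ==ᵇ G)
==ᵇ-─⊥ G K = bool-ext (to {G = G} {K}) from
  where
  to : ∀ {m} {G K : Subset m} → (G ⊆ᵇ K) ∧ ((K ─ G) ==ᵇ ⊥) ≡ true → (K ==ᵇ G) ≡ true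
  to {G = []} {[]} e = refl
  to {G = false ∷ G} {false ∷ K} e = to {G = G} {K} e
  to {G = true ∷ G} {true ∷ K} e = to {G = G} {K} e
  to {G = false ∷ G} {true ∷ K} e with () ← proj₂ (∧-true {G ⊆ᵇ K} e)
  from : (K ==ᵇ G) ≡ true → (G ⊆ᵇ K) ∧ ((K ─ G) ==ᵇ ⊥) ≡ true
  from e with ==ᵇ⇒≡ {X = K} {G} e
  ... | refl = lem K
    where
    lem : ∀ {m} (K : Subset m) → (K ⊆ᵇ K) ∧ ((K ─ K) ==ᵇ ⊥) ≡ true
    lem [] = refl
    lem (true ∷ K) = lem K
    lem (false ∷ K) = lem K

─-∪-cancel : ∀ {m} (G K : Subset m) → (G ⊆ᵇ K) ≡ true → (K ─ G) ∪ G ≡ K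
─-∪-cancel [] [] e = refl
─-∪-cancel (true ∷ G) (true ∷ K) e = cong (true ∷_) (─-∪-cancel G K e)
─-∪-cancel (false ∷ G) (true ∷ K) e = cong (true ∷_) (─-∪-cancel G K e)
─-∪-cancel (false ∷ G) (false ∷ K) e = cong (false ∷_) (─-∪-cancel G K e)

∪-─-cancel : ∀ {m} (G F : Subset m) → (F ⊆ᵇ (⊤ ─ G)) ≡ true → (F ∪ G) ─ G ≡ F
∪-─-cancel [] [] e = refl
∪-─-cancel (true ∷ G) (false ∷ F) e = cong (false ∷_) (∪-─-cancel G F e)
∪-─-cancel (false ∷ G) (true ∷ F) e = cong (true ∷_) (∪-─-cancel G F e)
∪-─-cancel (false ∷ G) (false ∷ F) e = cong (false ∷_) (∪-─-cancel G F e)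

⊆ᵇ-∪ʳ : ∀ {m} (F G : Subset m) → (G ⊆ᵇ (F ∪ G)) ≡ true
⊆ᵇ-∪ʳ F G = ⊆⇒⊆ᵇ (q⊆p∪q F G)

∪-∪-⊤ : ∀ {m} (G : Subset m) → (⊤ ─ G) ∪ G ≡ ⊤
∪-∪-⊤ [] = refl
∪-∪-⊤ (true ∷ G) = cong (true ∷_) (∪-∪-⊤ G)
∪-∪-⊤ (false ∷ G) = cong (true ∷_) (∪-∪-⊤ G)

∪-distrib-∪ : ∀ {m} (X Y G : Subset m) → (X ∪ G) ∪ (Y ∪ G) ≡ (X ∪ Y) ∪ G
∪-distrib-∪ [] [] [] = refl
∪-distrib-∪ (true ∷ X) (y ∷ Y) (g ∷ G) = cong (true ∷_) (∪-distrib-∪ X Y G)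
∪-distrib-∪ (false ∷ X) (true ∷ Y) (true ∷ G) = cong (true ∷_) (∪-distrib-∪ X Y G)
∪-distrib-∪ (false ∷ X) (true ∷ Y) (false ∷ G) = cong (true ∷_) (∪-distrib-∪ X Y G)
∪-distrib-∪ (false ∷ X) (false ∷ Y) (true ∷ G) = cong (true ∷_) (∪-distrib-∪ X Y G)
∪-distrib-∪ (false ∷ X) (false ∷ Y) (false ∷ G) = cong (false ∷_) (∪-distrib-∪ X Y G)

∈-─⁻ : ∀ {m} {X Y : Subset m} {x} → x ∈ X ─ Y → x ∈ X × x ∉ Y
∈-─⁻ {X = X} {Y} {x} p = p─q⊆p X Y p , λ q → go X Y x q p
  where
  go : ∀ {m} (X Y : Subset m) x → x ∈ Y → ¬ (x ∈ X ─ Y)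
  go (_ ∷ X) (true ∷ Y) zero V.here ()
  go (_ ∷ X) (_ ∷ Y) (suc x) (V.there p) (V.there q) = go X Y x p q

Flat : ∀ {m} → (Subset m → ℕ) → Subset m → Set
Flat r G = ∀ x → x ∉ G → r G < r (G ∪ ⁅ x ⁆)

all-allFin⁻ : ∀ {m} (p : Fin m → Bool) → all p (L.allFin m) ≡ true → ∀ i → p i ≡ true
all-allFin⁻ {m} p e i = go p e i
  where
  go : ∀ {m} {A : Set} {f : Fin m → A} (p : A → Bool) → all p (L.tabulate f) ≡ true → ∀ i → p (f i) ≡ true
  go {suc m} {f = f} p e zero = proj₁ (∧-true {p (f zero)} e)
  go {suc m} {f = f} p e (suc i) = go {f = f ∘ suc} p (proj₂ (∧-true {p (f zero)} e)) i

all-allFin⁺ : ∀ {m} (p : Fin m → Bool) → (∀ i → p i ≡ true) → all p (L.allFin m) ≡ true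
all-allFin⁺ {m} p h = go id h
  where
  go : ∀ {m} {A : Set} (f : Fin m → A) {p : A → Bool} → (∀ i → p (f i) ≡ true) → all p (L.tabulate f) ≡ true
  go {zero} f h = refl
  go {suc m} f h rewrite h zero = go (f ∘ suc) (h ∘ suc)

isFlat⁻ : ∀ N F → isFlatᵇ N F ≡ true →
  F ⊆ E N × (∀ x → x ∈ E N → x ∉ F → rk N F < rk N (F ∪ ⁅ x ⁆))
isFlat⁻ N F e = ⊆ᵇ⇒⊆ (proj₁ split) , λ x x∈E x∉F → go x (all-allFin⁻ _ (proj₂ split) x) (∈-lookup x∈E) (lookup-∉ x x∉F)
  where
  split = ∧-true {F ⊆ᵇ E N} e
  lookup-∉ : ∀ x → x ∉ F → lookup F x ≡ false
  lookup-∉ x x∉F with lookup F x in eq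
  ... | true = ⊥-elim (x∉F (lookup-∈ F x eq))
  ... | false = refl
  go : ∀ x → (not (lookup (E N) x ∧ not (lookup F x)) ∨ (rk N F <ᵇ rk N (F ∪ ⁅ x ⁆))) ≡ true →
       lookup (E N) x ≡ true → lookup F x ≡ false → rk N F < rk N (F ∪ ⁅ x ⁆)
  go x h a b rewrite a | b = <ᵇ⇒< h

isFlat⁺ : ∀ N F → F ⊆ E N → (∀ x → x ∈ E N → x ∉ F → rk N F < rk N (F ∪ ⁅ x ⁆)) →
  isFlatᵇ N F ≡ true
isFlat⁺ N F F⊆E h rewrite ⊆⇒⊆ᵇ F⊆E = all-allFin⁺ _ go
  where
  go : ∀ x → (not (lookup (E N) x ∧ not (lookup F x)) ∨ (rk N F <ᵇ rk N (F ∪ ⁅ x ⁆))) ≡ true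
  go x with lookup (E N) x in eE | lookup F x in eF
  ... | false | _ = refl
  ... | true | true = refl
  ... | true | false = <⇒<ᵇ (h x (lookup-∈ (E N) x eE) λ p → true≢false (trans (sym (∈-lookup p)) eF))

∪-swap : ∀ {m} (A B C : Subset m) → (A ∪ B) ∪ C ≡ (A ∪ C) ∪ B
∪-swap A B C = trans (∪-assoc A B C) (trans (cong (A ∪_) (∪-comm B C)) (sym (∪-assoc A C B)))

module Contraction {m : ℕ} (r : Subset m → ℕ) (mat : IsMatroid (rmat m ⊤ r)) where

  open IsMatroid mat

  mono : ∀ {X Y} → X ⊆ Y → r X ≤ r Y
  mono {X} {Y} = rk-mono X Y ⊆⊤

  -- Contracting twice yields a rank function that agrees with that of a single contraction only
  -- pointwise, and `P` need not respect such agreement. Hence `N` is any presentation of the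
  -- contraction at `G`. The additive form of `inv` avoids truncated subtraction.
  record Contracts (G : Subset m) (N : RMat) : Set where
    constructor contracts
    field
      r′ : Subset m → ℕ
      N≡ : N ≡ rmat m (⊤ ─ G) r′
      inv : ∀ X → r′ X ℕ.+ r G ≡ r (X ∪ G)

  contract-contracts : ∀ {G r′} → (∀ X → r′ X ℕ.+ r G ≡ r (X ∪ G)) →
    ∀ F → Contracts (F ∪ G) (contract (rmat m (⊤ ─ G) r′) F)
  contract-contracts {G} {r′} inv F = contracts _
    (cong (λ E′ → rmat m E′ _) (trans (p─q─r≡p─q∪r ⊤ G F) (cong (⊤ ─_) (∪-comm G F)))) λ X →
    ℕP.+-cancelʳ-≡ (r′ F ℕ.+ r G) _ _ (begin
      (r′ (X ∪ F) ∸ r′ F) ℕ.+ r (F ∪ G) ℕ.+ (r′ F ℕ.+ r G) ≡⟨ lem (r′ (X ∪ F) ∸ r′ F) (r (F ∪ G)) (r′ F) (r G) ⟩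
      ((r′ (X ∪ F) ∸ r′ F) ℕ.+ r′ F) ℕ.+ r G ℕ.+ r (F ∪ G)
        ≡⟨ cong (λ z → z ℕ.+ r G ℕ.+ r (F ∪ G)) (ℕP.m∸n+n≡m (≤′ X)) ⟩
      r′ (X ∪ F) ℕ.+ r G ℕ.+ r (F ∪ G) ≡⟨ cong₂ ℕ._+_ (trans (inv (X ∪ F)) (cong r (∪-assoc X F G))) (sym (inv F)) ⟩
      r (X ∪ (F ∪ G)) ℕ.+ (r′ F ℕ.+ r G) ∎)
    where
    open ≡-Reasoning
    lem : ∀ a b c d → a ℕ.+ b ℕ.+ (c ℕ.+ d) ≡ a ℕ.+ c ℕ.+ d ℕ.+ b
    lem = solve-∀ℕ
    ≤′ : ∀ X → r′ F ≤ r′ (X ∪ F)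
    ≤′ X = ℕP.+-cancelʳ-≤ (r G) _ _ (subst₂ _≤_ (sym (inv F)) (sym (inv (X ∪ F)))
      (mono (λ p → x∈p∪q⁺ (Data.Sum.map (q⊆p∪q X F) id (x∈p∪q⁻ F G p)))))

  r⊥ : r ⊥ ≡ 0
  r⊥ = ℕP.n≤0⇒n≡0 (subst (r ⊥ ≤_) (∣⊥∣≡0 m) (rk-bound ⊥ ⊆⊤))

  subadd : ∀ X G → r (X ∪ G) ≤ r X ℕ.+ r G
  subadd X G = ℕP.≤-trans (ℕP.m≤m+n _ _) (rk-submod X G ⊆⊤ ⊆⊤)

  module _ {G} (r′ : Subset m → ℕ) (inv : ∀ X → r′ X ℕ.+ r G ≡ r (X ∪ G)) where

    cancel : ∀ {a b X} → a ℕ.+ r G ≡ r X → ∀ {Y} → b ℕ.+ r G ≡ r Y → r X ≤ r Y → a ≤ b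
    cancel p q le = ℕP.+-cancelʳ-≤ (r G) _ _ (subst₂ _≤_ (sym p) (sym q) le)

    contraction-matroid : IsMatroid (rmat m (⊤ ─ G) r′)
    contraction-matroid = record
      { rk-bound = λ X _ → ℕP.≤-trans
          (ℕP.+-cancelʳ-≤ (r G) _ _ (subst (_≤ r X ℕ.+ r G) (sym (inv X)) (subadd X G)))
          (rk-bound X ⊆⊤)
      ; rk-mono = λ X Y _ X⊆Y → cancel {X = X ∪ G} (inv X) {Y ∪ G} (inv Y)
          (mono λ p → x∈p∪q⁺ (Data.Sum.map X⊆Y id (x∈p∪q⁻ X G p)))
      ; rk-submod = λ X Y _ _ → ℕP.+-cancelʳ-≤ (r G ℕ.+ r G) _ _ (subst₂ _≤_
          (trans (cong₂ ℕ._+_ (trans (cong r (∪-distrib-∪ X Y G)) (sym (inv (X ∪ Y))))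
                               (trans (cong r (sym (∪-distribʳ-∩ G X Y))) (sym (inv (X ∩ Y)))))
                 (lem (r′ (X ∪ Y)) (r G) (r′ (X ∩ Y))))
          (trans (sym (cong₂ ℕ._+_ (inv X) (inv Y))) (lem (r′ X) (r G) (r′ Y)))
          (rk-submod (X ∪ G) (Y ∪ G) ⊆⊤ ⊆⊤))
      }
      where
      lem : ∀ a b c → (a ℕ.+ b) ℕ.+ (c ℕ.+ b) ≡ (a ℕ.+ c) ℕ.+ (b ℕ.+ b)
      lem = solve-∀ℕ

    contraction-loopless : Flat r G → Loopless (rmat m (⊤ ─ G) r′)
    contraction-loopless fl e e∈ = ℕP.≤-antisym
      (subst (r′ ⁅ e ⁆ ≤_) (∣⁅x⁆∣≡1 e) (IsMatroid.rk-bound contraction-matroid ⁅ e ⁆ ⁅e⁆⊆))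
      (ℕP.+-cancelʳ-≤ (r G) _ _ (subst (suc (r G) ≤_) (trans (cong r (∪-comm G ⁅ e ⁆)) (sym (inv ⁅ e ⁆)))
          (fl e (proj₂ (∈-─⁻ e∈)))))
      where
      ⁅e⁆⊆ : ⁅ e ⁆ ⊆ ⊤ ─ G
      ⁅e⁆⊆ p rewrite x∈⁅y⁆⇒x≡y e p = e∈

    contraction-rank : r′ (⊤ ─ G) ℕ.+ r G ≡ r ⊤
    contraction-rank = trans (inv (⊤ ─ G)) (cong r (∪-∪-⊤ G))

    contraction-flat⁺ : ∀ K → Flat r K → (G ⊆ᵇ K) ≡ true → isFlatᵇ (rmat m (⊤ ─ G) r′) (K ─ G) ≡ true
    contraction-flat⁺ K fl G⊆K = isFlat⁺ (rmat m (⊤ ─ G) r′) (K ─ G) sub λ x x∈ x∉ → ℕP.+-cancelʳ-≤ (r G) _ _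
      (subst₂ (λ a b → suc a ≤ b) (trans (cong r (sym K≡)) (sym (inv (K ─ G))))
         (trans (cong r (trans (cong (_∪ ⁅ x ⁆) (sym K≡)) (∪-swap (K ─ G) G ⁅ x ⁆))) (sym (inv ((K ─ G) ∪ ⁅ x ⁆))))
         (fl x λ x∈K → x∉ (x∈p∧x∉q⇒x∈p─q x∈K (proj₂ (∈-─⁻ x∈)))))
      where
      K≡ = ─-∪-cancel G K G⊆K
      sub : K ─ G ⊆ ⊤ ─ G
      sub p = x∈p∧x∉q⇒x∈p─q ∈⊤ (proj₂ (∈-─⁻ {X = K} p))

    contraction-flat⁻ : ∀ F → isFlatᵇ (rmat m (⊤ ─ G) r′) F ≡ true → Flat r (F ∪ G)
    contraction-flat⁻ F e x x∉ = subst₂ (λ a b → suc a ≤ b) (inv F)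
       (trans (inv (F ∪ ⁅ x ⁆)) (cong r (∪-swap F ⁅ x ⁆ G)))
       (ℕP.+-monoˡ-≤ (r G) (proj₂ (isFlat⁻ (rmat m (⊤ ─ G) r′) F e) x
          (x∈p∧x∉q⇒x∈p─q ∈⊤ (λ p → x∉ (q⊆p∪q F G p))) (λ p → x∉ (p⊆p∪q G p))))

-- Kazhdan–Lusztig polynomials from a palindromic model

-- A word over a flat `G` of weight r G + k is to contribute 1 to the coefficient of t^k in the
-- Kazhdan-Lusztig polynomial of the contraction at `G`. The fields `degree<` and `top` are then the
-- degree bound and the normalisation. `palindromic` ranges over all sets because Whitney's
-- expansion does, and the test function `ψ` expresses equality of two weight distributions.
record KLModel {m : ℕ} (r : Subset m → ℕ) (n : ℕ) : Set₁ where
  field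
    matroid : IsMatroid (rmat m ⊤ r)
    rank≡n  : r ⊤ ≡ n
    Word    : Set
    words   : List Word
    ok      : Word → Bool
    φ       : Word → Subset m
    wt      : Word → ℕ
    φ-flat  : ∀ ω → ok ω ≡ true → Flat r (φ ω)
    r≤wt    : ∀ ω → ok ω ≡ true → r (φ ω) ≤ wt ω
    wt≤n    : ∀ ω → ok ω ≡ true → wt ω ≤ n
    degree< : ∀ ω → ok ω ≡ true → r (φ ω) < n → 2 ℕ.* wt ω < n ℕ.+ r (φ ω)
    top     : ∑ words (λ ω → ⟦ ok ω ⟧ ℤ.* ⟦ φ ω ==ᵇ ⊤ ⟧) ≡ + 1
    palindromic : ∀ B (ψ : ℕ → ℤ) →
      ∑ words (λ ω → ⟦ ok ω ⟧ ℤ.* (⟦ B ⊆ᵇ φ ω ⟧ ℤ.* ψ (wt ω))) ≡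
      ∑ words (λ ω → ⟦ ok ω ⟧ ℤ.* (⟦ B ⊆ᵇ φ ω ⟧ ℤ.* ψ (r B ℕ.+ (n ∸ wt ω))))

module KL (P : RMat → Poly) (isKL : IsKL P) {m : ℕ} {r : Subset m → ℕ} {n : ℕ} (M : KLModel r n) where

  open KLModel M
  open Contraction r matroid
  open ≡-Reasoning

  -- The candidate for the Kazhdan-Lusztig polynomial of the contraction at `G`.
  e : Subset m → Poly
  e G j = ∑ words (λ ω → ⟦ ok ω ⟧ ℤ.* (⟦ φ ω ==ᵇ G ⟧ ℤ.* ⟦ wt ω ≡ᵇ r G ℕ.+ j ⟧))

  r≤n : ∀ X → r X ≤ n
  r≤n X = subst (r X ≤_) rank≡n (mono ⊆⊤)

  ∑-words-cong : {f g : Word → ℤ} → (∀ ω → ok ω ≡ true → f ω ≡ g ω) →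
    ∑ words (λ ω → ⟦ ok ω ⟧ ℤ.* f ω) ≡ ∑ words (λ ω → ⟦ ok ω ⟧ ℤ.* g ω)
  ∑-words-cong = ∑-cong-if words ok

  shift-∑ : ∀ d G j (D : ℕ) →
    (∀ ω → ok ω ≡ true → φ ω ≡ G → ((d ≤ᵇ j) ∧ (wt ω ≡ᵇ r G ℕ.+ (j ∸ d))) ≡ (wt ω ≡ᵇ D)) →
    shift d (e G) j ≡ ∑ words (λ ω → ⟦ ok ω ⟧ ℤ.* (⟦ φ ω ==ᵇ G ⟧ ℤ.* ⟦ wt ω ≡ᵇ D ⟧))
  shift-∑ d G j D h = trans (sym (∑-*ˡ words ⟦ d ≤ᵇ j ⟧ _))
    (trans (∑-cong words (λ ω → rearr ⟦ d ≤ᵇ j ⟧ ⟦ ok ω ⟧ ⟦ φ ω ==ᵇ G ⟧ _))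
      (∑-words-cong λ ω okω → go ω okω (φ ω ==ᵇ G) refl))
    where
    rearr : ∀ a b c d → a ℤ.* (b ℤ.* (c ℤ.* d)) ≡ b ℤ.* (c ℤ.* (a ℤ.* d))
    rearr = solve-∀
    go : ∀ ω → ok ω ≡ true → ∀ b → (φ ω ==ᵇ G) ≡ b →
      ⟦ b ⟧ ℤ.* (⟦ d ≤ᵇ j ⟧ ℤ.* ⟦ wt ω ≡ᵇ r G ℕ.+ (j ∸ d) ⟧) ≡ ⟦ b ⟧ ℤ.* ⟦ wt ω ≡ᵇ D ⟧
    go ω okω true eq = cong (λ z → + 1 ℤ.* z)
      (trans (sym (⟦⟧-∧ (d ≤ᵇ j) _)) (cong ⟦_⟧ (h ω okω (==ᵇ⇒≡ eq))))
    go ω okω false eq = trans (ℤP.*-zeroˡ (⟦ d ≤ᵇ j ⟧ ℤ.* ⟦ wt ω ≡ᵇ r G ℕ.+ (j ∸ d) ⟧)) (sym (ℤP.*-zeroˡ ⟦ wt ω ≡ᵇ D ⟧))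

  module Step {G} (r′ : Subset m → ℕ) (inv : ∀ X → r′ X ℕ.+ r G ≡ r (X ∪ G)) where

    N : RMat
    N = rmat m (⊤ ─ G) r′

    r′-mono : ∀ {X Y} → X ⊆ Y → r′ X ≤ r′ Y
    r′-mono {X} {Y} X⊆Y = ℕP.+-cancelʳ-≤ (r G) _ _ (subst₂ _≤_ (sym (inv X)) (sym (inv Y))
      (mono λ p → x∈p∪q⁺ (Data.Sum.map X⊆Y id (x∈p∪q⁻ X G p))))

    -- the summand at a chain A ⊆ F only sees the rank of A ∪ G
    shift-e : ∀ {A F} j → (A ⊆ᵇ F) ≡ true →
      shift (r′ F ∸ r′ A) (e (F ∪ G)) j ≡
      ∑ words (λ ω → ⟦ ok ω ⟧ ℤ.* (⟦ φ ω ==ᵇ (F ∪ G) ⟧ ℤ.* ⟦ wt ω ≡ᵇ r (A ∪ G) ℕ.+ j ⟧))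
    shift-e {A} {F} j A⊆F = shift-∑ (r′ F ∸ r′ A) (F ∪ G) j (r (A ∪ G) ℕ.+ j) λ ω okω φ≡ →
      bool-ext (to ω) (from ω (subst (λ K → r K ≤ wt ω) φ≡ (r≤wt ω okω)))
      where
      d = r′ F ∸ r′ A
      d+A : d ℕ.+ r (A ∪ G) ≡ r (F ∪ G)
      d+A = begin
        d ℕ.+ r (A ∪ G) ≡⟨ cong (d ℕ.+_) (sym (inv A)) ⟩
        d ℕ.+ (r′ A ℕ.+ r G) ≡⟨ sym (ℕP.+-assoc d (r′ A) (r G)) ⟩
        d ℕ.+ r′ A ℕ.+ r G ≡⟨ cong (ℕ._+ r G) (ℕP.m∸n+n≡m (r′-mono (⊆ᵇ⇒⊆ A⊆F))) ⟩
        r′ F ℕ.+ r G ≡⟨ inv F ⟩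
        r (F ∪ G) ∎
      calc : d ≤ j → r (F ∪ G) ℕ.+ (j ∸ d) ≡ r (A ∪ G) ℕ.+ j
      calc le = begin
        r (F ∪ G) ℕ.+ (j ∸ d) ≡⟨ cong (ℕ._+ (j ∸ d)) (sym d+A) ⟩
        d ℕ.+ r (A ∪ G) ℕ.+ (j ∸ d) ≡⟨ cong (ℕ._+ (j ∸ d)) (ℕP.+-comm d (r (A ∪ G))) ⟩
        r (A ∪ G) ℕ.+ d ℕ.+ (j ∸ d) ≡⟨ ℕP.+-assoc (r (A ∪ G)) d (j ∸ d) ⟩
        r (A ∪ G) ℕ.+ (d ℕ.+ (j ∸ d)) ≡⟨ cong (r (A ∪ G) ℕ.+_) (ℕP.m+[n∸m]≡n le) ⟩
        r (A ∪ G) ℕ.+ j ∎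
      to : ∀ ω → ((d ≤ᵇ j) ∧ (wt ω ≡ᵇ r (F ∪ G) ℕ.+ (j ∸ d))) ≡ true → (wt ω ≡ᵇ r (A ∪ G) ℕ.+ j) ≡ true
      to ω h = let (h₁ , h₂) = ∧-true {d ≤ᵇ j} h in
        ≡⇒≡ᵇ (trans (≡ᵇ⇒≡ {wt ω} h₂) (calc (≤ᵇ⇒≤ h₁)))
      from : ∀ ω → r (F ∪ G) ≤ wt ω → (wt ω ≡ᵇ r (A ∪ G) ℕ.+ j) ≡ true →
        ((d ≤ᵇ j) ∧ (wt ω ≡ᵇ r (F ∪ G) ℕ.+ (j ∸ d))) ≡ true
      from ω le h = cong₂ _∧_ (≤⇒≤ᵇ d≤j) (≡⇒≡ᵇ (trans (≡ᵇ⇒≡ {wt ω} h) (sym (calc d≤j))))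
        where
        d≤j : d ≤ j
        d≤j = ℕP.+-cancelʳ-≤ (r (A ∪ G)) _ _ (subst₂ _≤_ (sym d+A)
          (trans (≡ᵇ⇒≡ {wt ω} h) (ℕP.+-comm (r (A ∪ G)) j)) le)

    -- A word lies over F ∪ G for at most one flat F of the contraction, namely `φ ω ─ G`, and this
    -- is a flat because `φ ω` is one.
    flats-over : ∀ ω A → ok ω ≡ true →
      ∑ (subsets m) (λ F → ⟦ isFlatᵇ N F ⟧ ℤ.* (⟦ A ⊆ᵇ F ⟧ ℤ.* ⟦ φ ω ==ᵇ (F ∪ G) ⟧)) ≡
      ⟦ G ⊆ᵇ φ ω ⟧ ℤ.* ⟦ A ⊆ᵇ (φ ω ─ G) ⟧
    flats-over ω A okω = trans (∑-cong (subsets m) point) (∑-δ m (φ ω ─ G) (λ F → ⟦ G ⊆ᵇ φ ω ⟧ ℤ.* ⟦ A ⊆ᵇ F ⟧))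
      where
      boolEq : ∀ F → (isFlatᵇ N F ∧ (φ ω ==ᵇ (F ∪ G))) ≡ ((F ==ᵇ (φ ω ─ G)) ∧ (G ⊆ᵇ φ ω))
      boolEq F = bool-ext to from
        where
        to : (isFlatᵇ N F ∧ (φ ω ==ᵇ (F ∪ G))) ≡ true → ((F ==ᵇ (φ ω ─ G)) ∧ (G ⊆ᵇ φ ω)) ≡ true
        to h with ∧-true {isFlatᵇ N F} h
        ... | hf , hφ with ==ᵇ⇒≡ {X = φ ω} hφ
        ... | φ≡ rewrite φ≡ | ∪-─-cancel G F (⊆⇒⊆ᵇ (proj₁ (isFlat⁻ N F hf))) =
          cong₂ _∧_ (==ᵇ-refl F) (⊆ᵇ-∪ʳ F G)
        from : ((F ==ᵇ (φ ω ─ G)) ∧ (G ⊆ᵇ φ ω)) ≡ true → (isFlatᵇ N F ∧ (φ ω ==ᵇ (F ∪ G))) ≡ true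
        from h with ∧-true {F ==ᵇ (φ ω ─ G)} h
        ... | hF , hG with ==ᵇ⇒≡ {X = F} hF
        ... | refl rewrite ─-∪-cancel G (φ ω) hG =
          cong₂ _∧_ (contraction-flat⁺ r′ inv (φ ω) (φ-flat ω okω) hG) (==ᵇ-refl (φ ω))
      rearr₁ : ∀ a b c → a ℤ.* (b ℤ.* c) ≡ (a ℤ.* c) ℤ.* b
      rearr₁ = solve-∀
      point : ∀ F → ⟦ isFlatᵇ N F ⟧ ℤ.* (⟦ A ⊆ᵇ F ⟧ ℤ.* ⟦ φ ω ==ᵇ (F ∪ G) ⟧) ≡
                    ⟦ F ==ᵇ (φ ω ─ G) ⟧ ℤ.* (⟦ G ⊆ᵇ φ ω ⟧ ℤ.* ⟦ A ⊆ᵇ F ⟧)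
      point F = begin
        ⟦ isFlatᵇ N F ⟧ ℤ.* (⟦ A ⊆ᵇ F ⟧ ℤ.* ⟦ φ ω ==ᵇ (F ∪ G) ⟧)
          ≡⟨ rearr₁ ⟦ isFlatᵇ N F ⟧ ⟦ A ⊆ᵇ F ⟧ ⟦ φ ω ==ᵇ (F ∪ G) ⟧ ⟩
        (⟦ isFlatᵇ N F ⟧ ℤ.* ⟦ φ ω ==ᵇ (F ∪ G) ⟧) ℤ.* ⟦ A ⊆ᵇ F ⟧
          ≡⟨ cong (ℤ._* ⟦ A ⊆ᵇ F ⟧) (trans (sym (⟦⟧-∧ (isFlatᵇ N F) _))
              (trans (cong ⟦_⟧ (boolEq F)) (⟦⟧-∧ (F ==ᵇ (φ ω ─ G)) _))) ⟩
        (⟦ F ==ᵇ (φ ω ─ G) ⟧ ℤ.* ⟦ G ⊆ᵇ φ ω ⟧) ℤ.* ⟦ A ⊆ᵇ F ⟧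
          ≡⟨ ℤP.*-assoc ⟦ F ==ᵇ (φ ω ─ G) ⟧ ⟦ G ⊆ᵇ φ ω ⟧ ⟦ A ⊆ᵇ F ⟧ ⟩
        ⟦ F ==ᵇ (φ ω ─ G) ⟧ ℤ.* (⟦ G ⊆ᵇ φ ω ⟧ ℤ.* ⟦ A ⊆ᵇ F ⟧) ∎

    subs : List (Subset m)
    subs = subsets m

    recursion : ∀ j → j ℕ.+ r G ≤ n →
      ∑ (flats N) (λ F → conv (chi (restrict N F)) (e (F ∪ G)) j) ≡ e G (n ∸ r G ∸ j)
    recursion j j≤ = begin
      ∑ (flats N) (λ F → conv (chi (restrict N F)) (e (F ∪ G)) j)
        ≡⟨ ∑-filter (isFlatᵇ N) subs _ ⟩
      ∑ subs (λ F → ⟦ isFlatᵇ N F ⟧ ℤ.* conv (chi (restrict N F)) (e (F ∪ G)) j)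
        ≡⟨ ∑-cong subs (λ F → cong (λ z → ⟦ isFlatᵇ N F ⟧ ℤ.* z) (begin
             conv (chi (restrict N F)) (e (F ∪ G)) j ≡⟨ conv-chi N F (e (F ∪ G)) j ⟩
             ∑ subs (λ A → ⟦ A ⊆ᵇ F ⟧ ℤ.* (sign ∣ A ∣ ℤ.* shift (r′ F ∸ r′ A) (e (F ∪ G)) j))
               ≡⟨ ∑-cong-if subs (_⊆ᵇ F) (λ A A⊆F → cong (λ z → sign ∣ A ∣ ℤ.* z) (shift-e j A⊆F)) ⟩
             ∑ subs (λ A → ⟦ A ⊆ᵇ F ⟧ ℤ.* (sign ∣ A ∣ ℤ.* ∑ words (λ ω → ⟦ ok ω ⟧ ℤ.* (⟦ φ ω ==ᵇ (F ∪ G) ⟧ ℤ.* w A ω)))) ∎)) ⟩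
      ∑ subs (λ F → ⟦ isFlatᵇ N F ⟧ ℤ.* ∑ subs (λ A → ⟦ A ⊆ᵇ F ⟧ ℤ.*
          (sign ∣ A ∣ ℤ.* ∑ words (λ ω → ⟦ ok ω ⟧ ℤ.* (⟦ φ ω ==ᵇ (F ∪ G) ⟧ ℤ.* w A ω)))))
        ≡⟨ ∑-cong subs (λ F → trans (sym (∑-*ˡ subs ⟦ isFlatᵇ N F ⟧ _)) (∑-cong subs λ A → push F A)) ⟩
      ∑ subs (λ F → ∑ subs (λ A → ∑ words (λ ω → sign ∣ A ∣ ℤ.* (⟦ ok ω ⟧ ℤ.* (w A ω ℤ.* t F A ω)))))
        ≡⟨ ∑-swap subs subs _ ⟩
      ∑ subs (λ A → ∑ subs (λ F → ∑ words (λ ω → sign ∣ A ∣ ℤ.* (⟦ ok ω ⟧ ℤ.* (w A ω ℤ.* t F A ω)))))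
        ≡⟨ ∑-cong subs (λ A → trans (∑-swap subs words _) (trans
              (∑-cong words λ ω → trans (∑-*ˡ subs (sign ∣ A ∣) _) (cong (λ z → sign ∣ A ∣ ℤ.* z)
                 (trans (∑-*ˡ subs ⟦ ok ω ⟧ _) (cong (λ z → ⟦ ok ω ⟧ ℤ.* z) (∑-*ˡ subs (w A ω) _)))))
              (∑-*ˡ words (sign ∣ A ∣) _))) ⟩
      ∑ subs (λ A → sign ∣ A ∣ ℤ.* ∑ words (λ ω → ⟦ ok ω ⟧ ℤ.* (w A ω ℤ.* ∑ subs (λ F → t F A ω))))
        -- For fixed A the flats have done their work: the sum over F only asks that the flat of the
        -- word contain A ∪ G.
        ≡⟨ ∑-cong subs (λ A → cong (λ z → sign ∣ A ∣ ℤ.* z) (toB A)) ⟩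
      ∑ subs (λ A → sign ∣ A ∣ ℤ.* (⟦ A ⊆ᵇ (⊤ ─ G) ⟧ ℤ.* ∑ words (λ ω → ⟦ ok ω ⟧ ℤ.* (⟦ (A ∪ G) ⊆ᵇ φ ω ⟧ ℤ.* w A ω))))
        -- Palindromy at A ∪ G: the condition wt ω - r(A ∪ G) = j becomes n - wt ω = j, in which A
        -- no longer occurs.
        ≡⟨ ∑-cong subs (λ A → cong (λ z → sign ∣ A ∣ ℤ.* (⟦ A ⊆ᵇ (⊤ ─ G) ⟧ ℤ.* z)) (flip A)) ⟩
      ∑ subs (λ A → sign ∣ A ∣ ℤ.* (⟦ A ⊆ᵇ (⊤ ─ G) ⟧ ℤ.* ∑ words (λ ω → ⟦ ok ω ⟧ ℤ.* (⟦ (A ∪ G) ⊆ᵇ φ ω ⟧ ℤ.* v ω))))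
        ≡⟨ ∑-cong subs (λ A → trans (cong (λ z → sign ∣ A ∣ ℤ.* z) (sym (∑-*ˡ words ⟦ A ⊆ᵇ (⊤ ─ G) ⟧ _)))
              (trans (sym (∑-*ˡ words (sign ∣ A ∣) _)) (∑-cong words (λ ω → back A ω)))) ⟩
      ∑ subs (λ A → ∑ words (λ ω → (⟦ ok ω ⟧ ℤ.* (⟦ G ⊆ᵇ φ ω ⟧ ℤ.* v ω)) ℤ.* (⟦ A ⊆ᵇ (φ ω ─ G) ⟧ ℤ.* sign ∣ A ∣)))
        ≡⟨ ∑-swap subs words _ ⟩
      ∑ words (λ ω → ∑ subs (λ A → (⟦ ok ω ⟧ ℤ.* (⟦ G ⊆ᵇ φ ω ⟧ ℤ.* v ω)) ℤ.* (⟦ A ⊆ᵇ (φ ω ─ G) ⟧ ℤ.* sign ∣ A ∣)))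
        -- The sum over A is now a bare alternating sum over the subsets of `φ ω ─ G`, and it
        -- vanishes unless this set is empty.
        ≡⟨ ∑-cong words (λ ω → trans (∑-*ˡ subs (⟦ ok ω ⟧ ℤ.* (⟦ G ⊆ᵇ φ ω ⟧ ℤ.* v ω))
            (λ A → ⟦ A ⊆ᵇ (φ ω ─ G) ⟧ ℤ.* sign ∣ A ∣)) (trans (cong (λ z → (⟦ ok ω ⟧ ℤ.* (⟦ G ⊆ᵇ φ ω ⟧ ℤ.* v ω)) ℤ.* z)
            (∑-sign m (φ ω ─ G)))
              (trans (rearr₂ ⟦ ok ω ⟧ ⟦ G ⊆ᵇ φ ω ⟧ (v ω) _)
                (cong (λ z → ⟦ ok ω ⟧ ℤ.* (z ℤ.* v ω)) (trans (sym (⟦⟧-∧ (G ⊆ᵇ φ ω) _)) (cong ⟦_⟧ (==ᵇ-─⊥ G (φ ω)))))))) ⟩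
      ∑ words (λ ω → ⟦ ok ω ⟧ ℤ.* (⟦ φ ω ==ᵇ G ⟧ ℤ.* v ω))
        ≡⟨ ∑-words-cong (λ ω okω → cong (λ z → ⟦ φ ω ==ᵇ G ⟧ ℤ.* z) (cong ⟦_⟧ (bool-ext (fin→ ω (wt≤n ω okω)) (fin← ω)))) ⟩
      e G (n ∸ r G ∸ j) ∎
      where
      w : Subset m → Word → ℤ
      w A ω = ⟦ wt ω ≡ᵇ r (A ∪ G) ℕ.+ j ⟧
      v : Word → ℤ
      v ω = ⟦ n ∸ wt ω ≡ᵇ j ⟧
      t : Subset m → Subset m → Word → ℤ
      t F A ω = ⟦ isFlatᵇ N F ⟧ ℤ.* (⟦ A ⊆ᵇ F ⟧ ℤ.* ⟦ φ ω ==ᵇ (F ∪ G) ⟧)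
      rearr₂ : ∀ a b c d → (a ℤ.* (b ℤ.* c)) ℤ.* d ≡ a ℤ.* ((b ℤ.* d) ℤ.* c)
      rearr₂ = solve-∀
      push : ∀ F A → ⟦ isFlatᵇ N F ⟧ ℤ.* (⟦ A ⊆ᵇ F ⟧ ℤ.*
          (sign ∣ A ∣ ℤ.* ∑ words (λ ω → ⟦ ok ω ⟧ ℤ.* (⟦ φ ω ==ᵇ (F ∪ G) ⟧ ℤ.* w A ω))))
                   ≡ ∑ words (λ ω → sign ∣ A ∣ ℤ.* (⟦ ok ω ⟧ ℤ.* (w A ω ℤ.* t F A ω)))
      push F A = trans (assoc₃ ⟦ isFlatᵇ N F ⟧ ⟦ A ⊆ᵇ F ⟧ (sign ∣ A ∣) _)
        (trans (sym (∑-*ˡ words (⟦ isFlatᵇ N F ⟧ ℤ.* (⟦ A ⊆ᵇ F ⟧ ℤ.* sign ∣ A ∣)) _))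
          (∑-cong words λ ω → mix ⟦ isFlatᵇ N F ⟧ ⟦ A ⊆ᵇ F ⟧ (sign ∣ A ∣) ⟦ ok ω ⟧ ⟦ φ ω ==ᵇ (F ∪ G) ⟧ (w A ω)))
        where
        assoc₃ : ∀ a b c d → a ℤ.* (b ℤ.* (c ℤ.* d)) ≡ (a ℤ.* (b ℤ.* c)) ℤ.* d
        assoc₃ = solve-∀
        mix : ∀ a b c o p x → (a ℤ.* (b ℤ.* c)) ℤ.* (o ℤ.* (p ℤ.* x)) ≡ c ℤ.* (o ℤ.* (x ℤ.* (a ℤ.* (b ℤ.* p))))
        mix = solve-∀
      cross : ∀ A ω → ⟦ G ⊆ᵇ φ ω ⟧ ℤ.* ⟦ A ⊆ᵇ (φ ω ─ G) ⟧ ≡ ⟦ A ⊆ᵇ (⊤ ─ G) ⟧ ℤ.* ⟦ (A ∪ G) ⊆ᵇ φ ω ⟧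
      cross A ω = trans (sym (⟦⟧-∧ (G ⊆ᵇ φ ω) _)) (trans (cong ⟦_⟧ (⊆ᵇ-∪-─ A G (φ ω))) (⟦⟧-∧ (A ⊆ᵇ (⊤ ─ G)) _))
      toB : ∀ A → ∑ words (λ ω → ⟦ ok ω ⟧ ℤ.* (w A ω ℤ.* ∑ subs (λ F → t F A ω))) ≡
                  ⟦ A ⊆ᵇ (⊤ ─ G) ⟧ ℤ.* ∑ words (λ ω → ⟦ ok ω ⟧ ℤ.* (⟦ (A ∪ G) ⊆ᵇ φ ω ⟧ ℤ.* w A ω))
      toB A = trans (∑-words-cong λ ω okω → cong (λ z → w A ω ℤ.* z) (trans (flats-over ω A okω) (cross A ω)))
        (trans (∑-cong words λ ω → mix ⟦ ok ω ⟧ (w A ω) ⟦ A ⊆ᵇ (⊤ ─ G) ⟧ ⟦ (A ∪ G) ⊆ᵇ φ ω ⟧) (∑-*ˡ words ⟦ A ⊆ᵇ (⊤ ─ G) ⟧ _))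
        where
        mix : ∀ o x a b → o ℤ.* (x ℤ.* (a ℤ.* b)) ≡ a ℤ.* (o ℤ.* (b ℤ.* x))
        mix = solve-∀
      flip : ∀ A → ∑ words (λ ω → ⟦ ok ω ⟧ ℤ.* (⟦ (A ∪ G) ⊆ᵇ φ ω ⟧ ℤ.* w A ω)) ≡
                   ∑ words (λ ω → ⟦ ok ω ⟧ ℤ.* (⟦ (A ∪ G) ⊆ᵇ φ ω ⟧ ℤ.* v ω))
      flip A = trans (palindromic (A ∪ G) (λ x → ⟦ x ≡ᵇ r (A ∪ G) ℕ.+ j ⟧))
        (∑-cong words λ ω → cong (λ z → ⟦ ok ω ⟧ ℤ.* (⟦ (A ∪ G) ⊆ᵇ φ ω ⟧ ℤ.* z)) (cong ⟦_⟧
          (bool-ext (λ h → ≡⇒≡ᵇ (ℕP.+-cancelˡ-≡ (r (A ∪ G)) _ _ (≡ᵇ⇒≡ h)))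
                    (λ h → ≡⇒≡ᵇ (cong (r (A ∪ G) ℕ.+_) (≡ᵇ⇒≡ h))))))
      back : ∀ A ω → sign ∣ A ∣ ℤ.* (⟦ A ⊆ᵇ (⊤ ─ G) ⟧ ℤ.* (⟦ ok ω ⟧ ℤ.* (⟦ (A ∪ G) ⊆ᵇ φ ω ⟧ ℤ.* v ω))) ≡
                     (⟦ ok ω ⟧ ℤ.* (⟦ G ⊆ᵇ φ ω ⟧ ℤ.* v ω)) ℤ.* (⟦ A ⊆ᵇ (φ ω ─ G) ⟧ ℤ.* sign ∣ A ∣)
      back A ω = trans (mix₁ (sign ∣ A ∣) ⟦ A ⊆ᵇ (⊤ ─ G) ⟧ ⟦ ok ω ⟧ ⟦ (A ∪ G) ⊆ᵇ φ ω ⟧ (v ω))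
        (trans (cong (λ z → (sign ∣ A ∣ ℤ.* (⟦ ok ω ⟧ ℤ.* v ω)) ℤ.* z) (sym (cross A ω)))
          (mix₂ (sign ∣ A ∣) ⟦ ok ω ⟧ (v ω) ⟦ G ⊆ᵇ φ ω ⟧ ⟦ A ⊆ᵇ (φ ω ─ G) ⟧))
        where
        mix₁ : ∀ s a o b v → s ℤ.* (a ℤ.* (o ℤ.* (b ℤ.* v))) ≡ (s ℤ.* (o ℤ.* v)) ℤ.* (a ℤ.* b)
        mix₁ = solve-∀
        mix₂ : ∀ s o v g a → (s ℤ.* (o ℤ.* v)) ℤ.* (g ℤ.* a) ≡ (o ℤ.* (g ℤ.* v)) ℤ.* (a ℤ.* s)
        mix₂ = solve-∀
      n-j : r G ℕ.+ (n ∸ r G ∸ j) ≡ n ∸ j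
      n-j = begin
        r G ℕ.+ (n ∸ r G ∸ j) ≡⟨ sym (ℕP.+-∸-assoc (r G) (ℕP.m+n≤o⇒m≤o∸n j j≤)) ⟩
        (r G ℕ.+ (n ∸ r G)) ∸ j ≡⟨ cong (_∸ j) (ℕP.m+[n∸m]≡n (r≤n G)) ⟩
        n ∸ j ∎
      j≤n : j ≤ n
      j≤n = ℕP.≤-trans (ℕP.m≤m+n j _) j≤
      fin→ : ∀ ω → wt ω ≤ n → (n ∸ wt ω ≡ᵇ j) ≡ true → (wt ω ≡ᵇ r G ℕ.+ (n ∸ r G ∸ j)) ≡ true
      fin→ ω le h = ≡⇒≡ᵇ (trans (sym (ℕP.m∸[m∸n]≡n le)) (trans (cong (n ∸_) (≡ᵇ⇒≡ {n ∸ wt ω} {j} h)) (sym n-j)))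
      fin← : ∀ ω → (wt ω ≡ᵇ r G ℕ.+ (n ∸ r G ∸ j)) ≡ true → (n ∸ wt ω ≡ᵇ j) ≡ true
      fin← ω h = ≡⇒≡ᵇ (trans (cong (n ∸_) (trans (≡ᵇ⇒≡ {wt ω} h) n-j)) (ℕP.m∸[m∸n]≡n j≤n))

  e-degree : ∀ {G d} → r G ℕ.+ d ≡ n → 0 < d → ∀ k → d ≤ 2 ℕ.* k → e G k ≡ + 0
  e-degree {G} {d} rG+d 0<d k d≤2k = trans (∑-words-cong λ ω okω → go ω okω (φ ω ==ᵇ G) refl (wt ω ≡ᵇ r G ℕ.+ k) refl)
      (∑-zero′ words λ ω → ℤP.*-zeroʳ ⟦ ok ω ⟧)
    where
    bound : ∀ ω → ok ω ≡ true → φ ω ≡ G → wt ω ≢ r G ℕ.+ k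
    bound ω okω φ≡ wt≡ = ℕP.<⇒≱ (subst₂ (λ x K → 2 ℕ.* x < n ℕ.+ r K) wt≡ φ≡ (degree< ω okω
        (subst (λ K → r K < n) (sym φ≡) (subst (r G <_) rG+d (ℕP.m<m+n (r G) 0<d)))))
      (subst₂ _≤_ (trans (lem₁ (r G) d) (cong (ℕ._+ r G) rG+d)) (lem₂ (r G) k) (ℕP.+-monoʳ-≤ (r G ℕ.+ r G) d≤2k))
      where
      lem₁ : ∀ a b → a ℕ.+ a ℕ.+ b ≡ a ℕ.+ b ℕ.+ a
      lem₁ = solve-∀ℕ
      lem₂ : ∀ a k → a ℕ.+ a ℕ.+ 2 ℕ.* k ≡ 2 ℕ.* (a ℕ.+ k)
      lem₂ = solve-∀ℕ
    go : ∀ ω → ok ω ≡ true → ∀ b → (φ ω ==ᵇ G) ≡ b → ∀ c → (wt ω ≡ᵇ r G ℕ.+ k) ≡ c → ⟦ b ⟧ ℤ.* ⟦ c ⟧ ≡ + 0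
    go ω okω false _ c _ = ℤP.*-zeroˡ ⟦ c ⟧
    go ω okω true _ false _ = refl
    go ω okω true e₁ true e₂ = ⊥-elim (bound ω okω (==ᵇ⇒≡ e₁) (≡ᵇ⇒≡ {wt ω} e₂))

  e-top : ∀ {G} → G ≡ ⊤ → ∀ k → e G k ≡ δ k
  e-top refl zero = trans (∑-words-cong λ ω okω → go ω okω (φ ω ==ᵇ ⊤) refl) top
    where
    go : ∀ ω → ok ω ≡ true → ∀ b → (φ ω ==ᵇ ⊤) ≡ b → ⟦ b ⟧ ℤ.* ⟦ wt ω ≡ᵇ r ⊤ ℕ.+ 0 ⟧ ≡ ⟦ b ⟧
    go ω okω false eq = ℤP.*-zeroˡ ⟦ wt ω ≡ᵇ r ⊤ ℕ.+ 0 ⟧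
    go ω okω true eq = trans (ℤP.*-identityˡ ⟦ wt ω ≡ᵇ r ⊤ ℕ.+ 0 ⟧) (cong ⟦_⟧ (≡⇒≡ᵇ (trans (ℕP.≤-antisym
      (subst (wt ω ≤_) (sym rank≡n) (wt≤n ω okω)) (subst (λ K → r K ≤ wt ω) (==ᵇ⇒≡ eq) (r≤wt ω okω)))
      (sym (ℕP.+-identityʳ (r ⊤))))))
  e-top refl (suc k) = trans (∑-words-cong λ ω okω → trans
      (cong (λ b → ⟦ φ ω ==ᵇ ⊤ ⟧ ℤ.* ⟦ b ⟧) (bool-ext {b = false}
        (λ h → ⊥-elim (ℕP.<⇒≱ (subst (n <_) (trans (trans (cong (ℕ._+ suc k) (sym rank≡n)) refl) (sym (≡ᵇ⇒≡ {wt ω} h)))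
            (ℕP.m<m+n n (s≤s z≤n))) (wt≤n ω okω)))
        (λ ())))
      (ℤP.*-zeroʳ ⟦ φ ω ==ᵇ ⊤ ⟧))
    (∑-zero′ words λ ω → ℤP.*-zeroʳ ⟦ ok ω ⟧)

  flat-top : ∀ {G} → Flat r G → r G ≡ n → G ≡ ⊤
  flat-top {G} fl rG = ⊆-antisym ⊆⊤ λ {x} _ → go x (x ∈? G)
    where
    go : ∀ x → _ → x ∈ G
    go x (yes p) = p
    go x (no p) = ⊥-elim (ℕP.<⇒≱ (subst (_< r (G ∪ ⁅ x ⁆)) rG (fl x p)) (r≤n _))

  rank-Contracts : ∀ {G N d} → Contracts G N → r G ℕ.+ d ≡ n → rank N ≡ d
  rank-Contracts {G} {d = d} (contracts r′ refl inv) rG+d = ℕP.+-cancelʳ-≡ (r G) _ _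
    (trans (contraction-rank r′ inv) (trans rank≡n (trans (sym rG+d) (ℕP.+-comm (r G) d))))

  KL-at : ∀ {G N} → Contracts G N → Flat r G →
    (rank N ≡ 0 → ∀ k → P N k ≡ δ k)
    × (0 < rank N → ∀ k → rank N ≤ 2 ℕ.* k → P N k ≡ + 0)
    × (∀ k → rev (rank N) (P N) k
           ≡ sumℤ (L.map (λ F → conv (chi (restrict N F)) (P (contract N F)) k) (flats N)))
  KL-at (contracts r′ refl inv) fl = isKL _ (contraction-matroid r′ inv) (contraction-loopless r′ inv fl)

  P-degree : ∀ {G N d} → Contracts G N → Flat r G → r G ℕ.+ d ≡ n → 0 < d → ∀ k → d ≤ 2 ℕ.* k → P N k ≡ + 0
  P-degree c fl rG+d 0<d k d≤ = proj₁ (proj₂ (KL-at c fl)) (subst (0 <_) (sym rk≡) 0<d) k (subst (_≤ 2 ℕ.* k) (sym rk≡) d≤)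
    where rk≡ = rank-Contracts c rG+d

  -- Both sides satisfy the same degree bound and the same recursion, so the usual uniqueness
  -- argument applies, by induction on the corank `d`.
  P≡e : ∀ d {G N} → Contracts G N → Flat r G → r G ℕ.+ d ≡ n → ∀ k → P N k ≡ e G k
  P≡e = <-rec _ go
    where
    go : ∀ d → (∀ {d′} → d′ < d → ∀ {G N} → Contracts G N → Flat r G → r G ℕ.+ d′ ≡ n → ∀ k → P N k ≡ e G k) →
         ∀ {G N} → Contracts G N → Flat r G → r G ℕ.+ d ≡ n → ∀ k → P N k ≡ e G k
    go zero IH {G} c fl rG k = trans (proj₁ (KL-at c fl) (rank-Contracts c rG) k)
      (sym (e-top (flat-top fl (trans (sym (ℕP.+-identityʳ _)) rG)) k))
    go d@(suc d-1) IH {G} c@(contracts r′ refl inv) fl rG+d k with d ℕP.≤? 2 ℕ.* k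
    -- In the upper half of the degrees both polynomials vanish.
    ... | yes d≤2k = trans (P-degree c fl rG+d (s≤s z≤n) k d≤2k) (sym (e-degree rG+d (s≤s z≤n) k d≤2k))
    -- A coefficient in the lower half is read off the recursion at the complementary exponent
    -- `j = d ∸ k`, which lies in the upper half.
    ... | no d≰2k = begin
      P N k ≡⟨ cong (P N) (sym (ℕP.m∸[m∸n]≡n k≤d)) ⟩
      P N (d ∸ j) ≡⟨ sym (cong (λ b → if b then P N (d ∸ j) else + 0) (≤⇒≤ᵇ (ℕP.m∸n≤m d k))) ⟩
      rev d (P N) j ≡⟨ cong (λ d → rev d (P N) j) (sym (rank-Contracts c rG+d)) ⟩
      rev (rank N) (P N) j ≡⟨ proj₂ (proj₂ (KL-at c fl)) j ⟩
      ∑ (flats N) (λ F → conv (chi (restrict N F)) (P (contract N F)) j)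
        ≡⟨ trans (∑-filter (isFlatᵇ N) (subsets m) _)
             (trans (∑-cong-if (subsets m) (isFlatᵇ N) replace) (sym (∑-filter (isFlatᵇ N) (subsets m) _))) ⟩
      ∑ (flats N) (λ F → conv (chi (restrict N F)) (e (F ∪ G)) j) ≡⟨ recursion j (subst (j ℕ.+ r G ≤_) rG+d
             (subst (_≤ r G ℕ.+ d) (ℕP.+-comm (r G) j) (ℕP.+-monoʳ-≤ (r G) (ℕP.m∸n≤m d k)))) ⟩
      e G (n ∸ r G ∸ j) ≡⟨ cong (λ x → e G (x ∸ j)) (trans (cong (_∸ r G) (sym rG+d)) (ℕP.m+n∸m≡n (r G) d)) ⟩
      e G (d ∸ j) ≡⟨ cong (e G) (ℕP.m∸[m∸n]≡n k≤d) ⟩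
      e G k ∎
      where
      open Step r′ inv
      2k<d : 2 ℕ.* k < d
      2k<d = ℕP.≰⇒> d≰2k
      k≤d : k ≤ d
      k≤d = ℕP.≤-trans (ℕP.m≤m+n k _) (ℕP.<⇒≤ 2k<d)
      j : ℕ
      j = d ∸ k
      d≤2j : d ≤ 2 ℕ.* j
      d≤2j = ℕP.+-cancelʳ-≤ (2 ℕ.* k) _ _ (subst (d ℕ.+ 2 ℕ.* k ≤_)
        (trans (trans (sym (cong (2 ℕ.*_) (ℕP.m∸n+n≡m k≤d))) (ℕP.*-distribˡ-+ 2 j k)) refl)
        (ℕP.+-monoʳ-≤ d (ℕP.≤-trans (ℕP.<⇒≤ 2k<d) (ℕP.≤-reflexive (sym (ℕP.+-identityʳ d))))))
      replace : ∀ F → isFlatᵇ N F ≡ true →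
        conv (chi (restrict N F)) (P (contract N F)) j ≡ conv (chi (restrict N F)) (e (F ∪ G)) j
      replace F hF = trans (conv-chi N F (P (contract N F)) j) (trans
        (∑-cong-if (subsets m) (_⊆ᵇ F) (λ A A⊆F → cong (λ z → sign ∣ A ∣ ℤ.* z) (sh A A⊆F (nonempty? F))))
        (sym (conv-chi N F (e (F ∪ G)) j)))
        where
        flF = contraction-flat⁻ r′ inv F hF
        cF = contract-contracts inv F
        sh : ∀ A → (A ⊆ᵇ F) ≡ true → _ → shift (r′ F ∸ r′ A) (P (contract N F)) j ≡ shift (r′ F ∸ r′ A) (e (F ∪ G)) j
        sh A A⊆F (yes (x , x∈F)) = cong (λ z → ⟦ (r′ F ∸ r′ A) ≤ᵇ j ⟧ ℤ.* z)
          (IH smaller cF flF (ℕP.m+[n∸m]≡n (r≤n (F ∪ G))) (j ∸ (r′ F ∸ r′ A)))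
          where
          x∉G : x ∉ G
          x∉G = proj₂ (∈-─⁻ (proj₁ (isFlat⁻ N F hF) x∈F))
          bigger : r G < r (F ∪ G)
          bigger = ℕP.≤-trans (fl x x∉G) (mono λ p → x∈p∪q⁺ (Data.Sum.swap (Data.Sum.map id
            (λ q → subst (_∈ F) (sym (x∈⁅y⁆⇒x≡y x q)) x∈F) (x∈p∪q⁻ G ⁅ x ⁆ p))))
          smaller : n ∸ r (F ∪ G) < d
          smaller = ℕP.+-cancelˡ-≤ (r G) _ _ (subst₂ _≤_ (sym (ℕP.+-suc (r G) _)) (trans (ℕP.m+[n∸m]≡n (r≤n (F ∪ G))) (sym rG+d))
             (ℕP.+-monoˡ-≤ (n ∸ r (F ∪ G)) bigger))
        sh A A⊆F (no empty) = subst (λ d₀ → shift d₀ (P (contract N F)) j ≡ shift d₀ (e (F ∪ G)) j) (sym d₀≡0)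
          (cong (λ z → + 1 ℤ.* z) (trans (P-degree cF flF r⊥G (s≤s z≤n) j d≤2j) (sym (e-degree r⊥G (s≤s z≤n) j d≤2j))))
          where
          F≡⊥ = Empty-unique {p = F} empty
          A≡⊥ = Empty-unique {p = A} (λ { (x , p) → empty (x , ⊆ᵇ⇒⊆ A⊆F p) })
          d₀≡0 : r′ F ∸ r′ A ≡ 0
          d₀≡0 = trans (cong₂ (λ X Y → r′ X ∸ r′ Y) F≡⊥ A≡⊥) (ℕP.n∸n≡0 (r′ ⊥))
          r⊥G : r (F ∪ G) ℕ.+ d ≡ n
          r⊥G = trans (cong (λ K → r K ℕ.+ d) (trans (cong (_∪ G) F≡⊥) (∪-identityˡ G))) rG+d

  -- The factor t^(rk F) restores the rank that `e` subtracts from the weight, and every word lies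
  -- over exactly one flat. The rank function `rk₀` is kept apart from `r` because the rank of the
  -- whirl, a maximum over a list, equals the model's only pointwise.
  Zpoly-words : ∀ (rk₀ : Subset m → ℕ) → (∀ X → rk₀ X ≡ r X) → ∀ k →
    Zpoly P (rmat m ⊤ rk₀) k ≡ ∑ words (λ ω → ⟦ ok ω ⟧ ℤ.* ⟦ wt ω ≡ᵇ k ⟧)
  Zpoly-words rk₀ rk≡ k = begin
    Zpoly P M₀ k ≡⟨ ∑-filter (isFlatᵇ M₀) subs _ ⟩
    ∑ subs (λ F → ⟦ isFlatᵇ M₀ F ⟧ ℤ.* (if rk₀ F ≤ᵇ k then P (contract M₀ F) (k ∸ rk₀ F) else + 0))
      ≡⟨ ∑-cong-if subs (isFlatᵇ M₀) (λ F hF → trans (⟦⟧-if (rk₀ F ≤ᵇ k) _) (trans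
           (cong₂ (λ a z → ⟦ a ≤ᵇ k ⟧ ℤ.* z) (rk≡ F) (trans (P≡e (n ∸ r F) (con F) (flat⁻ F hF) (ℕP.m+[n∸m]≡n (r≤n F))
               (k ∸ rk₀ F))
             (cong (λ a → e F (k ∸ a)) (rk≡ F))))
           (shift-∑ (r F) F k k λ ω okω φ≡ → bool-ext (to ω F) (from ω F (subst (λ K → r K ≤ wt ω) φ≡ (r≤wt ω okω)))))) ⟩
    ∑ subs (λ F → ⟦ isFlatᵇ M₀ F ⟧ ℤ.* ∑ words (λ ω → ⟦ ok ω ⟧ ℤ.* (⟦ φ ω ==ᵇ F ⟧ ℤ.* ⟦ wt ω ≡ᵇ k ⟧)))
      ≡⟨ ∑-cong subs (λ F → trans (sym (∑-*ˡ words ⟦ isFlatᵇ M₀ F ⟧ _))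
            (∑-cong words λ ω → mix ⟦ isFlatᵇ M₀ F ⟧ ⟦ ok ω ⟧ ⟦ φ ω ==ᵇ F ⟧ ⟦ wt ω ≡ᵇ k ⟧)) ⟩
    ∑ subs (λ F → ∑ words (λ ω → ⟦ ok ω ⟧ ℤ.* (⟦ wt ω ≡ᵇ k ⟧ ℤ.* (⟦ φ ω ==ᵇ F ⟧ ℤ.* ⟦ isFlatᵇ M₀ F ⟧))))
      ≡⟨ ∑-swap subs words _ ⟩
    ∑ words (λ ω → ∑ subs (λ F → ⟦ ok ω ⟧ ℤ.* (⟦ wt ω ≡ᵇ k ⟧ ℤ.* (⟦ φ ω ==ᵇ F ⟧ ℤ.* ⟦ isFlatᵇ M₀ F ⟧))))
      ≡⟨ ∑-cong words (λ ω → trans (∑-*ˡ subs ⟦ ok ω ⟧ _) (cong (λ z → ⟦ ok ω ⟧ ℤ.* z) (∑-*ˡ subs ⟦ wt ω ≡ᵇ k ⟧ _))) ⟩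
    ∑ words (λ ω → ⟦ ok ω ⟧ ℤ.* (⟦ wt ω ≡ᵇ k ⟧ ℤ.* ∑ subs (λ F → ⟦ φ ω ==ᵇ F ⟧ ℤ.* ⟦ isFlatᵇ M₀ F ⟧)))
      ≡⟨ ∑-words-cong (λ ω okω → trans (cong (λ z → ⟦ wt ω ≡ᵇ k ⟧ ℤ.* z) (trans
           (∑-cong subs (λ F → cong (λ b → ⟦ b ⟧ ℤ.* ⟦ isFlatᵇ M₀ F ⟧) (∧-comm (φ ω ⊆ᵇ F) _)))
           (trans (∑-δ m (φ ω) (λ F → ⟦ isFlatᵇ M₀ F ⟧)) (cong ⟦_⟧ (isFlat⁺ M₀ (φ ω) ⊆⊤ (λ x _ x∉ →
              subst₂ _<_ (sym (rk≡ _)) (sym (rk≡ _)) (φ-flat ω okω x x∉)))))))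
           (ℤP.*-identityʳ ⟦ wt ω ≡ᵇ k ⟧)) ⟩
    ∑ words (λ ω → ⟦ ok ω ⟧ ℤ.* ⟦ wt ω ≡ᵇ k ⟧) ∎
    where
    subs = subsets m
    M₀ : RMat
    M₀ = rmat m ⊤ rk₀
    mix : ∀ a b c d → a ℤ.* (b ℤ.* (c ℤ.* d)) ≡ b ℤ.* (d ℤ.* (c ℤ.* a))
    mix = solve-∀
    con : ∀ F → Contracts F (contract M₀ F)
    con F = contracts _ refl λ X → trans (cong₂ (λ a b → a ∸ b ℕ.+ r F) (rk≡ (X ∪ F)) (rk≡ F))
      (ℕP.m∸n+n≡m (mono (q⊆p∪q X F)))
    flat⁻ : ∀ F → isFlatᵇ M₀ F ≡ true → Flat r F
    flat⁻ F h x x∉ = subst₂ _<_ (rk≡ _) (rk≡ _) (proj₂ (isFlat⁻ M₀ F h) x ∈⊤ x∉)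
    to : ∀ ω F → ((r F ≤ᵇ k) ∧ (wt ω ≡ᵇ r F ℕ.+ (k ∸ r F))) ≡ true → (wt ω ≡ᵇ k) ≡ true
    to ω F h = let (h₁ , h₂) = ∧-true {r F ≤ᵇ k} h in
      ≡⇒≡ᵇ (trans (≡ᵇ⇒≡ {wt ω} h₂) (ℕP.m+[n∸m]≡n (≤ᵇ⇒≤ {r F} h₁)))
    from : ∀ ω F → r F ≤ wt ω → (wt ω ≡ᵇ k) ≡ true → ((r F ≤ᵇ k) ∧ (wt ω ≡ᵇ r F ℕ.+ (k ∸ r F))) ≡ true
    from ω F le h = cong₂ _∧_ (≤⇒≤ᵇ r≤k) (≡⇒≡ᵇ (trans (≡ᵇ⇒≡ {wt ω} h) (sym (ℕP.m+[n∸m]≡n r≤k))))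
      where
      r≤k : r F ≤ k
      r≤k = subst (r F ≤_) (≡ᵇ⇒≡ {wt ω} h) le

-- The rank function of the whirl

allBools : ∀ n → (Vec Bool n → Bool) → Bool
allBools zero f = f []
allBools (suc n) f = allBools n (f ∘ (true ∷_)) ∧ allBools n (f ∘ (false ∷_))

-- Proof by truth table: the statements about covers and words reduce to inequalities at a single
-- vertex in a few Boolean unknowns, which evaluation settles.
tauto : ∀ n (f : Vec Bool n → Bool) → allBools n f ≡ true → ∀ v → f v ≡ true
tauto zero f e [] = e
tauto (suc n) f e (true ∷ v) = tauto n (f ∘ (true ∷_)) (proj₁ (∧-true {allBools n (f ∘ (true ∷_))} e)) v
tauto (suc n) f e (false ∷ v) = tauto n (f ∘ (false ∷_)) (proj₂ (∧-true {allBools n (f ∘ (true ∷_))} e)) v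

𝟙 : Bool → ℕ
𝟙 true = 1
𝟙 false = 0

card-∷ : ∀ {m} b (X : Subset m) → ∣ b ∷ X ∣ ≡ 𝟙 b ℕ.+ ∣ X ∣
card-∷ true X = refl
card-∷ false X = refl

rot : ∀ {A : Set} {m} → Vec A m → Vec A m
rot [] = []
rot (x ∷ xs) = xs ∷ʳ x

zipWith-∷ʳ : ∀ {A B C : Set} (f : A → B → C) {m} (xs : Vec A m) (ys : Vec B m) x y →
  V.zipWith f (xs ∷ʳ x) (ys ∷ʳ y) ≡ V.zipWith f xs ys ∷ʳ f x y
zipWith-∷ʳ f [] [] x y = refl
zipWith-∷ʳ f (x′ ∷ xs) (y′ ∷ ys) x y = cong (f x′ y′ ∷_) (zipWith-∷ʳ f xs ys x y)

rot-zipWith : ∀ {A B C : Set} (f : A → B → C) {m} (xs : Vec A m) (ys : Vec B m) →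
  rot (V.zipWith f xs ys) ≡ V.zipWith f (rot xs) (rot ys)
rot-zipWith f [] [] = refl
rot-zipWith f (x ∷ xs) (y ∷ ys) = sym (zipWith-∷ʳ f xs ys x y)

-- Inclusion in inductive form, so that vertexwise estimates can recurse along it.
data _⊑_ : ∀ {m} → Vec Bool m → Vec Bool m → Set where
  []   : [] ⊑ []
  keep : ∀ {m} {X Y : Vec Bool m} b → X ⊑ Y → (b ∷ X) ⊑ (b ∷ Y)
  add  : ∀ {m} {X Y : Vec Bool m} → X ⊑ Y → (false ∷ X) ⊑ (true ∷ Y)

⊆⇒⊑ : ∀ {m} {X Y : Subset m} → X ⊆ Y → X ⊑ Y
⊆⇒⊑ {X = []} {[]} s = []
⊆⇒⊑ {X = true ∷ X} {false ∷ Y} s with () ← s V.here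
⊆⇒⊑ {X = true ∷ X} {true ∷ Y} s = keep true (⊆⇒⊑ (drop-∷-⊆ s))
⊆⇒⊑ {X = false ∷ X} {true ∷ Y} s = add (⊆⇒⊑ (drop-∷-⊆ s))
⊆⇒⊑ {X = false ∷ X} {false ∷ Y} s = keep false (⊆⇒⊑ (drop-∷-⊆ s))

⊑-take : ∀ m {n} {X Y : Vec Bool (m ℕ.+ n)} → X ⊑ Y → V.take m X ⊑ V.take m Y
⊑-take zero s = []
⊑-take (suc m) {X = x ∷ X} {.x ∷ Y} (keep .x s) = keep x (⊑-take m s)
⊑-take (suc m) (add s) = add (⊑-take m s)

⊑-drop : ∀ m {n} {X Y : Vec Bool (m ℕ.+ n)} → X ⊑ Y → V.drop m X ⊑ V.drop m Y
⊑-drop zero s = s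
⊑-drop (suc m) (keep x s) = ⊑-drop m s
⊑-drop (suc m) (add s) = ⊑-drop m s

∣∣-++ : ∀ m {n} (X : Subset (m ℕ.+ n)) → ∣ X ∣ ≡ ∣ V.take m X ∣ ℕ.+ ∣ V.drop m X ∣
∣∣-++ zero X = refl
∣∣-++ (suc m) (x ∷ X) = trans (card-∷ x X) (trans (cong (𝟙 x ℕ.+_) (∣∣-++ m X))
  (trans (sym (ℕP.+-assoc (𝟙 x) _ _)) (cong (ℕ._+ ∣ V.drop m X ∣) (sym (card-∷ x (V.take m X))))))

-- Vertex covers: the rank of a set of spokes A and rim edges R is the least cost of a
-- set S of rim vertices, each vertex of S and each element not supported on S costing 1.

term : Bool → Bool → Bool → Bool → ℕ
term a r s s′ = 𝟙 s ℕ.+ (𝟙 (a ∧ not s) ℕ.+ 𝟙 (r ∧ not (s ∧ s′)))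

cost : ∀ {m} → (A R S S′ : Vec Bool m) → ℕ
cost [] [] [] [] = 0
cost (a ∷ A) (r ∷ R) (s ∷ S) (s′ ∷ S′) = term a r s s′ ℕ.+ cost A R S S′

minBy : {A : Set} → (A → ℕ) → A → List A → ℕ
minBy f d = L.foldr (λ x → f x ℕ.⊓_) (f d)

minBy-≤ : {A : Set} (f : A → ℕ) (d : A) {xs : List A} {x : A} → x ∈ˡ xs → minBy f d xs ≤ f x
minBy-≤ f d (here refl) = ℕP.m⊓n≤m _ _
minBy-≤ f d (there {x = y} p) = ℕP.≤-trans (ℕP.m⊓n≤n (f y) _) (minBy-≤ f d p)

minBy-attained : {A : Set} (f : A → ℕ) (d : A) (xs : List A) → ∃ λ x → f x ≡ minBy f d xs
minBy-attained f d [] = d , refl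
minBy-attained f d (x ∷ xs) with ℕP.⊓-sel (f x) (minBy f d xs) | minBy-attained f d xs
... | inj₁ e | _ = x , sym e
... | inj₂ e | y , h = y , trans h (sym e)

∈-subsets : ∀ {m} (X : Subset m) → X ∈ˡ subsets m
∈-subsets [] = here refl
∈-subsets (false ∷ X) = ∈-++⁺ˡ (∈-map⁺ (false ∷_) (∈-subsets X))
∈-subsets {suc m} (true ∷ X) = ∈-++⁺ʳ (L.map (false ∷_) (subsets m)) (∈-map⁺ (true ∷_) (∈-subsets X))

rankAR : ∀ {m} → Vec Bool m → Vec Bool m → ℕ
rankAR {m} A R = minBy (λ S → cost A R S (rot S)) ⊥ (subsets m)

-- A bound and a cover attaining it determine the minimum; in this form a rank can be rotated, and
-- computed by exhibiting a cover.
IsRank : ∀ {m} → Vec Bool m → Vec Bool m → ℕ → Set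
IsRank A R k = (∀ S → k ≤ cost A R S (rot S)) × ∃ λ S → cost A R S (rot S) ≡ k

rankAR-isRank : ∀ {m} (A R : Vec Bool m) → IsRank A R (rankAR A R)
rankAR-isRank {m} A R = (λ S → minBy-≤ _ ⊥ (∈-subsets S)) , minBy-attained _ ⊥ (subsets m)

isRank-unique : ∀ {m} {A R : Vec Bool m} {k l} → IsRank A R k → IsRank A R l → k ≡ l
isRank-unique (k≤ , S , refl) (l≤ , T , refl) = ℕP.≤-antisym (k≤ T) (l≤ S)

wrank : ∀ m → Subset (m ℕ.+ m) → ℕ
wrank m X = rankAR (V.take m X) (V.drop m X)

cost-⊥ : ∀ {m} (A R S′ : Vec Bool m) → cost A R ⊥ S′ ≡ ∣ A ∣ ℕ.+ ∣ R ∣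
cost-⊥ [] [] [] = refl
cost-⊥ (a ∷ A) (r ∷ R) (s′ ∷ S′) rewrite cost-⊥ A R S′ | card-∷ a A | card-∷ r R
  | ∧-identityʳ a | ∧-identityʳ r = lem (𝟙 a) (𝟙 r) ∣ A ∣ ∣ R ∣
  where
  lem : ∀ a b c d → a ℕ.+ b ℕ.+ (c ℕ.+ d) ≡ a ℕ.+ c ℕ.+ (b ℕ.+ d)
  lem = solve-∀ℕ

term-monoᵃ : ∀ r s s′ → term false r s s′ ≤ term true r s s′
term-monoᵃ r s s′ = ≤ᵇ⇒≤ (tauto 3 (λ { (r ∷ s ∷ s′ ∷ []) → term false r s s′ ≤ᵇ term true r s s′ }) refl (r ∷ s ∷ s′ ∷ []))

term-monoʳ : ∀ a s s′ → term a false s s′ ≤ term a true s s′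
term-monoʳ a s s′ = ≤ᵇ⇒≤ (tauto 3 (λ { (a ∷ s ∷ s′ ∷ []) → term a false s s′ ≤ᵇ term a true s s′ }) refl (a ∷ s ∷ s′ ∷ []))

cost-mono : ∀ {m} {A A′ R R′ : Vec Bool m} → A ⊑ A′ → R ⊑ R′ → ∀ S S′ → cost A R S S′ ≤ cost A′ R′ S S′
cost-mono [] [] [] [] = z≤n
cost-mono (keep a p) (keep r q) (s ∷ S) (s′ ∷ S′) = ℕP.+-monoʳ-≤ (term a r s s′) (cost-mono p q S S′)
cost-mono (keep a p) (add q) (s ∷ S) (s′ ∷ S′) = ℕP.+-mono-≤ (term-monoʳ a s s′) (cost-mono p q S S′)
cost-mono (add p) (keep r q) (s ∷ S) (s′ ∷ S′) = ℕP.+-mono-≤ (term-monoᵃ r s s′) (cost-mono p q S S′)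
cost-mono (add p) (add q) (s ∷ S) (s′ ∷ S′) = ℕP.+-mono-≤
  (ℕP.≤-trans (term-monoᵃ false s s′) (term-monoʳ true s s′)) (cost-mono p q S S′)

-- Submodularity holds at each vertex separately if the union is covered by the union of the two
-- covers and the intersection by their intersection.
term-submod : ∀ a a′ r r′ s t s′ t′ →
  term (a ∨ a′) (r ∨ r′) (s ∨ t) (s′ ∨ t′) ℕ.+ term (a ∧ a′) (r ∧ r′) (s ∧ t) (s′ ∧ t′)
  ≤ term a r s s′ ℕ.+ term a′ r′ t t′
term-submod a a′ r r′ s t s′ t′ = ≤ᵇ⇒≤ (tauto 8 (λ { (a ∷ a′ ∷ r ∷ r′ ∷ s ∷ t ∷ s′ ∷ t′ ∷ []) →
    term (a ∨ a′) (r ∨ r′) (s ∨ t) (s′ ∨ t′) ℕ.+ term (a ∧ a′) (r ∧ r′) (s ∧ t) (s′ ∧ t′)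
    ≤ᵇ term a r s s′ ℕ.+ term a′ r′ t t′ }) refl (a ∷ a′ ∷ r ∷ r′ ∷ s ∷ t ∷ s′ ∷ t′ ∷ []))

cost-submod : ∀ {m} (A A′ R R′ S T S′ T′ : Vec Bool m) →
  cost (A ∪ A′) (R ∪ R′) (S ∪ T) (S′ ∪ T′) ℕ.+ cost (A ∩ A′) (R ∩ R′) (S ∩ T) (S′ ∩ T′)
  ≤ cost A R S S′ ℕ.+ cost A′ R′ T T′
cost-submod [] [] [] [] [] [] [] [] = z≤n
cost-submod (a ∷ A) (a′ ∷ A′) (r ∷ R) (r′ ∷ R′) (s ∷ S) (t ∷ T) (s′ ∷ S′) (t′ ∷ T′) =
  subst₂ _≤_ (lem t∪ t∩ _ _) (lem (term a r s s′) (term a′ r′ t t′) _ _)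
    (ℕP.+-mono-≤ (term-submod a a′ r r′ s t s′ t′) (cost-submod A A′ R R′ S T S′ T′))
  where
  t∪ = term (a ∨ a′) (r ∨ r′) (s ∨ t) (s′ ∨ t′)
  t∩ = term (a ∧ a′) (r ∧ r′) (s ∧ t) (s′ ∧ t′)
  lem : ∀ a b c d → a ℕ.+ b ℕ.+ (c ℕ.+ d) ≡ a ℕ.+ c ℕ.+ (b ℕ.+ d)
  lem = solve-∀ℕ

wrank-≤ : ∀ m X S → wrank m X ≤ cost (V.take m X) (V.drop m X) S (rot S)
wrank-≤ m X S = proj₁ (rankAR-isRank (V.take m X) (V.drop m X)) S

wrank-matroid : ∀ m → IsMatroid (rmat (m ℕ.+ m) ⊤ (wrank m))
wrank-matroid m = record
  { rk-bound = λ X _ → subst (wrank m X ≤_) (trans (cost-⊥ (V.take m X) (V.drop m X) (rot ⊥)) (sym (∣∣-++ m X))) (wrank-≤ m X ⊥)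
  ; rk-mono = λ X Y _ X⊆Y → mono X Y (⊆⇒⊑ X⊆Y)
  ; rk-submod = λ X Y _ _ → submod X Y }
  where
  mono : ∀ X Y → X ⊑ Y → wrank m X ≤ wrank m Y
  mono X Y s with rankAR-isRank (V.take m Y) (V.drop m Y)
  ... | _ , S , eq = ℕP.≤-trans (wrank-≤ m X S) (subst (cost (V.take m X) (V.drop m X) S (rot S) ≤_) eq
          (cost-mono (⊑-take m s) (⊑-drop m s) S (rot S)))
  submod : ∀ X Y → wrank m (X ∪ Y) ℕ.+ wrank m (X ∩ Y) ≤ wrank m X ℕ.+ wrank m Y
  submod X Y with rankAR-isRank (V.take m X) (V.drop m X) | rankAR-isRank (V.take m Y) (V.drop m Y)
  ... | _ , S , eqS | _ , T , eqT = ℕP.≤-trans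
    (ℕP.+-mono-≤ (wrank-≤ m (X ∪ Y) (S ∪ T)) (wrank-≤ m (X ∩ Y) (S ∩ T)))
    (subst₂ _≤_ (cong₂ ℕ._+_ (eq _∨_) (eq _∧_)) (cong₂ ℕ._+_ eqS eqT)
      (cost-submod (V.take m X) (V.take m Y) (V.drop m X) (V.drop m Y) S T (rot S) (rot T)))
    where
    eq : ∀ (f : Bool → Bool → Bool) →
      cost (V.zipWith f (V.take m X) (V.take m Y)) (V.zipWith f (V.drop m X) (V.drop m Y)) (V.zipWith f S T)
          (V.zipWith f (rot S) (rot T))
      ≡ cost (V.take m (V.zipWith f X Y)) (V.drop m (V.zipWith f X Y)) (V.zipWith f S T) (rot (V.zipWith f S T))
    eq f rewrite VP.take-zipWith {m = m} f X Y | VP.drop-zipWith {m = m} f X Y | rot-zipWith f S T = refl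

cost-⊤ : ∀ {m} (S S′ : Vec Bool m) → m ≤ cost ⊤ ⊤ S S′
cost-⊤ [] [] = z≤n
cost-⊤ (s ∷ S) (s′ ∷ S′) = ℕP.+-mono-≤ (≤ᵇ⇒≤ {1} (tauto 2 (λ { (s ∷ s′ ∷ []) → 1 ≤ᵇ term true true s s′ }) refl
    (s ∷ s′ ∷ []))) (cost-⊤ S S′)

cost-on-⊤ : ∀ {m} (A R : Vec Bool m) → cost A R ⊤ ⊤ ≡ m
cost-on-⊤ [] [] = refl
cost-on-⊤ (a ∷ A) (r ∷ R) rewrite ∧-zeroʳ a | ∧-zeroʳ r = cong suc (cost-on-⊤ A R)

replicate-∷ʳ : ∀ {A : Set} m (x : A) → V.replicate m x ∷ʳ x ≡ x ∷ V.replicate m x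
replicate-∷ʳ zero x = refl
replicate-∷ʳ (suc m) x = cong (x ∷_) (replicate-∷ʳ m x)

rot-replicate : ∀ {A : Set} m (x : A) → rot (V.replicate m x) ≡ V.replicate m x
rot-replicate zero x = refl
rot-replicate (suc m) x = replicate-∷ʳ m x

rank-⊤ : ∀ m → rankAR {m} ⊤ ⊤ ≡ m
rank-⊤ m = isRank-unique {A = ⊤} {⊤} (rankAR-isRank ⊤ ⊤)
  ((λ S → cost-⊤ S (rot S)) , ⊤ , trans (cong (cost ⊤ ⊤ ⊤) (rot-replicate m true)) (cost-on-⊤ {m} ⊤ ⊤))

take-⊤ : ∀ m {n} → V.take m (⊤ {m ℕ.+ n}) ≡ ⊤
take-⊤ zero = refl
take-⊤ (suc m) = cong (true ∷_) (take-⊤ m)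

drop-⊤ : ∀ m {n} → V.drop m (⊤ {m ℕ.+ n}) ≡ ⊤
drop-⊤ zero = refl
drop-⊤ (suc m) = drop-⊤ m

wrank-⊤ : ∀ m → wrank m ⊤ ≡ m
wrank-⊤ m = trans (cong₂ rankAR (take-⊤ m) (drop-⊤ m)) (rank-⊤ m)

-- Words and palindromy

sum2 : ∀ m → (Subset m → Subset m → ℤ) → ℤ
sum2 m f = ∑ (subsets m) (λ b → ∑ (subsets m) (λ a → f b a))

sum2-suc : ∀ m f → sum2 (suc m) f ≡
  (sum2 m (λ b a → f (false ∷ b) (false ∷ a)) ℤ.+ sum2 m (λ b a → f (false ∷ b) (true ∷ a))) ℤ.+
  (sum2 m (λ b a → f (true ∷ b) (false ∷ a)) ℤ.+ sum2 m (λ b a → f (true ∷ b) (true ∷ a)))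
sum2-suc m f = trans (∑-subsets-suc m _) (cong₂ ℤ._+_ (half false) (half true))
  where
  half : ∀ c → ∑ (subsets m) (λ b → ∑ (subsets (suc m)) (f (c ∷ b))) ≡
    sum2 m (λ b a → f (c ∷ b) (false ∷ a)) ℤ.+ sum2 m (λ b a → f (c ∷ b) (true ∷ a))
  half c = trans (∑-cong (subsets m) (λ b → ∑-subsets-suc m (f (c ∷ b)))) (∑-+ (subsets m) _ _)

sum2-cong : ∀ m {f g : Subset m → Subset m → ℤ} → (∀ b a → f b a ≡ g b a) → sum2 m f ≡ sum2 m g
sum2-cong m h = ∑-cong (subsets m) λ b → ∑-cong (subsets m) (h b)

sum2-*ˡ : ∀ m c (f : Subset m → Subset m → ℤ) → sum2 m (λ b a → c ℤ.* f b a) ≡ c ℤ.* sum2 m f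
sum2-*ˡ m c f = trans (∑-cong (subsets m) λ b → ∑-*ˡ (subsets m) c (f b)) (∑-*ˡ (subsets m) c _)

-- Heights are taken at the vertices, in units of two half-steps.  The letters (0,0) and (0,1) start with a
-- down half-step and are forbidden at height 0; depth e is the least start from which a word is allowed
-- and ends at height at least e.

step : Bool → Bool → ℕ → ℕ
step true true g = suc g
step false false g = ℕ.pred g
step true false g = g
step false true g = g

pre : Bool → Bool → ℕ → ℕ
pre true true d = ℕ.pred d
pre false false d = suc d
pre true false d = d
pre false true d = suc (ℕ.pred d)

depth : ∀ {m} → ℕ → Vec Bool m → Vec Bool m → ℕ
depth e [] [] = e
depth e (b ∷ B) (a ∷ A) = pre b a (depth e B A)

zeros : ∀ {m} → ℕ → Vec Bool m → Vec Bool m → Vec Bool m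
zeros g [] [] = []
zeros g (b ∷ B) (a ∷ A) = (g ≡ᵇ 0) ∷ zeros (step b a g) B A

end : ∀ {m} → ℕ → Vec Bool m → Vec Bool m → ℕ
end g [] [] = g
end g (b ∷ B) (a ∷ A) = end (step b a g) B A

spokes : ∀ {m} → Vec Bool m → Vec Bool m → Vec Bool m
spokes B A = zeros (depth 0 B A) B A

rims : ∀ {m} → Vec Bool m → Vec Bool m → Vec Bool m
rims = V.zipWith (λ b a → b ∧ not a)

balanced : ∀ {m} → Vec Bool m → Vec Bool m → Bool
balanced {m} B A = ∣ B ∣ ℕ.+ ∣ A ∣ ≡ᵇ m

pre≤⇒≤step : ∀ b a {d g} → pre b a d ≤ g → d ≤ step b a g
pre≤⇒≤step true true {zero} le = z≤n
pre≤⇒≤step true true {suc d} le = s≤s le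
pre≤⇒≤step true false le = le
pre≤⇒≤step false false (s≤s le) = le
pre≤⇒≤step false true {zero} le = z≤n
pre≤⇒≤step false true {suc d} le = le

-- A letter changes the height by b + a - 1; starting at the depth or above keeps `pred` from
-- truncating.
end-count : ∀ {m} g (B A : Vec Bool m) → depth 0 B A ≤ g → end g B A ℕ.+ m ≡ g ℕ.+ (∣ B ∣ ℕ.+ ∣ A ∣)
end-count g [] [] le = refl
end-count {suc m} g (b ∷ B) (a ∷ A) le = trans (ℕP.+-suc _ m)
  (trans (cong suc (end-count (step b a g) B A (pre≤⇒≤step b a le))) (go b a g le))
  where
  x = ∣ B ∣
  y = ∣ A ∣
  go : ∀ b a g → pre b a (depth 0 B A) ≤ g → suc (step b a g ℕ.+ (x ℕ.+ y)) ≡ g ℕ.+ (∣ b ∷ B ∣ ℕ.+ ∣ a ∷ A ∣)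
  go true true g le = lem g x y
    where
    lem : ∀ g x y → suc (suc g ℕ.+ (x ℕ.+ y)) ≡ g ℕ.+ (suc x ℕ.+ suc y)
    lem = solve-∀ℕ
  go true false g le = sym (ℕP.+-suc g (x ℕ.+ y))
  go false false (suc g) le = refl
  go false true g le = lem g x y
    where
    lem : ∀ g x y → suc (g ℕ.+ (x ℕ.+ y)) ≡ g ℕ.+ (x ℕ.+ suc y)
    lem = solve-∀ℕ

balanced-end : ∀ {m} (B A : Vec Bool m) → balanced B A ≡ true → end (depth 0 B A) B A ≡ depth 0 B A
balanced-end {m} B A e = ℕP.+-cancelʳ-≡ m _ _ (trans (end-count _ B A ℕP.≤-refl)
  (cong (depth 0 B A ℕ.+_) (≡ᵇ⇒≡ {∣ B ∣ ℕ.+ ∣ A ∣} e)))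

suc-⊔-∸ : ∀ d x s → suc (d ℕ.⊔ (x ∸ s)) ≡ suc d ℕ.⊔ (suc x ∸ s)
suc-⊔-∸ d x zero = refl
suc-⊔-∸ d zero (suc s) rewrite ℕP.0∸n≡0 s = cong suc (ℕP.⊔-identityʳ d)
suc-⊔-∸ d (suc x) (suc s) = suc-⊔-∸ d x s

-- The total displacement does not depend on the start, so asking for an end at height `e` or more
-- adds just one further lower bound for the start.
depth-shift : ∀ {m} e (B A : Vec Bool m) →
  depth e B A ≡ depth 0 B A ℕ.⊔ ((e ℕ.+ m) ∸ (∣ B ∣ ℕ.+ ∣ A ∣))
depth-shift e [] [] = sym (ℕP.+-identityʳ e)
depth-shift {suc m} e (b ∷ B) (a ∷ A) = trans (cong (pre b a) (depth-shift e B A))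
  (trans (go b a (depth 0 B A)) (cong (λ z → pre b a (depth 0 B A) ℕ.⊔ (z ∸ (∣ b ∷ B ∣ ℕ.+ ∣ a ∷ A ∣))) (sym (ℕP.+-suc e m))))
  where
  s = ∣ B ∣ ℕ.+ ∣ A ∣
  pred-⊔ : ∀ x y → ℕ.pred (x ℕ.⊔ y) ≡ ℕ.pred x ℕ.⊔ ℕ.pred y
  pred-⊔ zero y = refl
  pred-⊔ (suc x) zero = sym (ℕP.⊔-identityʳ x)
  pred-⊔ (suc x) (suc y) = refl
  go : ∀ b a d → pre b a (d ℕ.⊔ ((e ℕ.+ m) ∸ s)) ≡ pre b a d ℕ.⊔ (suc (e ℕ.+ m) ∸ (∣ b ∷ B ∣ ℕ.+ ∣ a ∷ A ∣))
  go true true d rewrite ℕP.+-suc ∣ B ∣ ∣ A ∣ = trans (pred-⊔ d _) (cong (ℕ.pred d ℕ.⊔_) (ℕP.pred[m∸n]≡m∸[1+n] (e ℕ.+ m) s))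
  go true false d = refl
  go false false d = suc-⊔-∸ d (e ℕ.+ m) s
  go false true d rewrite ℕP.+-suc ∣ B ∣ ∣ A ∣ = lem d ((e ℕ.+ m) ∸ s)
    where
    lem : ∀ d x → suc (ℕ.pred (d ℕ.⊔ x)) ≡ suc (ℕ.pred d) ℕ.⊔ x
    lem zero zero = refl
    lem zero (suc x) = refl
    lem (suc d) zero = refl
    lem (suc d) (suc x) = refl

depth-∷ʳ : ∀ {m} e (B A : Vec Bool m) b a → depth e (B ∷ʳ b) (A ∷ʳ a) ≡ depth (pre b a e) B A
depth-∷ʳ e [] [] b a = refl
depth-∷ʳ e (b′ ∷ B) (a′ ∷ A) b a = cong (pre b′ a′) (depth-∷ʳ e B A b a)

zeros-∷ʳ : ∀ {m} g (B A : Vec Bool m) b a → zeros g (B ∷ʳ b) (A ∷ʳ a) ≡ zeros g B A ∷ʳ (end g B A ≡ᵇ 0)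
zeros-∷ʳ g [] [] b a = refl
zeros-∷ʳ g (b′ ∷ B) (a′ ∷ A) b a = cong ((g ≡ᵇ 0) ∷_) (zeros-∷ʳ (step b′ a′ g) B A b a)

-- A balanced walk closes up, so its minimum is a cyclic notion: the rotated word starts at the
-- height that the original one has after its first letter.
rot-spokes : ∀ {m} (B A : Vec Bool m) → balanced B A ≡ true → spokes (rot B) (rot A) ≡ rot (spokes B A)
rot-spokes [] [] e = refl
rot-spokes {suc m} (b ∷ B) (a ∷ A) e = trans (cong (λ d → zeros d (B ∷ʳ b) (A ∷ʳ a)) (trans (depth-∷ʳ 0 B A b a) (key b a bal)))
  (trans (zeros-∷ʳ _ B A b a) (cong (λ z → zeros H′ B A ∷ʳ (z ≡ᵇ 0)) (balanced-end (b ∷ B) (a ∷ A) e)))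
  where
  bal : ∣ b ∷ B ∣ ℕ.+ ∣ a ∷ A ∣ ≡ suc m
  bal = ≡ᵇ⇒≡ e
  d₀ = depth 0 B A
  H′ = step b a (pre b a d₀)
  -- The letter moved to the end requires `B`, `A` to finish at height `pre b a 0` or more;
  -- `depth-shift` makes this a maximum whose second entry is evaluated by the balance.
  key : ∀ b a → ∣ b ∷ B ∣ ℕ.+ ∣ a ∷ A ∣ ≡ suc m → depth (pre b a 0) B A ≡ step b a (pre b a d₀)
  key true false h = refl
  key true true h = lem d₀ (trans (depth-shift 0 B A)
      (cong (d₀ ℕ.⊔_) (trans (cong (_∸ (∣ B ∣ ℕ.+ ∣ A ∣)) m≡) (ℕP.m+n∸n≡m 1 (∣ B ∣ ℕ.+ ∣ A ∣)))))
    where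
    m≡ : m ≡ suc (∣ B ∣ ℕ.+ ∣ A ∣)
    m≡ = ℕP.suc-injective (trans (sym h) (cong suc (ℕP.+-suc ∣ B ∣ ∣ A ∣)))
    lem : ∀ d → d ≡ d ℕ.⊔ 1 → d ≡ suc (ℕ.pred d)
    lem zero ()
    lem (suc d) _ = refl
  key false false h = trans (depth-shift 1 B A) (trans (cong (d₀ ℕ.⊔_) (trans (cong (suc m ∸_) h) (ℕP.n∸n≡0 (suc m))))
      (ℕP.⊔-identityʳ d₀))
  key false true h = trans (depth-shift 1 B A) (trans (cong (d₀ ℕ.⊔_) (trans (cong (suc m ∸_) s≡) (ℕP.m+n∸n≡m 1 m))) (lem d₀))
    where
    s≡ : ∣ B ∣ ℕ.+ ∣ A ∣ ≡ m
    s≡ = ℕP.suc-injective (trans (sym (ℕP.+-suc ∣ B ∣ ∣ A ∣)) h)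
    lem : ∀ d → d ℕ.⊔ 1 ≡ suc (ℕ.pred d)
    lem zero = refl
    lem (suc zero) = refl
    lem (suc (suc d)) = refl

∣∷ʳ∣ : ∀ {m} (X : Subset m) x → ∣ X ∷ʳ x ∣ ≡ ∣ x ∷ X ∣
∣∷ʳ∣ [] x = refl
∣∷ʳ∣ (true ∷ X) true = cong suc (∣∷ʳ∣ X true)
∣∷ʳ∣ (true ∷ X) false = cong suc (∣∷ʳ∣ X false)
∣∷ʳ∣ (false ∷ X) true = ∣∷ʳ∣ X true
∣∷ʳ∣ (false ∷ X) false = ∣∷ʳ∣ X false

∣rot∣ : ∀ {m} (X : Subset m) → ∣ rot X ∣ ≡ ∣ X ∣
∣rot∣ [] = refl
∣rot∣ (x ∷ X) = ∣∷ʳ∣ X x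

⊆ᵇ-rot : ∀ {m} (X Y : Subset m) → (rot X ⊆ᵇ rot Y) ≡ (X ⊆ᵇ Y)
⊆ᵇ-rot [] [] = refl
⊆ᵇ-rot (x ∷ X) (y ∷ Y) = go X Y
  where
  ∧-swap : ∀ p q r → p ∧ (q ∧ r) ≡ q ∧ (p ∧ r)
  ∧-swap true q r = refl
  ∧-swap false true r = refl
  ∧-swap false false r = refl
  go : ∀ {m} (X Y : Subset m) → ((X ∷ʳ x) ⊆ᵇ (Y ∷ʳ y)) ≡ (not x ∨ y) ∧ (X ⊆ᵇ Y)
  go [] [] = refl
  go (x′ ∷ X) (y′ ∷ Y) = trans (cong ((not x′ ∨ y′) ∧_) (go X Y)) (∧-swap (not x′ ∨ y′) (not x ∨ y) (X ⊆ᵇ Y))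

∑-∷ʳ : ∀ m (f : Subset (suc m) → ℤ) →
  ∑ (subsets (suc m)) f ≡ ∑ (subsets m) (λ X → f (X ∷ʳ false)) ℤ.+ ∑ (subsets m) (λ X → f (X ∷ʳ true))
∑-∷ʳ zero f = ∑-subsets-suc zero f
∑-∷ʳ (suc m) f = trans (∑-subsets-suc (suc m) f)
  (trans (cong₂ ℤ._+_ (∑-∷ʳ m (f ∘ (false ∷_))) (∑-∷ʳ m (f ∘ (true ∷_))))
   (trans (lem (∑ (subsets m) _) (∑ (subsets m) _) (∑ (subsets m) _) (∑ (subsets m) _))
     (sym (cong₂ ℤ._+_ (∑-subsets-suc m (λ X → f (X ∷ʳ false))) (∑-subsets-suc m (λ X → f (X ∷ʳ true)))))))
  where
  lem : ∀ a b c d → a ℤ.+ b ℤ.+ (c ℤ.+ d) ≡ a ℤ.+ c ℤ.+ (b ℤ.+ d)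
  lem = solve-∀

∑-rot : ∀ m (f : Subset m → ℤ) → ∑ (subsets m) (f ∘ rot) ≡ ∑ (subsets m) f
∑-rot zero f = refl
∑-rot (suc m) f = trans (∑-subsets-suc m (f ∘ rot)) (sym (∑-∷ʳ m f))

sum2-rot : ∀ m (f : Subset m → Subset m → ℤ) → sum2 m (λ b a → f (rot b) (rot a)) ≡ sum2 m f
sum2-rot m f = trans (∑-cong (subsets m) (λ b → ∑-rot m (f (rot b)))) (∑-rot m (λ b → ∑ (subsets m) (f b)))

contains : ∀ {m} (A R : Vec Bool m) → Subset m → Subset m → Bool
contains A R b a = (A ⊆ᵇ spokes b a) ∧ (R ⊆ᵇ rims b a)

-- Balance makes `∣ a ∣` equal to m - `∣ b ∣`, so this is the palindromy of the model with `k` in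
-- the place of the rank.
Palindromic : ∀ {m} (A R : Vec Bool m) → ℕ → Set
Palindromic {m} A R k = ∀ (ψ : ℕ → ℤ) →
  sum2 m (λ b a → ⟦ balanced b a ⟧ ℤ.* (⟦ contains A R b a ⟧ ℤ.* ψ ∣ b ∣)) ≡
  sum2 m (λ b a → ⟦ balanced b a ⟧ ℤ.* (⟦ contains A R b a ⟧ ℤ.* ψ (k ℕ.+ ∣ a ∣)))

-- Each case finds its centre in its own form, `∣ R ∣` or `rho`; carrying `IsRank` along identifies
-- it with the rank afterwards.
PalindromicRank : ∀ {m} (A R : Vec Bool m) → Set
PalindromicRank A R = ∃ λ k → IsRank A R k × Palindromic A R k

cost-rot : ∀ {m} (A R S S′ : Vec Bool m) → cost (rot A) (rot R) (rot S) (rot S′) ≡ cost A R S S′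
cost-rot [] [] [] [] = refl
cost-rot (a ∷ A) (r ∷ R) (s ∷ S) (s′ ∷ S′) = go A R S S′
  where
  lem : ∀ x y z → x ℕ.+ (y ℕ.+ z) ≡ y ℕ.+ (x ℕ.+ z)
  lem = solve-∀ℕ
  go : ∀ {m} (A R S S′ : Vec Bool m) → cost (A ∷ʳ a) (R ∷ʳ r) (S ∷ʳ s) (S′ ∷ʳ s′) ≡ term a r s s′ ℕ.+ cost A R S S′
  go [] [] [] [] = refl
  go (x ∷ A) (y ∷ R) (z ∷ S) (z′ ∷ S′) = trans (cong (term x y z z′ ℕ.+_) (go A R S S′))
    (lem (term x y z z′) (term a r s s′) (cost A R S S′))

unrot : ∀ {A : Set} {m} (xs : Vec A m) → ∃ λ ys → rot ys ≡ xs
unrot [] = [] , refl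
unrot {m = suc m} xs with V.initLast xs
... | ys , y , eq = y ∷ ys , sym eq

palindromic-rank-unrot : ∀ {m} (A R : Vec Bool m) → PalindromicRank (rot A) (rot R) → PalindromicRank A R
palindromic-rank-unrot {m} A R (k , (lower , S , attained) , pal) = k , (lower′ , upper′) , pal′
  where
  lower′ : ∀ S → k ≤ cost A R S (rot S)
  lower′ S = subst (k ≤_) (cost-rot A R S (rot S)) (lower (rot S))
  upper′ : ∃ λ S → cost A R S (rot S) ≡ k
  upper′ with unrot S
  ... | S₀ , refl = S₀ , trans (sym (cost-rot A R S₀ (rot S₀))) attained
  turn : ∀ (Ψ : ℕ → ℕ → ℤ) →
    sum2 m (λ b a → ⟦ balanced b a ⟧ ℤ.* (⟦ contains A R b a ⟧ ℤ.* Ψ ∣ b ∣ ∣ a ∣)) ≡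
    sum2 m (λ b a → ⟦ balanced b a ⟧ ℤ.* (⟦ contains (rot A) (rot R) b a ⟧ ℤ.* Ψ ∣ b ∣ ∣ a ∣))
  turn Ψ = trans (sum2-cong m point) (sum2-rot m (λ b a → ⟦ balanced b a ⟧ ℤ.*
      (⟦ contains (rot A) (rot R) b a ⟧ ℤ.* Ψ ∣ b ∣ ∣ a ∣)))
    where
    point : ∀ b a → ⟦ balanced b a ⟧ ℤ.* (⟦ contains A R b a ⟧ ℤ.* Ψ ∣ b ∣ ∣ a ∣) ≡
      ⟦ balanced (rot b) (rot a) ⟧ ℤ.* (⟦ contains (rot A) (rot R) (rot b) (rot a) ⟧ ℤ.* Ψ ∣ rot b ∣ ∣ rot a ∣)
    point b a rewrite ∣rot∣ b | ∣rot∣ a = go (balanced b a) refl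
      where
      go : ∀ c → balanced b a ≡ c → ⟦ c ⟧ ℤ.* (⟦ contains A R b a ⟧ ℤ.* Ψ ∣ b ∣ ∣ a ∣) ≡
        ⟦ c ⟧ ℤ.* (⟦ contains (rot A) (rot R) (rot b) (rot a) ⟧ ℤ.* Ψ ∣ b ∣ ∣ a ∣)
      go false _ = trans (ℤP.*-zeroˡ (⟦ contains A R b a ⟧ ℤ.* Ψ ∣ b ∣ ∣ a ∣))
          (sym (ℤP.*-zeroˡ (⟦ contains (rot A) (rot R) (rot b) (rot a) ⟧ ℤ.* Ψ ∣ b ∣ ∣ a ∣)))
      go true e = cong (λ c → + 1 ℤ.* (⟦ c ⟧ ℤ.* Ψ ∣ b ∣ ∣ a ∣)) (sym (cong₂ _∧_
        (trans (cong (rot A ⊆ᵇ_) (rot-spokes b a e)) (⊆ᵇ-rot A (spokes b a)))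
        (trans (cong (rot R ⊆ᵇ_) (sym (rot-zipWith _ b a))) (⊆ᵇ-rot R (rims b a)))))
  pal′ : Palindromic A R k
  pal′ ψ = trans (turn (λ x y → ψ x)) (trans (pal ψ) (sym (turn (λ x y → ψ (k ℕ.+ y)))))

-- No spokes: exchange the two halves of every letter outside R.

⊥⊆ᵇ : ∀ {m} (X : Subset m) → (⊥ ⊆ᵇ X) ≡ true
⊥⊆ᵇ [] = refl
⊥⊆ᵇ (x ∷ X) = ⊥⊆ᵇ X

sum2-letters : ∀ m (f g : Subset (suc m) → Subset (suc m) → ℤ) →
  sum2 m (λ b a → f (false ∷ b) (false ∷ a)) ≡ sum2 m (λ b a → g (false ∷ b) (false ∷ a)) →
  sum2 m (λ b a → f (false ∷ b) (true ∷ a)) ≡ sum2 m (λ b a → g (true ∷ b) (false ∷ a)) →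
  sum2 m (λ b a → f (true ∷ b) (false ∷ a)) ≡ sum2 m (λ b a → g (false ∷ b) (true ∷ a)) →
  sum2 m (λ b a → f (true ∷ b) (true ∷ a)) ≡ sum2 m (λ b a → g (true ∷ b) (true ∷ a)) →
  sum2 (suc m) f ≡ sum2 (suc m) g
sum2-letters m f g e00 e01 e10 e11 = trans (sum2-suc m f) (trans
  (trans (cong₂ ℤ._+_ (cong₂ ℤ._+_ e00 e01) (cong₂ ℤ._+_ e10 e11))
    (lem (sum2 m (λ b a → g (false ∷ b) (false ∷ a))) (sum2 m (λ b a → g (true ∷ b) (false ∷ a)))
         (sum2 m (λ b a → g (false ∷ b) (true ∷ a))) (sum2 m (λ b a → g (true ∷ b) (true ∷ a)))))
  (sym (sum2-suc m g)))
  where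
  lem : ∀ a b c d → (a ℤ.+ b) ℤ.+ (c ℤ.+ d) ≡ (a ℤ.+ c) ℤ.+ (b ℤ.+ d)
  lem = solve-∀

-- The exchange fixes the total number of ups, which the first argument of `Φ` keeps available for
-- the balance condition. Letters in `R` are (1 , 0) and stay, so they give b its surplus `∣ R ∣`.
swap-letters : ∀ {m} (R : Vec Bool m) (Φ : ℕ → ℕ → ℤ) →
  sum2 m (λ b a → ⟦ R ⊆ᵇ rims b a ⟧ ℤ.* Φ (∣ b ∣ ℕ.+ ∣ a ∣) ∣ b ∣) ≡
  sum2 m (λ b a → ⟦ R ⊆ᵇ rims b a ⟧ ℤ.* Φ (∣ b ∣ ℕ.+ ∣ a ∣) (∣ R ∣ ℕ.+ ∣ a ∣))
swap-letters [] Φ = refl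
swap-letters {suc m} (true ∷ R) Φ = trans (sum2-suc m f) (trans
  (cong (λ z → (sum2 m (λ b a → + 0) ℤ.+ sum2 m (λ b a → + 0)) ℤ.+ (z ℤ.+ sum2 m (λ b a → + 0)))
    (swap-letters R (λ x y → Φ (suc x) (suc y)))) (sym (sum2-suc m g)))
  where
  f g : Subset (suc m) → Subset (suc m) → ℤ
  f b a = ⟦ (true ∷ R) ⊆ᵇ rims b a ⟧ ℤ.* Φ (∣ b ∣ ℕ.+ ∣ a ∣) ∣ b ∣
  g b a = ⟦ (true ∷ R) ⊆ᵇ rims b a ⟧ ℤ.* Φ (∣ b ∣ ℕ.+ ∣ a ∣) (suc ∣ R ∣ ℕ.+ ∣ a ∣)
swap-letters {suc m} (false ∷ R) Φ = sum2-letters m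
  (λ b a → ⟦ (false ∷ R) ⊆ᵇ rims b a ⟧ ℤ.* Φ (∣ b ∣ ℕ.+ ∣ a ∣) ∣ b ∣)
  (λ b a → ⟦ (false ∷ R) ⊆ᵇ rims b a ⟧ ℤ.* Φ (∣ b ∣ ℕ.+ ∣ a ∣) (∣ R ∣ ℕ.+ ∣ a ∣))
  (swap-letters R Φ) l01 l10 l11
  where
  up : ∀ (p q : Subset m → Subset m → ℕ) (Ψ : ℕ → ℕ → ℤ) (p′ q′ : Subset m → Subset m → ℕ) →
    (∀ b a → p b a ≡ p′ b a) → (∀ b a → q b a ≡ q′ b a) →
    sum2 m (λ b a → ⟦ R ⊆ᵇ rims b a ⟧ ℤ.* Ψ (p b a) (q b a)) ≡ sum2 m (λ b a → ⟦ R ⊆ᵇ rims b a ⟧ ℤ.* Ψ (p′ b a) (q′ b a))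
  up p q Ψ p′ q′ ep eq = sum2-cong m λ b a → cong₂ (λ x y → ⟦ R ⊆ᵇ rims b a ⟧ ℤ.* Ψ x y) (ep b a) (eq b a)
  sa : ∀ (b a : Subset m) → ∣ b ∣ ℕ.+ suc ∣ a ∣ ≡ suc (∣ b ∣ ℕ.+ ∣ a ∣)
  sa b a = ℕP.+-suc ∣ b ∣ ∣ a ∣
  sR : ∀ (b a : Subset m) → ∣ R ∣ ℕ.+ suc ∣ a ∣ ≡ suc (∣ R ∣ ℕ.+ ∣ a ∣)
  sR b a = ℕP.+-suc ∣ R ∣ ∣ a ∣
  l01 : sum2 m (λ b a → ⟦ R ⊆ᵇ rims b a ⟧ ℤ.* Φ (∣ b ∣ ℕ.+ suc ∣ a ∣) ∣ b ∣) ≡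
        sum2 m (λ b a → ⟦ R ⊆ᵇ rims b a ⟧ ℤ.* Φ (suc ∣ b ∣ ℕ.+ ∣ a ∣) (∣ R ∣ ℕ.+ ∣ a ∣))
  l01 = trans (up _ _ Φ _ _ sa (λ _ _ → refl)) (swap-letters R (λ x y → Φ (suc x) y))
  l10 : sum2 m (λ b a → ⟦ R ⊆ᵇ rims b a ⟧ ℤ.* Φ (suc ∣ b ∣ ℕ.+ ∣ a ∣) (suc ∣ b ∣)) ≡
        sum2 m (λ b a → ⟦ R ⊆ᵇ rims b a ⟧ ℤ.* Φ (∣ b ∣ ℕ.+ suc ∣ a ∣) (∣ R ∣ ℕ.+ suc ∣ a ∣))
  l10 = trans (swap-letters R (λ x y → Φ (suc x) (suc y))) (sym (up _ _ Φ _ _ sa sR))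
  l11 : sum2 m (λ b a → ⟦ R ⊆ᵇ rims b a ⟧ ℤ.* Φ (suc ∣ b ∣ ℕ.+ suc ∣ a ∣) (suc ∣ b ∣)) ≡
        sum2 m (λ b a → ⟦ R ⊆ᵇ rims b a ⟧ ℤ.* Φ (suc ∣ b ∣ ℕ.+ suc ∣ a ∣) (∣ R ∣ ℕ.+ suc ∣ a ∣))
  l11 = trans (up _ _ Φ _ _ (λ b a → cong suc (sa b a)) (λ _ _ → refl))
    (trans (swap-letters R (λ x y → Φ (suc (suc x)) (suc y))) (sym (up _ _ Φ _ _ (λ b a → cong suc (sa b a)) sR)))

palindromic-rank-no-spokes : ∀ {m} (R : Vec Bool m) → PalindromicRank ⊥ R
palindromic-rank-no-spokes {m} R = ∣ R ∣ , ((λ S → lower R S (rot S)) , ⊥ , trans (cost-⊥ ⊥ R (rot ⊥))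
    (cong (ℕ._+ ∣ R ∣) (∣⊥∣≡0 m))) , λ ψ →
  trans (sum2-cong m λ b a → rearr b a (ψ ∣ b ∣)) (trans
    (swap-letters R (λ x y → ⟦ x ≡ᵇ m ⟧ ℤ.* ψ y))
    (sum2-cong m λ b a → sym (rearr b a (ψ (∣ R ∣ ℕ.+ ∣ a ∣)))))
  where
  lower : ∀ {m} (R S S′ : Vec Bool m) → ∣ R ∣ ≤ cost ⊥ R S S′
  lower [] [] [] = z≤n
  lower (r ∷ R) (s ∷ S) (s′ ∷ S′) = subst (_≤ cost ⊥ (r ∷ R) (s ∷ S) (s′ ∷ S′)) (sym (card-∷ r R))
    (ℕP.+-mono-≤ (≤ᵇ⇒≤ {𝟙 r} (tauto 3 (λ { (r ∷ s ∷ s′ ∷ []) → 𝟙 r ≤ᵇ term false r s s′ }) refl (r ∷ s ∷ s′ ∷ [])))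
        (lower R S S′))
  mix : ∀ a b c → a ℤ.* (b ℤ.* c) ≡ b ℤ.* (a ℤ.* c)
  mix = solve-∀
  rearr : ∀ b a x → ⟦ balanced b a ⟧ ℤ.* (⟦ contains ⊥ R b a ⟧ ℤ.* x) ≡ ⟦ R ⊆ᵇ rims b a ⟧ ℤ.* (⟦ ∣ b ∣ ℕ.+ ∣ a ∣ ≡ᵇ m ⟧ ℤ.* x)
  rearr b a x rewrite ⊥⊆ᵇ (spokes b a) = mix ⟦ balanced b a ⟧ ⟦ R ⊆ᵇ rims b a ⟧ x

-- Closed walks from a prescribed spoke at vertex 0

chk : Bool → ℕ → Bool
chk α g = not α ∨ (g ≡ᵇ 0)

allowed : Bool → Bool → Bool → ℕ → Bool
allowed ρ b a g = (not ρ ∨ (b ∧ not a)) ∧ (b ∨ not (g ≡ᵇ 0))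

-- The condition that the start be the depth is global; here it is replaced by conditions checked
-- letter by letter, which admit a recursion on the current height.
closedWalk : ∀ {m} → ℕ → (A R b a : Vec Bool m) → Bool
closedWalk g [] [] [] [] = g ≡ᵇ 0
closedWalk g (α ∷ A) (ρ ∷ R) (b ∷ B) (a ∷ A′) = chk α g ∧ (allowed ρ b a g ∧ closedWalk (step b a g) A R B A′)

pre≤ : ∀ b a d g → (pre b a d ≤ᵇ g) ≡ (b ∨ not (g ≡ᵇ 0)) ∧ (d ≤ᵇ step b a g)
pre≤ true true zero g = refl
pre≤ true true (suc zero) g = refl
pre≤ true true (suc (suc d)) g = refl
pre≤ true false d g = refl
pre≤ false false d zero = refl
pre≤ false false zero (suc g) = refl
pre≤ false false (suc d) (suc g) = refl
pre≤ false true d zero = refl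
pre≤ false true zero (suc g) = refl
pre≤ false true (suc d) (suc g) = refl

closedWalk-char : ∀ {m} g (A R B A′ : Vec Bool m) → closedWalk g A R B A′ ≡
  (((depth 0 B A′ ≤ᵇ g) ∧ (end g B A′ ≡ᵇ 0)) ∧ ((A ⊆ᵇ zeros g B A′) ∧ (R ⊆ᵇ rims B A′)))
closedWalk-char g [] [] [] [] = sym (∧-identityʳ (g ≡ᵇ 0))
closedWalk-char g (α ∷ A) (ρ ∷ R) (b ∷ B) (a ∷ A′)
  rewrite closedWalk-char (step b a g) A R B A′ | pre≤ b a (depth 0 B A′) g =
  shuffle (chk α g) (not ρ ∨ (b ∧ not a)) (b ∨ not (g ≡ᵇ 0)) _ _ _ _
  where
  shuffle : ∀ c p q d e x y → c ∧ ((p ∧ q) ∧ ((d ∧ e) ∧ (x ∧ y))) ≡ (((q ∧ d) ∧ e) ∧ ((c ∧ x) ∧ (p ∧ y)))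
  shuffle true true true d e x y = refl
  shuffle true true false d e x y = refl
  shuffle true false true d e x y = sym (trans (cong ((d ∧ e) ∧_) (∧-zeroʳ x)) (∧-zeroʳ (d ∧ e)))
  shuffle true false false d e x y = refl
  shuffle false p true d e x y = sym (∧-zeroʳ (d ∧ e))
  shuffle false p false d e x y = refl

-- A prescribed spoke at vertex 0 forces the depth to be 0, and balance is then the return to height
-- 0.
closedWalk-head : ∀ {m} (A R B A′ : Vec Bool (suc m)) → V.head A ≡ true →
  balanced B A′ ∧ contains A R B A′ ≡ closedWalk 0 A R B A′
closedWalk-head {m} A@(true ∷ _) R B@(_ ∷ _) A′@(_ ∷ _) refl = trans (bool-ext to from) (sym (closedWalk-char 0 A R B A′))
  where
  d = depth 0 B A′
  rhs : Bool
  rhs = ((d ≤ᵇ 0) ∧ (end 0 B A′ ≡ᵇ 0)) ∧ ((A ⊆ᵇ zeros 0 B A′) ∧ (R ⊆ᵇ rims B A′))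
  to : balanced B A′ ∧ contains A R B A′ ≡ true → rhs ≡ true
  to h with ∧-true {balanced B A′} h
  ... | bal , con with ∧-true {A ⊆ᵇ spokes B A′} con
  ... | hA , hR = cong₂ _∧_ (cong₂ _∧_ (≤⇒≤ᵇ (ℕP.≤-reflexive d≡0))
        (≡⇒≡ᵇ (trans (cong (λ g → end g B A′) (sym d≡0)) (trans (balanced-end B A′ bal) d≡0))))
      (cong₂ _∧_ (trans (cong (λ g → A ⊆ᵇ zeros g B A′) (sym d≡0)) hA) hR)
    where
    d≡0 : d ≡ 0
    d≡0 = ≡ᵇ⇒≡ {d} (proj₁ (∧-true {d ≡ᵇ 0} hA))
  from : rhs ≡ true → balanced B A′ ∧ contains A R B A′ ≡ true
  from h with ∧-true {(d ≤ᵇ 0) ∧ (end 0 B A′ ≡ᵇ 0)} h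
  ... | h₁ , h₂ with ∧-true {d ≤ᵇ 0} h₁ | ∧-true {A ⊆ᵇ zeros 0 B A′} h₂
  ... | hd , he | hA , hR = cong₂ _∧_
      (≡⇒≡ᵇ (trans (sym (end-count 0 B A′ d≤0)) (cong (ℕ._+ suc m) (≡ᵇ⇒≡ {end 0 B A′} he))))
      (cong₂ _∧_ (trans (cong (λ g → A ⊆ᵇ zeros g B A′) (ℕP.n≤0⇒n≡0 d≤0)) hA) hR)
    where
    d≤0 : d ≤ 0
    d≤0 = ≤ᵇ⇒≤ {d} hd

-- Transfer recursion for the sum over closed walks; the up-steps already made are stored by
-- shifting the arguments of `Ψ`.
walks : ∀ {m} → (A R : Vec Bool m) → ℕ → (ℕ → ℕ → ℤ) → ℤ
walks [] [] g Ψ = ⟦ g ≡ᵇ 0 ⟧ ℤ.* Ψ 0 0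
walks (α ∷ A) (ρ ∷ R) g Ψ = ⟦ chk α g ⟧ ℤ.*
  (((⟦ allowed ρ false false g ⟧ ℤ.* walks A R (ℕ.pred g) Ψ) ℤ.+
    (⟦ allowed ρ false true g ⟧ ℤ.* walks A R g (λ x y → Ψ x (suc y)))) ℤ.+
   ((⟦ allowed ρ true false g ⟧ ℤ.* walks A R g (λ x y → Ψ (suc x) y)) ℤ.+
    (⟦ allowed ρ true true g ⟧ ℤ.* walks A R (suc g) (λ x y → Ψ (suc x) (suc y)))))

walks-sum : ∀ {m} (A R : Vec Bool m) g Ψ →
  sum2 m (λ b a → ⟦ closedWalk g A R b a ⟧ ℤ.* Ψ ∣ b ∣ ∣ a ∣) ≡ walks A R g Ψ
walks-sum [] [] g Ψ = trans (ℤP.+-identityʳ _) (ℤP.+-identityʳ _)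
walks-sum {suc m} (α ∷ A) (ρ ∷ R) g Ψ = trans (sum2-suc m (λ b a → ⟦ closedWalk g (α ∷ A) (ρ ∷ R) b a ⟧ ℤ.* Ψ ∣ b ∣ ∣ a ∣))
  (trans (cong₂ ℤ._+_ (cong₂ ℤ._+_ (letter false false Ψ) (letter false true (λ x y → Ψ x (suc y))))
                      (cong₂ ℤ._+_ (letter true false (λ x y → Ψ (suc x) y)) (letter true true (λ x y → Ψ (suc x) (suc y)))))
    (factor ⟦ chk α g ⟧
      (⟦ allowed ρ false false g ⟧ ℤ.* walks A R (ℕ.pred g) Ψ)
      (⟦ allowed ρ false true g ⟧ ℤ.* walks A R g (λ x y → Ψ x (suc y)))
      (⟦ allowed ρ true false g ⟧ ℤ.* walks A R g (λ x y → Ψ (suc x) y))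
      (⟦ allowed ρ true true g ⟧ ℤ.* walks A R (suc g) (λ x y → Ψ (suc x) (suc y)))))
  where
  factor : ∀ c p q r s → (c ℤ.* p ℤ.+ c ℤ.* q) ℤ.+ (c ℤ.* r ℤ.+ c ℤ.* s) ≡ c ℤ.* ((p ℤ.+ q) ℤ.+ (r ℤ.+ s))
  factor = solve-∀
  letter : ∀ b a (Ψ′ : ℕ → ℕ → ℤ) →
    sum2 m (λ B A′ → ⟦ chk α g ∧ (allowed ρ b a g ∧ closedWalk (step b a g) A R B A′) ⟧ ℤ.* Ψ′ ∣ B ∣ ∣ A′ ∣) ≡
    ⟦ chk α g ⟧ ℤ.* (⟦ allowed ρ b a g ⟧ ℤ.* walks A R (step b a g) Ψ′)
  letter b a Ψ′ = trans (sum2-cong m (λ B A′ → trans (cong (ℤ._* Ψ′ ∣ B ∣ ∣ A′ ∣) (trans (⟦⟧-∧ (chk α g) _)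
        (cong (λ z → ⟦ chk α g ⟧ ℤ.* z) (⟦⟧-∧ (allowed ρ b a g) _))))
        (assoc₃ ⟦ chk α g ⟧ ⟦ allowed ρ b a g ⟧ ⟦ closedWalk (step b a g) A R B A′ ⟧ (Ψ′ ∣ B ∣ ∣ A′ ∣))))
    (trans (sum2-*ˡ m ⟦ chk α g ⟧ _) (cong (λ z → ⟦ chk α g ⟧ ℤ.* z) (trans (sum2-*ˡ m ⟦ allowed ρ b a g ⟧ _)
      (cong (λ z → ⟦ allowed ρ b a g ⟧ ℤ.* z) (walks-sum A R (step b a g) Ψ′)))))
    where
    assoc₃ : ∀ a b c d → (a ℤ.* (b ℤ.* c)) ℤ.* d ≡ a ℤ.* (b ℤ.* (c ℤ.* d))
    assoc₃ = solve-∀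

walks-cong : ∀ {m} (A R : Vec Bool m) g {Ψ Ψ′ : ℕ → ℕ → ℤ} → (∀ x y → Ψ x y ≡ Ψ′ x y) → walks A R g Ψ ≡ walks A R g Ψ′
walks-cong [] [] g e = cong (λ z → ⟦ g ≡ᵇ 0 ⟧ ℤ.* z) (e 0 0)
walks-cong (α ∷ A) (ρ ∷ R) g e
  rewrite walks-cong A R (ℕ.pred g) e | walks-cong A R g (λ x y → e x (suc y))
        | walks-cong A R g (λ x y → e (suc x) y) | walks-cong A R (suc g) (λ x y → e (suc x) (suc y)) = refl

-- Rank of a set read off along the rim: a run of consecutive rim edges of length l contributes l,
-- and one more if it touches a spoke (c tells whether the current run already did).
rho : ∀ {m} → Bool → (A R : Vec Bool m) → ℕ
rho c [] [] = 0
rho c (α ∷ A) (true ∷ R) = suc (rho (c ∨ α) A R)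
rho c (α ∷ A) (false ∷ R) = 𝟙 (c ∨ α) ℕ.+ rho false A R

-- Walks starting in the middle of a rim edge at height q + 1/2, weighed by b-steps and by a-steps (the
-- initial half-step included in the latter).  Exchanging the half-steps before and after each run of
-- prescribed rim edges that touches no prescribed spoke turns one weight into the other, up to rho.
fromEdge fromEdge′ : ∀ {m} → Bool → (A R : Vec Bool m) → ℕ → (ℕ → ℤ) → ℤ
fromEdge c A R q ψ = ⟦ chk c q ⟧ ℤ.* walks A R q (λ x y → ψ x) ℤ.+ ⟦ chk c (suc q) ⟧ ℤ.* walks A R (suc q) (λ x y → ψ x)
fromEdge′ c A R q ψ = ⟦ chk c q ⟧ ℤ.* walks A R q (λ x y → ψ y) ℤ.+ ⟦ chk c (suc q) ⟧ ℤ.* walks A R (suc q) (λ x y → ψ (suc y))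

chk-∨ : ∀ c α g X → ⟦ chk c g ⟧ ℤ.* (⟦ chk α g ⟧ ℤ.* X) ≡ ⟦ chk (c ∨ α) g ⟧ ℤ.* X
chk-∨ false α g X = ℤP.*-identityˡ _
chk-∨ true false g X = cong (λ z → ⟦ g ≡ᵇ 0 ⟧ ℤ.* z) (ℤP.*-identityˡ X)
chk-∨ true true zero X = ℤP.*-identityˡ _
chk-∨ true true (suc g) X = trans (ℤP.*-zeroˡ (+ 0 ℤ.* X)) (sym (ℤP.*-zeroˡ X))

walks-rim : ∀ {m} c α (A R : Vec Bool m) g Ψ →
  ⟦ chk c g ⟧ ℤ.* walks (α ∷ A) (true ∷ R) g Ψ ≡ ⟦ chk (c ∨ α) g ⟧ ℤ.* walks A R g (λ x y → Ψ (suc x) y)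
walks-rim c α A R g Ψ = trans (cong (λ z → ⟦ chk c g ⟧ ℤ.* z) (only ⟦ chk α g ⟧
    (walks A R (ℕ.pred g) Ψ) (walks A R g (λ x y → Ψ x (suc y)))
    (walks A R g (λ x y → Ψ (suc x) y)) (walks A R (suc g) (λ x y → Ψ (suc x) (suc y)))))
  (chk-∨ c α g _)
  where
  only : ∀ c p q r s → c ℤ.* ((+ 0 ℤ.* p ℤ.+ + 0 ℤ.* q) ℤ.+ (+ 1 ℤ.* r ℤ.+ + 0 ℤ.* s)) ≡ c ℤ.* r
  only = solve-∀

fromEdge′-cong : ∀ {m} c (A R : Vec Bool m) q {ψ ψ′ : ℕ → ℤ} → (∀ y → ψ y ≡ ψ′ y) → fromEdge′ c A R q ψ ≡ fromEdge′ c A R q ψ′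
fromEdge′-cong c A R q e = cong₂ (λ u v → ⟦ chk c q ⟧ ℤ.* u ℤ.+ ⟦ chk c (suc q) ⟧ ℤ.* v)
  (walks-cong A R q (λ x y → e y)) (walks-cong A R (suc q) (λ x y → e (suc y)))

fromEdge-sym : ∀ {m} c (A R : Vec Bool m) q ψ → fromEdge c A R q ψ ≡ fromEdge′ c A R q (λ y → ψ (rho c A R ℕ.+ y))
-- The closing half-step has to go down to height 0 at vertex 0, so the summands that end at `suc q`
-- are zero.
fromEdge-sym c [] [] q ψ = cong (λ z → ⟦ chk c q ⟧ ℤ.* (⟦ q ≡ᵇ 0 ⟧ ℤ.* ψ 0) ℤ.+ ⟦ chk c (suc q) ⟧ ℤ.* z)
  (trans (ℤP.*-zeroˡ (ψ 0)) (sym (ℤP.*-zeroˡ (ψ 1))))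
fromEdge-sym c (α ∷ A) (true ∷ R) q ψ = trans
  (cong₂ ℤ._+_ (walks-rim c α A R q (λ x y → ψ x)) (walks-rim c α A R (suc q) (λ x y → ψ x)))
  (trans (fromEdge-sym (c ∨ α) A R q (ψ ∘ suc))
    (sym (cong₂ ℤ._+_ (walks-rim c α A R q (λ x y → ψ (suc (rho (c ∨ α) A R ℕ.+ y))))
                      (walks-rim c α A R (suc q) (λ x y → ψ (suc (rho (c ∨ α) A R ℕ.+ suc y)))))))
fromEdge-sym {suc m} c (α ∷ A) (false ∷ R) q ψ = trans
  (cong₂ ℤ._+_ (chk-∨ c α q (inner q (λ x y → ψ x))) (chk-∨ c α (suc q) (inner (suc q) (λ x y → ψ x))))
  (trans (go (c ∨ α) q)
    (sym (cong₂ ℤ._+_ (chk-∨ c α q (inner q (λ x y → ψ (k ℕ.+ y))))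
        (chk-∨ c α (suc q) (inner (suc q) (λ x y → ψ (k ℕ.+ suc y)))))))
  where
  ρ = rho false A R
  k = 𝟙 (c ∨ α) ℕ.+ ρ
  inner : ℕ → (ℕ → ℕ → ℤ) → ℤ
  inner g Ψ = ((⟦ allowed false false false g ⟧ ℤ.* walks A R (ℕ.pred g) Ψ) ℤ.+
    (⟦ allowed false false true g ⟧ ℤ.* walks A R g (λ x y → Ψ x (suc y)))) ℤ.+
   ((⟦ allowed false true false g ⟧ ℤ.* walks A R g (λ x y → Ψ (suc x) y)) ℤ.+
    (⟦ allowed false true true g ⟧ ℤ.* walks A R (suc g) (λ x y → Ψ (suc x) (suc y))))
  w v : ℕ → (ℕ → ℤ) → ℤ
  w g φ = walks A R g (λ x y → φ x)
  v g φ = walks A R g (λ x y → φ y)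
  O O′ : ℕ → (ℕ → ℤ) → ℤ
  O = fromEdge false A R
  O′ = fromEdge′ false A R
  ψ⁺ : ℕ → ℤ
  ψ⁺ y = ψ (ρ ℕ.+ y)
  IH : ∀ q → O q ψ ≡ O′ q ψ⁺
  IH q = fromEdge-sym false A R q ψ
  IHs : ∀ q → O q (ψ ∘ suc) ≡ O′ q (ψ⁺ ∘ suc)
  IHs q = trans (fromEdge-sym false A R q (ψ ∘ suc)) (fromEdge′-cong false A R q (λ y → cong ψ (sym (ℕP.+-suc ρ y))))
  zero₄ : ∀ a b c d → + 0 ℤ.* a ℤ.+ + 0 ℤ.* b ≡ + 0 ℤ.* c ℤ.+ + 0 ℤ.* d
  zero₄ = solve-∀
  bot : ∀ x y p q r → + 1 ℤ.* ((+ 0 ℤ.* x ℤ.+ + 0 ℤ.* y) ℤ.+ (+ 1 ℤ.* p ℤ.+ + 1 ℤ.* q)) ℤ.+ + 0 ℤ.* r ≡ + 1 ℤ.* p ℤ.+ + 1 ℤ.* q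
  bot = solve-∀
  low : ∀ x y p₀ p₁ r₀ r₁ s₁ s₂ →
    + 1 ℤ.* ((+ 0 ℤ.* x ℤ.+ + 0 ℤ.* y) ℤ.+ (+ 1 ℤ.* p₀ ℤ.+ + 1 ℤ.* p₁)) ℤ.+
    + 1 ℤ.* ((+ 1 ℤ.* r₀ ℤ.+ + 1 ℤ.* r₁) ℤ.+ (+ 1 ℤ.* s₁ ℤ.+ + 1 ℤ.* s₂)) ≡
    ((+ 1 ℤ.* p₀ ℤ.+ + 1 ℤ.* p₁) ℤ.+ (+ 1 ℤ.* r₀ ℤ.+ + 1 ℤ.* r₁)) ℤ.+ (+ 1 ℤ.* s₁ ℤ.+ + 1 ℤ.* s₂)
  low = solve-∀
  high : ∀ a b c d e f g h →
    + 1 ℤ.* ((+ 1 ℤ.* a ℤ.+ + 1 ℤ.* b) ℤ.+ (+ 1 ℤ.* c ℤ.+ + 1 ℤ.* d)) ℤ.+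
    + 1 ℤ.* ((+ 1 ℤ.* e ℤ.+ + 1 ℤ.* f) ℤ.+ (+ 1 ℤ.* g ℤ.+ + 1 ℤ.* h)) ≡
    ((+ 1 ℤ.* a ℤ.+ + 1 ℤ.* b) ℤ.+ (+ 1 ℤ.* c ℤ.+ + 1 ℤ.* d)) ℤ.+
    ((+ 1 ℤ.* e ℤ.+ + 1 ℤ.* f) ℤ.+ (+ 1 ℤ.* g ℤ.+ + 1 ℤ.* h))
  high = solve-∀
  comm₃ : ∀ a b c → (a ℤ.+ b) ℤ.+ c ≡ (b ℤ.+ a) ℤ.+ c
  comm₃ = solve-∀
  comm₄ : ∀ a b c d → (a ℤ.+ b) ℤ.+ (c ℤ.+ d) ≡ (a ℤ.+ c) ℤ.+ (b ℤ.+ d)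
  comm₄ = solve-∀
  go : ∀ c′ q → ⟦ chk c′ q ⟧ ℤ.* inner q (λ x y → ψ x) ℤ.+ ⟦ chk c′ (suc q) ⟧ ℤ.* inner (suc q) (λ x y → ψ x) ≡
    ⟦ chk c′ q ⟧ ℤ.* inner q (λ x y → ψ (𝟙 c′ ℕ.+ ρ ℕ.+ y)) ℤ.+ ⟦ chk c′ (suc q) ⟧ ℤ.* inner (suc q)
        (λ x y → ψ (𝟙 c′ ℕ.+ ρ ℕ.+ suc y))
  -- A run touching a prescribed spoke lies at height 0, which one half-step cannot reach from above
  -- mid-height 1/2.
  go true (suc q) = zero₄ (inner (suc q) (λ x y → ψ x)) (inner (suc (suc q)) (λ x y → ψ x))
    (inner (suc q) (λ x y → ψ (suc ρ ℕ.+ y))) (inner (suc (suc q)) (λ x y → ψ (suc ρ ℕ.+ suc y)))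
  -- At height 0 the run is entered by a down-step of a and left by an up-step of b. Nothing is
  -- exchanged, and b gains one up without counterpart: this is the unit `𝟙 c′` in the rank.
  go true zero = trans
    (bot (w 0 ψ) (w 0 ψ) (w 0 (ψ ∘ suc)) (w 1 (ψ ∘ suc)) (inner 1 (λ x y → ψ x)))
    (trans (fromEdge-sym false A R 0 (ψ ∘ suc))
      (sym (bot (v 0 ψ₁) (v 0 (ψ₁ ∘ suc)) (v 0 ψ₁) (v 1 (ψ₁ ∘ suc)) (inner 1 (λ x y → ψ₁ (suc y))))))
    where
    ψ₁ : ℕ → ℤ
    ψ₁ y = ψ (suc ρ ℕ.+ y)
  -- From mid-height 1/2, down-up and up-down both return to 1/2 and are exchanged by `comm₃`; up-up
  -- leads to 3/2 and is its own partner; down-down would go below 0.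
  go false zero = trans
    (low (w 0 ψ) (w 0 ψ) (w 0 (ψ ∘ suc)) (w 1 (ψ ∘ suc)) (w 0 ψ) (w 1 ψ) (w 1 (ψ ∘ suc)) (w 2 (ψ ∘ suc)))
    (trans (cong₂ ℤ._+_ (cong₂ ℤ._+_ (IHs 0) (IH 0)) (IHs 1))
      (trans (comm₃ (O′ 0 (ψ⁺ ∘ suc)) (O′ 0 ψ⁺) (O′ 1 (ψ⁺ ∘ suc)))
        (sym (low (v 0 ψ⁺) (v 0 (ψ⁺ ∘ suc)) (v 0 ψ⁺) (v 1 (ψ⁺ ∘ suc)) (v 0 (ψ⁺ ∘ suc)) (v 1 (λ y → ψ⁺ (suc (suc y))))
            (v 1 (ψ⁺ ∘ suc)) (v 2 (λ y → ψ⁺ (suc (suc y))))))))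
  -- All four pairs of half-steps are possible here; `comm₄` exchanges down-up with up-down.
  go false (suc q) = trans
    (high (w q ψ) (w (suc q) ψ) (w (suc q) (ψ ∘ suc)) (w (suc (suc q)) (ψ ∘ suc))
          (w (suc q) ψ) (w (suc (suc q)) ψ) (w (suc (suc q)) (ψ ∘ suc)) (w (suc (suc (suc q))) (ψ ∘ suc)))
    (trans (cong₂ ℤ._+_ (cong₂ ℤ._+_ (IH q) (IHs (suc q))) (cong₂ ℤ._+_ (IH (suc q)) (IHs (suc (suc q)))))
      (trans (comm₄ (O′ q ψ⁺) (O′ (suc q) (ψ⁺ ∘ suc)) (O′ (suc q) ψ⁺) (O′ (suc (suc q)) (ψ⁺ ∘ suc)))
       (sym (high (v q ψ⁺) (v (suc q) (ψ⁺ ∘ suc)) (v (suc q) ψ⁺) (v (suc (suc q)) (ψ⁺ ∘ suc))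
          (v (suc q) (ψ⁺ ∘ suc)) (v (suc (suc q)) (λ y → ψ⁺ (suc (suc y)))) (v (suc (suc q)) (ψ⁺ ∘ suc))
              (v (suc (suc (suc q))) (λ y → ψ⁺ (suc (suc y))))))))

-- The rank computed run by run along the rim

hd : ∀ {m} → Bool → Vec Bool m → Bool
hd w [] = w
hd w (s ∷ S) = s

nxt : ∀ {m} → Bool → Vec Bool m → Vec Bool m
nxt w [] = []
nxt w (s ∷ S) = hd w S ∷ nxt w S

nxt-∷ : ∀ {m} w s (S : Vec Bool m) → nxt w (s ∷ S) ≡ S ∷ʳ w
nxt-∷ w s [] = refl
nxt-∷ w s (t ∷ S) = cong (t ∷_) (nxt-∷ w t S)

-- The last summand is a credit carried along a run: if the run has met a spoke while its current
-- vertex is uncovered, the part already passed has cost one more than `rho` has counted. With this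
-- credit the bound becomes local.
rho-lower : ∀ {m} c w (A R S : Vec Bool m) → rho c A R ≤ cost A R S (nxt w S) ℕ.+ 𝟙 (c ∧ not (hd w S))
rho-lower c w [] [] [] = z≤n
rho-lower c w (α ∷ A) (true ∷ R) (s ∷ S) = ℕP.≤-trans (s≤s (rho-lower (c ∨ α) w A R S))
  (subst₂ _≤_ (lem₁ (cost A R S (nxt w S)) _) (lem₂ (cost A R S (nxt w S)) (term α true s (hd w S)) (𝟙 (c ∧ not s)))
      (ℕP.+-monoʳ-≤ (cost A R S (nxt w S)) (boole c α s (hd w S))))
  where
  lem₁ : ∀ x y → x ℕ.+ suc y ≡ suc (x ℕ.+ y)
  lem₁ = solve-∀ℕ
  lem₂ : ∀ x y z → x ℕ.+ (y ℕ.+ z) ≡ y ℕ.+ x ℕ.+ z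
  lem₂ = solve-∀ℕ
  boole : ∀ c α s s′ → suc (𝟙 ((c ∨ α) ∧ not s′)) ≤ term α true s s′ ℕ.+ 𝟙 (c ∧ not s)
  boole c α s s′ = ≤ᵇ⇒≤ (tauto 4 (λ { (c ∷ α ∷ s ∷ s′ ∷ []) → suc (𝟙 ((c ∨ α) ∧ not s′)) ≤ᵇ term α true s s′ ℕ.+ 𝟙
      (c ∧ not s) }) refl (c ∷ α ∷ s ∷ s′ ∷ []))
rho-lower c w (α ∷ A) (false ∷ R) (s ∷ S) = ℕP.≤-trans (ℕP.+-mono-≤ (boole c α s (hd w S)) (rho-lower false w A R S))
  (ℕP.≤-reflexive (lem (term α false s (hd w S)) (𝟙 (c ∧ not s)) (cost A R S (nxt w S))))
  where
  lem : ∀ x y z → x ℕ.+ y ℕ.+ (z ℕ.+ 0) ≡ x ℕ.+ z ℕ.+ y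
  lem = solve-∀ℕ
  boole : ∀ c α s s′ → 𝟙 (c ∨ α) ≤ term α false s s′ ℕ.+ 𝟙 (c ∧ not s)
  boole c α s s′ = ≤ᵇ⇒≤ (tauto 4 (λ { (c ∷ α ∷ s ∷ s′ ∷ []) → 𝟙 (c ∨ α) ≤ᵇ term α false s s′ ℕ.+ 𝟙 (c ∧ not s) }) refl
      (c ∷ α ∷ s ∷ s′ ∷ []))

-- does the current run of rim edges touch a spoke (the last run closes up at vertex 0, a spoke)?
touches : ∀ {m} → Bool → (A R : Vec Bool m) → Bool
touches c [] [] = true
touches c (α ∷ A) (true ∷ R) = touches (c ∨ α) A R
touches c (α ∷ A) (false ∷ R) = c ∨ α

cover : ∀ {m} → Bool → (A R : Vec Bool m) → Vec Bool m
cover c [] [] = []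
cover c (α ∷ A) (true ∷ R) = touches (c ∨ α) A R ∷ cover (c ∨ α) A R
cover c (α ∷ A) (false ∷ R) = (c ∨ α) ∷ cover false A R

hd-cover : ∀ {m} c (A R : Vec Bool m) → hd true (cover c A R) ≡ touches c A R
hd-cover c [] [] = refl
hd-cover c (α ∷ A) (true ∷ R) = refl
hd-cover c (α ∷ A) (false ∷ R) = refl

touches-true : ∀ {m} (A R : Vec Bool m) → touches true A R ≡ true
touches-true [] [] = refl
touches-true (α ∷ A) (true ∷ R) = touches-true A R
touches-true (α ∷ A) (false ∷ R) = refl

-- Covering a run pays for its vertices, leaving it uncovered pays for its elements; a single spoke
-- makes covering at least as cheap. So the runs that touch a spoke are covered and the others are
-- not.
rho-cover : ∀ {m} c (A R : Vec Bool m) → cost A R (cover c A R) (nxt true (cover c A R)) ≡ rho c A R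
rho-cover c [] [] = refl
rho-cover c (α ∷ A) (true ∷ R) rewrite hd-cover (c ∨ α) A R | rho-cover (c ∨ α) A R = cong (ℕ._+ rho (c ∨ α) A R) (go c α)
  where
  dup : ∀ t → term false true t t ≡ 1
  dup true = refl
  dup false = refl
  go : ∀ c α → term α true (touches (c ∨ α) A R) (touches (c ∨ α) A R) ≡ 1
  go true true rewrite touches-true A R = refl
  go true false rewrite touches-true A R = refl
  go false true rewrite touches-true A R = refl
  go false false = dup (touches false A R)
rho-cover c (α ∷ A) (false ∷ R) rewrite rho-cover false A R = cong (ℕ._+ rho false A R) (go c α)
  where
  go : ∀ c α → term α false (c ∨ α) (hd true (cover false A R)) ≡ 𝟙 (c ∨ α)
  go true true = refl
  go true false = refl
  go false true = refl
  go false false = refl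

rho-isRank : ∀ {m} (A R : Vec Bool m) r → IsRank (true ∷ A) (r ∷ R) (rho false (true ∷ A) (r ∷ R))
rho-isRank A R r = (λ { (s ∷ S) → subst (rho false (true ∷ A) (r ∷ R) ≤_)
    (trans (ℕP.+-identityʳ _) (cong (cost (true ∷ A) (r ∷ R) (s ∷ S)) (nxt-∷ s s S)))
        (rho-lower false s (true ∷ A) (r ∷ R) (s ∷ S)) })
  , cover false (true ∷ A) (r ∷ R) , trans (cong (cost (true ∷ A) (r ∷ R) (cover false (true ∷ A) (r ∷ R))) (wrap r))
      (rho-cover false (true ∷ A) (r ∷ R))
  where
  wrap : ∀ r → rot (cover false (true ∷ A) (r ∷ R)) ≡ nxt true (cover false (true ∷ A) (r ∷ R))
  wrap true rewrite touches-true A R = sym (nxt-∷ true true _)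
  wrap false = sym (nxt-∷ true true _)

-- The walk is started half a step early, at mid-height 1/2 in the rim edge before vertex 0, with
-- its run marked as touching a spoke. The mark forces the descent to height 0, and `k≡` discards it
-- because the spoke at vertex 0 sets it again.
palindromic-rank-spoke : ∀ {m} (A R : Vec Bool m) r → PalindromicRank (true ∷ A) (r ∷ R)
palindromic-rank-spoke {m} A R r = k , rho-isRank A R r , λ ψ → trans (toWalks (λ x y → ψ x)) (trans (sym (edge₀ ψ))
    (trans (fromEdge-sym true A₁ R₁ 0 ψ) (trans (cong (λ k → fromEdge′ true A₁ R₁ 0 (λ y → ψ (k ℕ.+ y))) (k≡ r))
        (trans (edge₀′ (λ y → ψ (k ℕ.+ y))) (sym (toWalks (λ x y → ψ (k ℕ.+ y))))))))
  where
  A₁ = true ∷ A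
  R₁ = r ∷ R
  k = rho false A₁ R₁
  k≡ : ∀ r → rho true (true ∷ A) (r ∷ R) ≡ rho false (true ∷ A) (r ∷ R)
  k≡ true = refl
  k≡ false = refl
  toWalks : ∀ Ψ → sum2 (suc m) (λ b a → ⟦ balanced b a ⟧ ℤ.* (⟦ contains A₁ R₁ b a ⟧ ℤ.* Ψ ∣ b ∣ ∣ a ∣)) ≡ walks A₁ R₁ 0 Ψ
  toWalks Ψ = trans (sum2-cong (suc m) (λ b a → trans (sym (ℤP.*-assoc ⟦ balanced b a ⟧ ⟦ contains A₁ R₁ b a ⟧ (Ψ ∣ b ∣ ∣ a ∣)))
      (cong (ℤ._* Ψ ∣ b ∣ ∣ a ∣) (trans (sym (⟦⟧-∧ (balanced b a) _)) (cong ⟦_⟧ (closedWalk-head A₁ R₁ b a refl))))))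
    (walks-sum A₁ R₁ 0 Ψ)
  lem : ∀ x y → + 1 ℤ.* x ℤ.+ + 0 ℤ.* y ≡ x
  lem = solve-∀
  edge₀ : ∀ ψ → fromEdge true A₁ R₁ 0 ψ ≡ walks A₁ R₁ 0 (λ x y → ψ x)
  edge₀ ψ = lem (walks A₁ R₁ 0 (λ x y → ψ x)) (walks A₁ R₁ 1 (λ x y → ψ x))
  edge₀′ : ∀ ψ → fromEdge′ true A₁ R₁ 0 ψ ≡ walks A₁ R₁ 0 (λ x y → ψ y)
  edge₀′ ψ = lem (walks A₁ R₁ 0 (λ x y → ψ y)) (walks A₁ R₁ 1 (λ x y → ψ (suc y)))

palindromic-rank : ∀ {m} (A R : Vec Bool m) → PalindromicRank A R
palindromic-rank A R with nonempty? A
... | no empty rewrite Empty-unique {p = A} empty = palindromic-rank-no-spokes R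
... | yes (x , x∈A) = turn (toℕ x) A R x refl x∈A
  where
  ∈-∷ʳ : ∀ {m} {X : Subset m} {x a} → x ∈ X → inject₁ x ∈ (X ∷ʳ a)
  ∈-∷ʳ V.here = V.here
  ∈-∷ʳ (V.there p) = V.there (∈-∷ʳ p)
  -- One rotation per vertex brings the chosen spoke to the front.
  turn : ∀ i {m} (A R : Vec Bool m) (x : Fin m) → toℕ x ≡ i → x ∈ A → PalindromicRank A R
  turn i (true ∷ A) (r ∷ R) zero e V.here = palindromic-rank-spoke A R r
  turn (suc i) (a ∷ A) (r ∷ R) (suc x) e (V.there x∈A) = palindromic-rank-unrot (a ∷ A) (r ∷ R)
    (turn i (A ∷ʳ a) (R ∷ʳ r) (inject₁ x) (trans (FP.toℕ-inject₁ x) (ℕP.suc-injective e)) (∈-∷ʳ x∈A))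

-- Flats of words

⊑-cons : ∀ {m x y} {X Y : Vec Bool m} → (not x ∨ y) ≡ true → X ⊑ Y → (x ∷ X) ⊑ (y ∷ Y)
⊑-cons {x = true} {true} e s = keep true s
⊑-cons {x = false} {true} e s = add s
⊑-cons {x = false} {false} e s = keep false s

⊑-head : ∀ {m x y} {X Y : Vec Bool m} → (x ∷ X) ⊑ (y ∷ Y) → (not x ∨ y) ≡ true
⊑-head (keep true s) = refl
⊑-head (keep false s) = refl
⊑-head (add s) = refl

⊑-tail : ∀ {m x y} {X Y : Vec Bool m} → (x ∷ X) ⊑ (y ∷ Y) → X ⊑ Y
⊑-tail (keep _ s) = s
⊑-tail (add s) = s

⊑⇒⊆ : ∀ {m} {X Y : Subset m} → X ⊑ Y → X ⊆ Y
⊑⇒⊆ (keep true s) V.here = V.here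
⊑⇒⊆ (keep b s) (V.there p) = V.there (⊑⇒⊆ s p)
⊑⇒⊆ (add s) (V.there p) = V.there (⊑⇒⊆ s p)

⊑-rot : ∀ {m} {X Y : Subset m} → X ⊑ Y → rot X ⊑ rot Y
⊑-rot [] = []
⊑-rot {X = x ∷ X} {y ∷ Y} s = go (⊑-tail s)
  where
  go : ∀ {m} {X Y : Subset m} → X ⊑ Y → (X ∷ʳ x) ⊑ (Y ∷ʳ y)
  go [] = ⊑-cons (⊑-head s) []
  go (keep b t) = keep b (go t)
  go (add t) = add (go t)

⊑-refl : ∀ {m} (X : Subset m) → X ⊑ X
⊑-refl [] = []
⊑-refl (x ∷ X) = keep x (⊑-refl X)

⊑⊥⇒≡ : ∀ {m} {X : Subset m} → X ⊑ ⊥ → X ≡ ⊥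
⊑⊥⇒≡ {X = []} s = refl
⊑⊥⇒≡ {X = false ∷ X} s = cong (false ∷_) (⊑⊥⇒≡ (⊑-tail s))
⊑⊥⇒≡ {X = true ∷ X} s with () ← ⊑-head s

⊤⊑⇒≡ : ∀ {m} {X : Subset m} → ⊤ ⊑ X → X ≡ ⊤
⊤⊑⇒≡ {X = []} s = refl
⊤⊑⇒≡ {X = true ∷ X} s = cong (true ∷_) (⊤⊑⇒≡ (⊑-tail s))
⊤⊑⇒≡ {X = false ∷ X} s with () ← ⊑-head s

⊑-++ : ∀ m {n} {X Y : Subset (m ℕ.+ n)} → V.take m X ⊑ V.take m Y → V.drop m X ⊑ V.drop m Y → X ⊑ Y
⊑-++ zero s t = t
⊑-++ (suc m) {X = x ∷ X} {y ∷ Y} s t = ⊑-cons (⊑-head s) (⊑-++ m (⊑-tail s) t)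

take-++ : ∀ {m n} (X : Subset m) (Y : Subset n) → V.take m (X V.++ Y) ≡ X
take-++ [] Y = refl
take-++ (x ∷ X) Y = cong (x ∷_) (take-++ X Y)

drop-++ : ∀ {m n} (X : Subset m) (Y : Subset n) → V.drop m (X V.++ Y) ≡ Y
drop-++ [] Y = refl
drop-++ (x ∷ X) Y = drop-++ X Y

-- Connectedness of the rim: a set of vertices closed under passing to the next one is everything or
-- nothing.
⊑-rot-constant : ∀ {m} (U : Subset m) → U ⊑ rot U → U ≡ ⊤ ⊎ U ≡ ⊥
⊑-rot-constant [] s = inj₁ refl
⊑-rot-constant (true ∷ X) s = inj₁ (cong (true ∷_) (proj₂ (allTrue X s)))
  where
  allTrue : ∀ {m y} (X : Subset m) → (true ∷ X) ⊑ (X ∷ʳ y) → y ≡ true × X ≡ ⊤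
  allTrue [] (keep true s) = refl , refl
  allTrue (true ∷ X) s = let (p , q) = allTrue X (⊑-tail s) in p , cong (true ∷_) q
  allTrue (false ∷ X) s with () ← ⊑-head s
⊑-rot-constant (false ∷ X) s = inj₂ (cong (false ∷_) (allFalse X s))
  where
  reach : ∀ {m y} (X : Subset m) → (true ∷ X) ⊑ (X ∷ʳ y) → y ≡ true
  reach [] (keep true s) = refl
  reach (true ∷ X) s = reach X (⊑-tail s)
  reach (false ∷ X) s with () ← ⊑-head s
  allFalse : ∀ {m x} (X : Subset m) → (x ∷ X) ⊑ (X ∷ʳ false) → X ≡ ⊥
  allFalse [] s = refl
  allFalse (false ∷ X) s = cong (false ∷_) (allFalse X (⊑-tail s))
  allFalse (true ∷ X) s with () ← reach X (⊑-tail s)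

nextZeros : ∀ {m} → ℕ → Vec Bool m → Vec Bool m → Vec Bool m
nextZeros g [] [] = []
nextZeros g (b ∷ B) (a ∷ A) = (step b a g ≡ᵇ 0) ∷ nextZeros (step b a g) B A

zeros-nextZeros : ∀ {m} g (B A : Vec Bool m) → zeros g B A ∷ʳ (end g B A ≡ᵇ 0) ≡ (g ≡ᵇ 0) ∷ nextZeros g B A
zeros-nextZeros g [] [] = refl
zeros-nextZeros g (b ∷ B) (a ∷ A) = cong ((g ≡ᵇ 0) ∷_) (zeros-nextZeros (step b a g) B A)

rot-zeros : ∀ {m} g (B A : Vec Bool m) → end g B A ≡ g → rot (zeros g B A) ≡ nextZeros g B A
rot-zeros g [] [] e = refl
rot-zeros g (b ∷ B) (a ∷ A) e = trans (cong (λ h → zeros (step b a g) B A ∷ʳ (h ≡ᵇ 0)) (sym e)) (zeros-nextZeros (step b a g) B A)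

-- s and s′ tell whether an allowed letter (b , a) starts, respectively ends, at height 0
local : Bool → Bool → Bool → Bool → Bool
local b a s s′ = (not s ∨ b) ∧ ((not (b ∧ not a) ∨ ((s ∧ s′) ∨ (not s ∧ not s′))) ∧ (not (s ∧ s′) ∨ (b ∧ not a)))

data Local : ∀ {m} → (B A S S′ : Vec Bool m) → Set where
  []  : Local [] [] [] []
  _∷_ : ∀ {m b a s s′} {B A S S′ : Vec Bool m} → local b a s s′ ≡ true → Local B A S S′ → Local (b ∷ B) (a ∷ A) (s ∷ S) (s′ ∷ S′)

local-zeros : ∀ {m} g (B A : Vec Bool m) → depth 0 B A ≤ g → Local B A (zeros g B A) (nextZeros g B A)
local-zeros g [] [] le = []
local-zeros g (b ∷ B) (a ∷ A) le = go b a g le ∷ local-zeros (step b a g) B A (pre≤⇒≤step b a le)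
  where
  go : ∀ b a g → pre b a (depth 0 B A) ≤ g → local b a (g ≡ᵇ 0) (step b a g ≡ᵇ 0) ≡ true
  go true true zero le = refl
  go true true (suc g) le = refl
  go true false zero le = refl
  go true false (suc g) le = refl
  go false false (suc g) le = refl
  go false true (suc g) le = refl

implies : ∀ {x y} → (not x ∨ y) ≡ true → x ≡ true → y ≡ true
implies {true} e refl = e

split-≤ : ∀ {t₀ t₁ c₀ c₁} → t₀ ≤ t₁ → c₀ ≤ c₁ → t₁ ℕ.+ c₁ ≤ t₀ ℕ.+ c₀ → t₁ ≤ t₀ × c₁ ≤ c₀
split-≤ {t₀} {t₁} {c₀} {c₁} t≤ c≤ le =
  ℕP.+-cancelʳ-≤ c₁ t₁ t₀ (ℕP.≤-trans le (ℕP.+-monoʳ-≤ t₀ c≤)) ,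
  ℕP.+-cancelˡ-≤ t₁ c₁ c₀ (ℕP.≤-trans le (ℕP.+-monoˡ-≤ c₀ t≤))

isRim : Bool → Bool → Bool
isRim b a = b ∧ not a

cost≤∣B∣ : ∀ {m} {B A S S′ : Vec Bool m} → Local B A S S′ → cost S (rims B A) S S′ ≤ ∣ B ∣
cost≤∣B∣ [] = z≤n
cost≤∣B∣ {B = b ∷ B} {a ∷ A} {s ∷ S} {s′ ∷ S′} (l ∷ ls) = subst (cost (s ∷ S) (rims (b ∷ B) (a ∷ A)) (s ∷ S) (s′ ∷ S′) ≤_)
    (sym (card-∷ b B))
  (ℕP.+-mono-≤ (≤ᵇ⇒≤ (implies (tauto 4 (λ { (b ∷ a ∷ s ∷ s′ ∷ []) → not (local b a s s′) ∨ (term s (isRim b a) s s′ ≤ᵇ 𝟙 b)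
      }) refl (b ∷ a ∷ s ∷ s′ ∷ [])) l)) (cost≤∣B∣ ls))

term-min : ∀ b a s s′ t t′ → local b a s s′ ≡ true → term s (isRim b a) s s′ ≤ term s (isRim b a) t t′
term-min b a s s′ t t′ l = ≤ᵇ⇒≤ (implies (tauto 6 (λ { (b ∷ a ∷ s ∷ s′ ∷ t ∷ t′ ∷ []) →
  not (local b a s s′) ∨ (term s (isRim b a) s s′ ≤ᵇ term s (isRim b a) t t′) }) refl (b ∷ a ∷ s ∷ s′ ∷ t ∷ t′ ∷ [])) l)

-- The vertices at height 0 form an optimal cover even letter by letter, so `T` and `T′` may vary
-- independently.
cost-min : ∀ {m} {B A S S′ : Vec Bool m} → Local B A S S′ → ∀ T T′ → cost S (rims B A) S S′ ≤ cost S (rims B A) T T′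
cost-min [] [] [] = z≤n
cost-min {B = b ∷ B} {a ∷ A} {s ∷ S} {s′ ∷ S′} (l ∷ ls) (t ∷ T) (t′ ∷ T′) = ℕP.+-mono-≤ (term-min b a s s′ t t′ l)
    (cost-min ls T T′)

extra : ∀ {m} → Vec Bool m → Vec Bool m → Vec Bool m
extra = V.zipWith (λ t s → t ∧ not s)

cost-min-strict : ∀ {m} {B A S S′ : Vec Bool m} → Local B A S S′ → ∀ T T′ →
  cost S (rims B A) T T′ ≤ cost S (rims B A) S S′ → extra T S ⊑ extra T′ S′ × extra T S ⊑ rims B A
cost-min-strict [] [] [] le = [] , []
cost-min-strict {B = b ∷ B} {a ∷ A} {s ∷ S} {s′ ∷ S′} (l ∷ ls) (t ∷ T) (t′ ∷ T′) le
  with split-≤ (term-min b a s s′ t t′ l) (cost-min ls T T′) le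
... | lt , lc with cost-min-strict ls T T′ lc
... | p , q = ⊑-cons (proj₁ both) p , ⊑-cons (proj₂ both) q
  where
  both : (not (t ∧ not s) ∨ (t′ ∧ not s′)) ≡ true × (not (t ∧ not s) ∨ isRim b a) ≡ true
  both = ∧-true (implies (tauto 6 (λ { (b ∷ a ∷ s ∷ s′ ∷ t ∷ t′ ∷ []) →
    not (local b a s s′ ∧ (term s (isRim b a) t t′ ≤ᵇ term s (isRim b a) s s′)) ∨
        ((not (t ∧ not s) ∨ (t′ ∧ not s′)) ∧ (not (t ∧ not s) ∨ isRim b a)) }) refl
    (b ∷ a ∷ s ∷ s′ ∷ t ∷ t′ ∷ [])) (cong₂ _∧_ l (≤⇒≤ᵇ lt)))

ones : ∀ {m} → Vec Bool m → Vec Bool m → Vec Bool m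
ones = V.zipWith (λ b a → not b ∧ a)

interchange : ∀ x y z w → (x ℕ.+ z) ℕ.+ (y ℕ.+ w) ≡ (x ℕ.+ y) ℕ.+ (z ℕ.+ w)
interchange = solve-∀ℕ

∣b∣≤ : ∀ b a s s′ → local b a s s′ ≡ true → 𝟙 b ≤ 𝟙 a ℕ.+ term s (isRim b a) s s′
∣b∣≤ b a s s′ l = ≤ᵇ⇒≤ (implies (tauto 4 (λ { (b ∷ a ∷ s ∷ s′ ∷ []) → not (local b a s s′) ∨
    (𝟙 b ≤ᵇ 𝟙 a ℕ.+ term s (isRim b a) s s′) }) refl (b ∷ a ∷ s ∷ s′ ∷ [])) l)

-- The source of the degree bound: since ∣B∣ + ∣A∣ = m, a failure of 2 wt < m + r means equality
-- here, and `tight` analyses that case.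
∣B∣≤ : ∀ {m} {B A S S′ : Vec Bool m} → Local B A S S′ → ∣ B ∣ ≤ ∣ A ∣ ℕ.+ cost S (rims B A) S S′
tight : ∀ {m} {B A S S′ : Vec Bool m} → Local B A S S′ → ∣ A ∣ ℕ.+ cost S (rims B A) S S′ ≤ ∣ B ∣ →
  S ⊑ rims B A × ones B A ⊑ ⊥
∣B∣≤ [] = z≤n
∣B∣≤ {B = b ∷ B} {a ∷ A} {s ∷ S} {s′ ∷ S′} (l ∷ ls) rewrite card-∷ b B | card-∷ a A =
  subst (𝟙 b ℕ.+ ∣ B ∣ ≤_) (interchange (𝟙 a) ∣ A ∣ _ _) (ℕP.+-mono-≤ (∣b∣≤ b a s s′ l) (∣B∣≤ ls))
tight [] le = [] , []
tight {B = b ∷ B} {a ∷ A} {s ∷ S} {s′ ∷ S′} (l ∷ ls) le rewrite card-∷ b B | card-∷ a A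
  with split-≤ (∣b∣≤ b a s s′ l) (∣B∣≤ ls) (subst (_≤ 𝟙 b ℕ.+ ∣ B ∣)
      (sym (interchange (𝟙 a) ∣ A ∣ (term s (isRim b a) s s′) _)) le)
... | lt , lc with tight ls lc
... | p , q = ⊑-cons (proj₁ both) p , ⊑-cons (proj₂ both) q
  where
  both : (not s ∨ isRim b a) ≡ true × (not (not b ∧ a) ∨ false) ≡ true
  both = ∧-true (implies (tauto 4 (λ { (b ∷ a ∷ s ∷ s′ ∷ []) →
    not (local b a s s′ ∧ (𝟙 a ℕ.+ term s (isRim b a) s s′ ≤ᵇ 𝟙 b)) ∨ ((not s ∨ isRim b a) ∧ (not (not b ∧ a) ∨ false)) }) refl
    (b ∷ a ∷ s ∷ s′ ∷ [])) (cong₂ _∧_ l (≤⇒≤ᵇ lt)))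

-- A cover inside the set of zero-height vertices supports neither a spoke outside `S` nor a rim
-- edge outside `rims B A`: by `local`, an edge with both ends at height 0 is already a peak. Every
-- added element therefore costs one.
maximal : ∀ {m} {B A S S′ : Vec Bool m} → Local B A S S′ → ∀ {T T′ X Y} → T ⊑ S → T′ ⊑ S′ →
  S ⊑ X → rims B A ⊑ Y → cost X Y T T′ ≤ cost S (rims B A) T T′ → X ⊑ S × Y ⊑ rims B A
maximal [] [] [] [] [] le = [] , []
maximal {B = b ∷ B} {a ∷ A} {s ∷ S} {s′ ∷ S′} (l ∷ ls) {t ∷ T} {t′ ∷ T′} {x ∷ X} {y ∷ Y} t⊑ t′⊑ ⊑x ⊑y le
  with split-≤ {term s (isRim b a) t t′} {term x y t t′} t≤ (cost-mono (⊑-tail ⊑x) (⊑-tail ⊑y) T T′) le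
  where
  t≤ : term s (isRim b a) t t′ ≤ term x y t t′
  t≤ = ≤ᵇ⇒≤ (implies (tauto 6 (λ { (s ∷ rr ∷ x ∷ y ∷ t ∷ t′ ∷ []) → not ((not s ∨ x) ∧ (not rr ∨ y)) ∨
      (term s rr t t′ ≤ᵇ term x y t t′) }) refl (s ∷ isRim b a ∷ x ∷ y ∷ t ∷ t′ ∷ []))
     (cong₂ _∧_ (⊑-head ⊑x) (⊑-head ⊑y)))
... | lt , lc with maximal ls (⊑-tail t⊑) (⊑-tail t′⊑) (⊑-tail ⊑x) (⊑-tail ⊑y) lc
... | p , q = ⊑-cons (proj₁ both) p , ⊑-cons (proj₂ both) q
  where
  both : (not x ∨ s) ≡ true × (not y ∨ isRim b a) ≡ true
  both = ∧-true (implies (tauto 8 (λ { (b ∷ a ∷ s ∷ s′ ∷ x ∷ y ∷ t ∷ t′ ∷ []) →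
    not ((local b a s s′ ∧ (term x y t t′ ≤ᵇ term s (isRim b a) t t′)) ∧
        (((not t ∨ s) ∧ (not t′ ∨ s′)) ∧ ((not s ∨ x) ∧ (not (isRim b a) ∨ y))))
    ∨ ((not x ∨ s) ∧ (not y ∨ isRim b a)) }) refl (b ∷ a ∷ s ∷ s′ ∷ x ∷ y ∷ t ∷ t′ ∷ []))
    (cong₂ _∧_ (cong₂ _∧_ l (≤⇒≤ᵇ lt)) (cong₂ _∧_ (cong₂ _∧_ (⊑-head t⊑) (⊑-head t′⊑)) (cong₂ _∧_ (⊑-head ⊑x) (⊑-head ⊑y)))))

-- the walk started at its depth reaches height 0, at a vertex or inside a letter (0,1)
end-zero : ∀ {m} (B A : Vec Bool m) → spokes B A ⊑ ⊥ → ones B A ⊑ ⊥ → end (depth 0 B A) B A ≡ 0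
end-zero [] [] z o = refl
end-zero (b ∷ B) (a ∷ A) z o = go b a (depth 0 B A) refl (⊑-head z) (⊑-tail z) (⊑-head o)
  where
  IH : ∀ {d} → depth 0 B A ≡ d → zeros d B A ⊑ ⊥ → end d B A ≡ 0
  IH refl z′ = end-zero B A z′ (⊑-tail o)
  go : ∀ b a d → depth 0 B A ≡ d → (not (pre b a d ≡ᵇ 0) ∨ false) ≡ true → zeros (step b a (pre b a d)) B A ⊑ ⊥ →
    (not (not b ∧ a) ∨ false) ≡ true → end (step b a (pre b a d)) B A ≡ 0
  go true true (suc (suc d)) e h z′ o = IH e z′
  go true false d e h z′ o = IH e z′
  go false false d e h z′ o = IH e z′
  go true true zero e () z′ o
  go true true (suc zero) e () z′ o
  go false true d e h z′ ()

-- The balanced words as a model of the whirl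

module Words (m-1 : ℕ) where

  m = suc m-1

  Word : Set
  Word = Subset m × Subset m

  words : List Word
  words = L.cartesianProduct (subsets m) (subsets m)

  ∑-words : ∀ (f : Word → ℤ) → ∑ words f ≡ sum2 m (λ b a → f (b , a))
  ∑-words f = go (subsets m)
    where
    go : ∀ xs → ∑ (L.cartesianProduct xs (subsets m)) f ≡ ∑ xs (λ b → ∑ (subsets m) (λ a → f (b , a)))
    go [] = refl
    go (b ∷ xs) = trans (∑-++ (L.map (b ,_) (subsets m)) _ f) (cong₂ ℤ._+_ (∑-map (b ,_) (subsets m) f) (go xs))

  φ : Word → Subset (m ℕ.+ m)
  φ (b , a) = spokes b a V.++ rims b a

  ok : Word → Bool
  ok (b , a) = balanced b a

  wt : Word → ℕ
  wt (b , a) = ∣ b ∣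

  module Balanced (B A : Subset m) (bal : balanced B A ≡ true) where

    S = spokes B A
    R = rims B A

    b+a : ∣ B ∣ ℕ.+ ∣ A ∣ ≡ m
    b+a = ≡ᵇ⇒≡ bal

    loc : Local B A S (rot S)
    loc = subst (Local B A S) (sym (rot-zeros _ B A (balanced-end B A bal))) (local-zeros _ B A ℕP.≤-refl)

    rankφ : ℕ
    rankφ = cost S R S (rot S)

    wrank-φ : wrank m (φ (B , A)) ≡ rankφ
    wrank-φ = trans (cong₂ rankAR (take-++ S R) (drop-++ S R))
      (isRank-unique {A = S} {R} (rankAR-isRank S R) ((λ T → cost-min loc T (rot T)) , S , refl))

    -- By `end-zero` the walk would end at height 0; being balanced it also starts there, so vertex
    -- 0 would be a spoke.
    touches-zero : ¬ (S ⊑ ⊥ × ones B A ⊑ ⊥)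
    touches-zero (z , o) = go B A z (trans (sym (balanced-end B A bal)) (end-zero B A z o))
      where
      absurd : ∀ d → d ≡ 0 → (not (d ≡ᵇ 0) ∨ false) ≢ true
      absurd zero refl ()
      go : ∀ {k} (B A : Subset (suc k)) → spokes B A ⊑ ⊥ → depth 0 B A ≢ 0
      go (b ∷ B) (a ∷ A) z e = absurd _ e (⊑-head z)

    flat : Flat (wrank m) (φ (B , A))
    flat x x∉ with wrank m K ℕP.<? wrank m (K ∪ ⁅ x ⁆)
      where K = φ (B , A)
    ... | yes lt = lt
    ... | no ≮ = ⊥-elim (x∉ (⊑⇒⊆ X⊑K (q⊆p∪q (φ (B , A)) ⁅ x ⁆ (x∈⁅x⁆ x))))
      where
      K = φ (B , A)
      X = K ∪ ⁅ x ⁆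
      X₁ = V.take m X
      X₂ = V.drop m X
      K⊑X : K ⊑ X
      K⊑X = ⊆⇒⊑ (p⊆p∪q ⁅ x ⁆)
      S⊑ : S ⊑ X₁
      S⊑ = subst (_⊑ X₁) (take-++ S R) (⊑-take m K⊑X)
      R⊑ : R ⊑ X₂
      R⊑ = subst (_⊑ X₂) (drop-++ S R) (⊑-drop m K⊑X)
      opt = proj₂ (rankAR-isRank X₁ X₂)
      Q = proj₁ opt
      X≤ : cost X₁ X₂ Q (rot Q) ≤ rankφ
      X≤ = subst₂ _≤_ (sym (proj₂ opt)) wrank-φ (ℕP.≮⇒≥ ≮)
      -- If adding `x` does not raise the rank, an optimal cover `Q` of the larger set is optimal
      -- for the smaller one as well.
      strict = cost-min-strict loc Q (rot Q) (ℕP.≤-trans (cost-mono S⊑ R⊑ Q (rot Q)) X≤)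
      U = extra Q S
      U⊑rot : U ⊑ rot U
      U⊑rot = subst (U ⊑_) (sym (rot-zipWith _ Q S)) (proj₁ strict)
      case : U ≡ ⊤ ⊎ U ≡ ⊥ → Q ⊑ S
      case (inj₁ U⊤) = ⊥-elim (touches-zero (noS Q S U⊤ , noOnes B A (⊤⊑⇒≡ (subst (_⊑ R) U⊤ (proj₂ strict)))))
        where
        noS : ∀ {k} (Q S : Subset k) → extra Q S ≡ ⊤ → S ⊑ ⊥
        noS [] [] e = []
        noS (true ∷ Q) (false ∷ S) e = keep false (noS Q S (VP.∷-injectiveʳ e))
        noOnes : ∀ {k} (B A : Subset k) → rims B A ≡ ⊤ → ones B A ⊑ ⊥
        noOnes [] [] e = []
        noOnes (true ∷ B) (false ∷ A) e = keep false (noOnes B A (VP.∷-injectiveʳ e))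
      case (inj₂ U⊥) = sub Q S U⊥
        where
        sub : ∀ {k} (Q S : Subset k) → extra Q S ≡ ⊥ → Q ⊑ S
        sub [] [] e = []
        sub (false ∷ Q) (s ∷ S) e = ⊑-cons refl (sub Q S (VP.∷-injectiveʳ e))
        sub (true ∷ Q) (true ∷ S) e = keep true (sub Q S (VP.∷-injectiveʳ e))
      Q⊑S : Q ⊑ S
      Q⊑S = case (⊑-rot-constant U U⊑rot)
      max = maximal loc Q⊑S (⊑-rot Q⊑S) S⊑ R⊑ (ℕP.≤-trans X≤ (cost-min loc Q (rot Q)))
      X⊑K : X ⊑ K
      X⊑K = ⊑-++ m (subst (X₁ ⊑_) (sym (take-++ S R)) (proj₁ max)) (subst (X₂ ⊑_) (sym (drop-++ S R)) (proj₂ max))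

    degree-bound : rankφ < m → 2 ℕ.* ∣ B ∣ < m ℕ.+ rankφ
    degree-bound rankφ<m = subst₂ (λ x y → x < y ℕ.+ rankφ) (cong (∣ B ∣ ℕ.+_) (sym (ℕP.+-identityʳ ∣ B ∣))) b+a
      (subst (∣ B ∣ ℕ.+ ∣ B ∣ <_) (sym (ℕP.+-assoc ∣ B ∣ ∣ A ∣ rankφ)) (ℕP.+-monoʳ-< ∣ B ∣ (ℕP.≰⇒> impossible)))
      where
      impossible : ¬ (∣ A ∣ ℕ.+ rankφ ≤ ∣ B ∣)
      impossible le with tight loc le
      -- In the equality case every zero-height vertex is followed by a rim edge of the flat, which
      -- leads to another zero-height vertex. So `S` is everything, and the rank is m, or nothing,
      -- against `touches-zero`.
      ... | S⊑R , o with ⊑-rot-constant S (closed loc S⊑R)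
        where
        closed : ∀ {k} {B A S S′ : Vec Bool k} → Local B A S S′ → S ⊑ rims B A → S ⊑ S′
        closed [] [] = []
        closed {B = b ∷ B} {a ∷ A} {s ∷ S} {s′ ∷ S′} (l ∷ ls) p = ⊑-cons (implies (tauto 4 (λ { (b ∷ a ∷ s ∷ s′ ∷ []) →
          not (local b a s s′ ∧ (not s ∨ (b ∧ not a))) ∨ (not s ∨ s′) }) refl (b ∷ a ∷ s ∷ s′ ∷ []))
              (cong₂ _∧_ l (⊑-head p))) (closed ls (⊑-tail p))
      ... | inj₂ S⊥ = touches-zero (subst (_⊑ ⊥) (sym S⊥) (⊑-refl ⊥) , o)
      ... | inj₁ S⊤ = ℕP.<-irrefl refl (subst (_< m) (trans (cong (λ S → cost S R S (rot S)) S⊤)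
          (trans (cong (cost ⊤ R ⊤) (rot-replicate m true)) (cost-on-⊤ ⊤ R))) rankφ<m)

  -- A flat with all rim edges forces every letter to be (1 , 0), and for that word all vertices are
  -- at the minimum.
  ∑-top : ∑ words (λ ω → ⟦ ok ω ⟧ ℤ.* ⟦ φ ω ==ᵇ ⊤ ⟧) ≡ + 1
  ∑-top = trans (∑-words _) (trans (sum2-cong m point)
      (trans (∑-cong (subsets m) λ b → ∑-*ˡ (subsets m) ⟦ b ==ᵇ ⊤ ⟧ (λ a → ⟦ a ==ᵇ ⊥ ⟧ ℤ.* (+ 1)))
     (trans (∑-δ m ⊤ (λ b → ∑ (subsets m) (λ a → ⟦ a ==ᵇ ⊥ ⟧ ℤ.* (+ 1)))) (∑-δ m ⊥ (λ _ → + 1)))))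
    where
    rims-⊤ : ∀ {k} (b a : Subset k) → rims b a ≡ ⊤ → b ≡ ⊤ × a ≡ ⊥
    rims-⊤ [] [] e = refl , refl
    rims-⊤ (true ∷ b) (false ∷ a) e = let (p , q) = rims-⊤ b a (VP.∷-injectiveʳ e) in cong (true ∷_) p , cong (false ∷_) q
    ⊤-depth : ∀ k → depth 0 (⊤ {k}) ⊥ ≡ 0
    ⊤-depth zero = refl
    ⊤-depth (suc k) = ⊤-depth k
    ⊤-zeros : ∀ k → zeros 0 (⊤ {k}) ⊥ ≡ ⊤
    ⊤-zeros zero = refl
    ⊤-zeros (suc k) = cong (true ∷_) (⊤-zeros k)
    ⊤-rims : ∀ k → rims (⊤ {k}) ⊥ ≡ ⊤
    ⊤-rims zero = refl
    ⊤-rims (suc k) = cong (true ∷_) (⊤-rims k)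
    ⊤-++ : ∀ k l → (⊤ {k}) V.++ (⊤ {l}) ≡ ⊤
    ⊤-++ zero l = refl
    ⊤-++ (suc k) l = cong (true ∷_) (⊤-++ k l)
    φ-⊤ : φ (⊤ , ⊥) ≡ ⊤
    φ-⊤ = trans (cong₂ V._++_ (trans (cong (λ d → zeros d (⊤ {m}) ⊥) (⊤-depth m)) (⊤-zeros m)) (⊤-rims m)) (⊤-++ m m)
    eqv : ∀ b a → (ok (b , a) ∧ (φ (b , a) ==ᵇ ⊤)) ≡ ((b ==ᵇ ⊤) ∧ (a ==ᵇ ⊥))
    eqv b a = bool-ext to from
      where
      to : (ok (b , a) ∧ (φ (b , a) ==ᵇ ⊤)) ≡ true → ((b ==ᵇ ⊤) ∧ (a ==ᵇ ⊥)) ≡ true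
      to h with rims-⊤ b a (trans (sym (drop-++ (spokes b a) (rims b a)))
          (trans (cong (V.drop m) (==ᵇ⇒≡ {X = φ (b , a)} (proj₂ (∧-true {ok (b , a)} h)))) (drop-⊤ m)))
      ... | refl , refl = cong₂ _∧_ (==ᵇ-refl (⊤ {m})) (==ᵇ-refl (⊥ {m}))
      from : ((b ==ᵇ ⊤) ∧ (a ==ᵇ ⊥)) ≡ true → (ok (b , a) ∧ (φ (b , a) ==ᵇ ⊤)) ≡ true
      from h with ==ᵇ⇒≡ {X = b} (proj₁ (∧-true {b ==ᵇ ⊤} h)) | ==ᵇ⇒≡ {X = a} (proj₂ (∧-true {b ==ᵇ ⊤} h))
      ... | refl | refl = cong₂ _∧_ (≡⇒≡ᵇ (trans (cong₂ ℕ._+_ (∣⊤∣≡n m) (∣⊥∣≡0 m)) (ℕP.+-identityʳ m)))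
            (trans (cong (_==ᵇ ⊤) φ-⊤) (==ᵇ-refl (⊤ {m ℕ.+ m})))
    point : ∀ b a → ⟦ ok (b , a) ⟧ ℤ.* ⟦ φ (b , a) ==ᵇ ⊤ ⟧ ≡ ⟦ b ==ᵇ ⊤ ⟧ ℤ.* (⟦ a ==ᵇ ⊥ ⟧ ℤ.* (+ 1))
    point b a = trans (sym (⟦⟧-∧ (ok (b , a)) _)) (trans (cong ⟦_⟧ (eqv b a)) (trans (⟦⟧-∧ (b ==ᵇ ⊤) _)
      (cong (λ z → ⟦ b ==ᵇ ⊤ ⟧ ℤ.* z) (sym (ℤP.*-identityʳ ⟦ a ==ᵇ ⊥ ⟧)))))

  ⊆ᵇ-++ : ∀ k {l} (X : Subset (k ℕ.+ l)) (Y : Subset k) (Z : Subset l) → (X ⊆ᵇ (Y V.++ Z)) ≡ (V.take k X ⊆ᵇ Y) ∧ (V.drop k X ⊆ᵇ Z)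
  ⊆ᵇ-++ zero X [] Z = refl
  ⊆ᵇ-++ (suc k) (x ∷ X) (y ∷ Y) Z = trans (cong ((not x ∨ y) ∧_) (⊆ᵇ-++ k X Y Z)) (sym (∧-assoc (not x ∨ y) _ _))

  model : KLModel (wrank m) m
  model = record
    { matroid = wrank-matroid m
    ; rank≡n = wrank-⊤ m
    ; Word = Word ; words = words ; ok = ok ; φ = φ ; wt = wt
    ; φ-flat = λ { (b , a) bal → Balanced.flat b a bal }
    ; r≤wt = λ { (b , a) bal → subst (_≤ ∣ b ∣) (sym (Balanced.wrank-φ b a bal)) (cost≤∣B∣ (Balanced.loc b a bal)) }
    ; wt≤n = λ { (b , a) bal → ∣p∣≤n b }
    ; degree< = λ { (b , a) bal lt → subst (λ x → 2 ℕ.* ∣ b ∣ < m ℕ.+ x) (sym (Balanced.wrank-φ b a bal))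
        (Balanced.degree-bound b a bal (subst (_< m) (Balanced.wrank-φ b a bal) lt)) }
    ; top = ∑-top
    ; palindromic = pal
    }
    where
    pal : ∀ X (ψ : ℕ → ℤ) →
      ∑ words (λ ω → ⟦ ok ω ⟧ ℤ.* (⟦ X ⊆ᵇ φ ω ⟧ ℤ.* ψ (wt ω))) ≡
      ∑ words (λ ω → ⟦ ok ω ⟧ ℤ.* (⟦ X ⊆ᵇ φ ω ⟧ ℤ.* ψ (wrank m X ℕ.+ (m ∸ wt ω))))
    pal X ψ with palindromic-rank (V.take m X) (V.drop m X)
    ... | k , isR , palk = trans (∑-words _) (trans (sum2-cong m λ b a → cong (λ c → ⟦ ok (b , a) ⟧ ℤ.* (⟦ c ⟧ ℤ.* ψ ∣ b ∣))
        (⊆ᵇ-++ m X (spokes b a) (rims b a)))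
      (trans (palk ψ) (trans (sum2-cong m point) (sym (∑-words _)))))
      where
      k≡ : k ≡ wrank m X
      k≡ = isRank-unique {A = V.take m X} {V.drop m X} isR (rankAR-isRank (V.take m X) (V.drop m X))
      point : ∀ b a → ⟦ balanced b a ⟧ ℤ.* (⟦ contains (V.take m X) (V.drop m X) b a ⟧ ℤ.* ψ (k ℕ.+ ∣ a ∣)) ≡
        ⟦ balanced b a ⟧ ℤ.* (⟦ X ⊆ᵇ (spokes b a V.++ rims b a) ⟧ ℤ.* ψ (wrank m X ℕ.+ (m ∸ ∣ b ∣)))
      point b a rewrite ⊆ᵇ-++ m X (spokes b a) (rims b a) | k≡ = go (balanced b a) refl
        where
        c = contains (V.take m X) (V.drop m X) b a
        go : ∀ o → balanced b a ≡ o → ⟦ o ⟧ ℤ.* (⟦ c ⟧ ℤ.* ψ (wrank m X ℕ.+ ∣ a ∣)) ≡ ⟦ o ⟧ ℤ.*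
            (⟦ c ⟧ ℤ.* ψ (wrank m X ℕ.+ (m ∸ ∣ b ∣)))
        go false e = trans (ℤP.*-zeroˡ (⟦ c ⟧ ℤ.* ψ (wrank m X ℕ.+ ∣ a ∣)))
            (sym (ℤP.*-zeroˡ (⟦ c ⟧ ℤ.* ψ (wrank m X ℕ.+ (m ∸ ∣ b ∣)))))
        go true e = cong (λ y → + 1 ℤ.* (⟦ c ⟧ ℤ.* ψ (wrank m X ℕ.+ y)))
          (trans (sym (ℕP.m+n∸m≡n ∣ b ∣ ∣ a ∣)) (cong (_∸ ∣ b ∣) (≡ᵇ⇒≡ {∣ b ∣ ℕ.+ ∣ a ∣} e)))

-- The whirl matroid has rank function wrank

⊑-trans : ∀ {m} {X Y Z : Subset m} → X ⊑ Y → Y ⊑ Z → X ⊑ Z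
⊑-trans p q = ⊆⇒⊑ (⊆-trans (⊑⇒⊆ p) (⊑⇒⊆ q))

lookup-⊑ : ∀ {m} {X Y : Subset m} → X ⊑ Y → ∀ j → (not (lookup X j) ∨ lookup Y j) ≡ true
lookup-⊑ {X = x ∷ X} {y ∷ Y} s zero = ⊑-head s
lookup-⊑ {X = x ∷ X} {y ∷ Y} s (suc j) = lookup-⊑ (⊑-tail s) j

⊑-lookup : ∀ {m} {X Y : Subset m} → (∀ j → (not (lookup X j) ∨ lookup Y j) ≡ true) → X ⊑ Y
⊑-lookup {X = []} {[]} h = []
⊑-lookup {X = x ∷ X} {y ∷ Y} h = ⊑-cons (h zero) (⊑-lookup (h ∘ suc))

∣⊑∣ : ∀ {m} {X Y : Subset m} → X ⊑ Y → ∣ X ∣ ≤ ∣ Y ∣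
∣⊑∣ p = p⊆q⇒∣p∣≤∣q∣ (⊑⇒⊆ p)

⊑-card-≡ : ∀ {m} {X Y : Subset m} → X ⊑ Y → ∣ Y ∣ ≤ ∣ X ∣ → X ≡ Y
⊑-card-≡ [] le = refl
⊑-card-≡ (keep true s) (s≤s le) = cong (true ∷_) (⊑-card-≡ s le)
⊑-card-≡ (keep false s) le = cong (false ∷_) (⊑-card-≡ s le)
⊑-card-≡ (add s) le = ⊥-elim (ℕP.<⇒≱ (s≤s (∣⊑∣ s)) le)

∣∣≡0⇒⊥ : ∀ {m} (X : Subset m) → ∣ X ∣ ≡ 0 → X ≡ ⊥
∣∣≡0⇒⊥ [] e = refl
∣∣≡0⇒⊥ (false ∷ X) e = cong (false ∷_) (∣∣≡0⇒⊥ X e)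

nonempty-∣∣ : ∀ {m} (X : Subset m) → 0 < ∣ X ∣ → Nonempty X
nonempty-∣∣ (true ∷ X) _ = zero , V.here
nonempty-∣∣ (false ∷ X) h = let (x , p) = nonempty-∣∣ X h in suc x , V.there p

extra-⊥ : ∀ {m} (X : Subset m) → extra X ⊥ ≡ X
extra-⊥ [] = refl
extra-⊥ (x ∷ X) = cong₂ _∷_ (∧-identityʳ x) (extra-⊥ X)

∣extra-⁅⁆∣ : ∀ {m} (X : Subset m) v → ∣ X ∣ ≡ ∣ extra X ⁅ v ⁆ ∣ ℕ.+ 𝟙 (lookup X v)
∣extra-⁅⁆∣ (x ∷ X) zero rewrite extra-⊥ X | ∧-zeroʳ x = trans (card-∷ x X) (ℕP.+-comm (𝟙 x) _)
∣extra-⁅⁆∣ (x ∷ X) (suc v) rewrite ∧-identityʳ x | card-∷ x X | card-∷ x (extra X ⁅ v ⁆) | ∣extra-⁅⁆∣ X v =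
  sym (ℕP.+-assoc (𝟙 x) _ _)

extra-⊑ : ∀ {m} (X Y : Subset m) → extra X Y ⊑ X
extra-⊑ [] [] = []
extra-⊑ (true ∷ X) (true ∷ Y) = add (extra-⊑ X Y)
extra-⊑ (true ∷ X) (false ∷ Y) = keep true (extra-⊑ X Y)
extra-⊑ (false ∷ X) (y ∷ Y) = keep false (extra-⊑ X Y)

extra-mono : ∀ {m} {X X′ : Subset m} → X ⊑ X′ → ∀ Y → extra X Y ⊑ extra X′ Y
extra-mono [] [] = []
extra-mono (keep b s) (y ∷ Y) = keep (b ∧ not y) (extra-mono s Y)
extra-mono (add s) (true ∷ Y) = keep false (extra-mono s Y)
extra-mono (add s) (false ∷ Y) = add (extra-mono s Y)

prv : ∀ {m} → Subset m → Subset m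
prv X = proj₁ (unrot X)

rot-prv : ∀ {m} (X : Subset m) → rot (prv X) ≡ X
rot-prv X = proj₂ (unrot X)

∣prv∣ : ∀ {m} (X : Subset m) → ∣ prv X ∣ ≡ ∣ X ∣
∣prv∣ X = trans (sym (∣rot∣ (prv X))) (cong ∣_∣ (rot-prv X))

unrot-⊑ : ∀ {m} {X Y : Subset m} → rot X ⊑ rot Y → X ⊑ Y
unrot-⊑ {X = X} {Y} s = ⊆⇒⊑ (⊆ᵇ⇒⊆ (trans (sym (⊆ᵇ-rot X Y)) (⊆⇒⊆ᵇ (⊑⇒⊆ s))))

-- Cycles of the wheel through degree counts

deg : Bool → Bool → Bool → ℕ
deg a r p = 𝟙 a ℕ.+ (𝟙 r ℕ.+ 𝟙 p)

degs : ∀ {m} → (A R P : Subset m) → ℕ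
degs [] [] [] = 0
degs (a ∷ A) (r ∷ R) (p ∷ P) = deg a r p ℕ.+ degs A R P

degs-sum : ∀ {m} (A R P : Subset m) → degs A R P ≡ ∣ A ∣ ℕ.+ (∣ R ∣ ℕ.+ ∣ P ∣)
degs-sum [] [] [] = refl
degs-sum (a ∷ A) (r ∷ R) (p ∷ P) rewrite card-∷ a A | card-∷ r R | card-∷ p P | degs-sum A R P =
  lem (𝟙 a) (𝟙 r) (𝟙 p) (∣ A ∣) (∣ R ∣) (∣ P ∣)
  where
  lem : ∀ a r p x y z → a ℕ.+ (r ℕ.+ p) ℕ.+ (x ℕ.+ (y ℕ.+ z)) ≡ a ℕ.+ x ℕ.+ (r ℕ.+ y ℕ.+ (p ℕ.+ z))
  lem = solve-∀ℕ

-- Degree 0 or 2, as in `cyclesᵇ`; the hub, too, may carry no more than two spokes.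
even : ℕ → Bool
even d = (d ≡ᵇ 0) ∨ (d ≡ᵇ 2)

record IsCycles {m} (A R : Subset m) : Set where
  field
    nonempty : 0 < ∣ A ∣ ℕ.+ ∣ R ∣
    hub : even ∣ A ∣ ≡ true
    vertices : ∀ j → even (deg (lookup A j) (lookup R j) (lookup (prv R) j)) ≡ true

double-≤ : ∀ {m} (A R P S : Subset m) → (∀ j → lookup S j ≡ true → 2 ≤ deg (lookup A j) (lookup R j) (lookup P j)) →
  2 ℕ.* ∣ S ∣ ≤ degs A R P
double-≤ [] [] [] [] h = z≤n
double-≤ (a ∷ A) (r ∷ R) (p ∷ P) (true ∷ S) h = subst (_≤ deg a r p ℕ.+ degs A R P) (lem ∣ S ∣)
  (ℕP.+-mono-≤ (h zero refl) (double-≤ A R P S (h ∘ suc)))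
  where
  lem : ∀ s → 2 ℕ.+ 2 ℕ.* s ≡ 2 ℕ.* suc s
  lem = solve-∀ℕ
double-≤ (a ∷ A) (r ∷ R) (p ∷ P) (false ∷ S) h = ℕP.≤-trans (double-≤ A R P S (h ∘ suc)) (ℕP.m≤n+m _ (deg a r p))

double-≡ : ∀ {m} (A R P S : Subset m) → (∀ j → lookup S j ≡ true → 2 ≤ deg (lookup A j) (lookup R j) (lookup P j)) →
  degs A R P ≤ 2 ℕ.* ∣ S ∣ → ∀ j → even (deg (lookup A j) (lookup R j) (lookup P j)) ≡ true
double-≡ (a ∷ A) (r ∷ R) (p ∷ P) (s ∷ S) h le j = go s h le j
  where
  lem : ∀ s → 2 ℕ.* suc s ≡ 2 ℕ.+ 2 ℕ.* s
  lem = solve-∀ℕ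
  even2 : ∀ d → d ≤ 2 → 2 ≤ d → even d ≡ true
  even2 d p q rewrite ℕP.≤-antisym p q = refl
  even0 : ∀ d → d ≤ 0 → even d ≡ true
  even0 zero p = refl
  go : ∀ s → (∀ j → lookup (s ∷ S) j ≡ true → 2 ≤ deg (lookup (a ∷ A) j) (lookup (r ∷ R) j) (lookup (p ∷ P) j)) →
    deg a r p ℕ.+ degs A R P ≤ 2 ℕ.* ∣ s ∷ S ∣ → ∀ j → even (deg (lookup (a ∷ A) j) (lookup (r ∷ R) j) (lookup (p ∷ P) j)) ≡ true
  go true h le j with split-≤ (h zero refl) (double-≤ A R P S (h ∘ suc)) (subst (deg a r p ℕ.+ degs A R P ≤_) (lem ∣ S ∣) le)
  go true h le zero | t , c = even2 _ t (h zero refl)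
  go true h le (suc j) | t , c = double-≡ A R P S (h ∘ suc) c j
  go false h le j with split-≤ {0} z≤n (double-≤ A R P S (h ∘ suc)) le
  go false h le zero | t , c = even0 _ t
  go false h le (suc j) | t , c = double-≡ A R P S (h ∘ suc) c j

-- A set of more elements than rim vertices it touches contains a cycle: delete vertices of
-- degree at most one and superfluous spokes until the degree count is tight.

record Crowded {m} (A R S : Subset m) : Set where
  field
    A⊑S : A ⊑ S
    R⊑S : R ⊑ S
    R⊑rotS : R ⊑ rot S
    crowd : ∣ S ∣ < ∣ A ∣ ℕ.+ ∣ R ∣

-- Each rim edge has its first end in `S`, so rim edges alone never outnumber the vertices.
crowded-spoke : ∀ {m} {A R S : Subset m} → Crowded A R S → 0 < ∣ A ∣
crowded-spoke {A = A} {R} {S} v with ∣ A ∣ in eq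
... | suc _ = s≤s z≤n
... | zero = ⊥-elim (ℕP.<⇒≱ (subst (λ a → ∣ S ∣ < a ℕ.+ ∣ R ∣) eq (Crowded.crowd v)) (∣⊑∣ (Crowded.R⊑S v)))

HasCycles : ∀ {m} → Subset m → Subset m → Set
HasCycles A R = ∃ λ A′ → ∃ λ R′ → A′ ⊑ A × R′ ⊑ R × IsCycles A′ R′

HasCycles-mono : ∀ {m} {A A′ R R′ : Subset m} → A ⊑ A′ → R ⊑ R′ → HasCycles A R → HasCycles A′ R′
HasCycles-mono p q (A₁ , R₁ , s , t , c) = A₁ , R₁ , ⊑-trans s p , ⊑-trans t q , c

prv-⊤ : ∀ m → prv (⊤ {m}) ≡ ⊤
prv-⊤ m = ⊤⊑⇒≡ (unrot-⊑ (subst₂ _⊑_ (sym (rot-replicate m true)) (sym (rot-prv ⊤)) (⊑-refl ⊤)))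

lookup-⊤ : ∀ {m} (j : Fin m) → lookup ⊤ j ≡ true
lookup-⊤ zero = refl
lookup-⊤ (suc j) = lookup-⊤ j

lookup-⊥ : ∀ {m} (j : Fin m) → lookup ⊥ j ≡ false
lookup-⊥ zero = refl
lookup-⊥ (suc j) = lookup-⊥ j

rim-cycles : ∀ m → IsCycles {suc m} ⊥ ⊤
rim-cycles m = record
  { nonempty = subst (0 <_) (sym (trans (cong₂ ℕ._+_ (∣⊥∣≡0 (suc m)) (∣⊤∣≡n (suc m))) refl)) (s≤s z≤n)
  ; hub = cong even (∣⊥∣≡0 (suc m))
  ; vertices = λ j → trans (cong (λ P → even (deg (lookup ⊥ j) (lookup ⊤ j) (lookup P j))) (prv-⊤ (suc m)))
      (cong₂ (λ x y → even (deg x y y)) (lookup-⊥ j) (lookup-⊤ j)) }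

crowded-cycles : ∀ {m} n (A R S : Subset (suc m)) → Crowded A R S → ∣ A ∣ ℕ.+ ∣ R ∣ ℕ.+ ∣ S ∣ ≤ n → HasCycles A R
crowded-cycles zero A R S v le = ⊥-elim (ℕP.<⇒≱ (Crowded.crowd v) (ℕP.≤-trans (ℕP.m≤m+n (∣ A ∣ ℕ.+ ∣ R ∣) _) (ℕP.≤-trans le z≤n)))
crowded-cycles {m} (suc n) A R S v le with suc ∣ S ∣ ℕP.<? ∣ A ∣ ℕ.+ ∣ R ∣
-- While the surplus is at least two a spoke can be given up; this is what brings the hub down to
-- degree two.
... | yes more = HasCycles-mono (extra-⊑ A ⁅ x ⁆) (⊑-refl R) (crowded-cycles n A′ R S
      (record { A⊑S = ⊑-trans (extra-⊑ A ⁅ x ⁆) A⊑S ; R⊑S = R⊑S ; R⊑rotS = R⊑rotS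
              ; crowd = ℕP.≤-pred (subst (suc ∣ S ∣ <_) (cong (ℕ._+ ∣ R ∣) ∣A∣≡) more) })
      (ℕP.≤-pred (subst (_≤ suc n) (cong (λ z → z ℕ.+ ∣ R ∣ ℕ.+ ∣ S ∣) ∣A∣≡) le)))
  where
  open Crowded v
  some = nonempty-∣∣ A (crowded-spoke v)
  x = proj₁ some
  A′ = extra A ⁅ x ⁆
  ∣A∣≡ : ∣ A ∣ ≡ suc ∣ A′ ∣
  ∣A∣≡ = trans (∣extra-⁅⁆∣ A x) (trans (cong (λ b → ∣ A′ ∣ ℕ.+ 𝟙 b) (∈-lookup (proj₂ some))) (ℕP.+-comm ∣ A′ ∣ 1))
... | no notMore with FP.any? (λ v → (v ∈? S) ×-dec (deg (lookup A v) (lookup R v) (lookup (prv R) v) ℕP.≤? 1))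
... | yes (x , x∈S , deg≤1) = HasCycles-mono (extra-⊑ A ⁅ x ⁆) R′⊑R (crowded-cycles n A′ R′ S′
      (record { A⊑S = extra-mono A⊑S ⁅ x ⁆
              ; R⊑S = extra-mono (⊑-trans (extra-⊑ R (rot ⁅ x ⁆)) R⊑S) ⁅ x ⁆
              ; R⊑rotS = ⊑-trans (extra-⊑ R₁ ⁅ x ⁆) (subst (R₁ ⊑_) (sym (rot-zipWith _ S ⁅ x ⁆)) (extra-mono R⊑rotS (rot ⁅ x ⁆)))
              ; crowd = ℕP.≤-pred (ℕP.≤-trans (subst (λ s → suc s ≤ ∣ A ∣ ℕ.+ ∣ R ∣) ∣S∣≡ crowd) AR≤) })
      (ℕP.≤-pred (ℕP.≤-trans (ℕP.≤-reflexive (trans (sym (ℕP.+-suc _ ∣ S′ ∣)) (cong (∣ A′ ∣ ℕ.+ ∣ R′ ∣ ℕ.+_) (sym ∣S∣≡))))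
        (ℕP.≤-trans (ℕP.+-monoˡ-≤ ∣ S ∣ (ℕP.+-mono-≤ (∣⊑∣ (extra-⊑ A ⁅ x ⁆)) (∣⊑∣ R′⊑R))) le))))
  where
  open Crowded v
  A′ = extra A ⁅ x ⁆
  S′ = extra S ⁅ x ⁆
  R₁ = extra R (rot ⁅ x ⁆)
  R′ = extra R₁ ⁅ x ⁆
  R′⊑R : R′ ⊑ R
  R′⊑R = ⊑-trans (extra-⊑ R₁ ⁅ x ⁆) (extra-⊑ R (rot ⁅ x ⁆))
  ∣S∣≡ : ∣ S ∣ ≡ suc ∣ S′ ∣
  ∣S∣≡ = trans (∣extra-⁅⁆∣ S x) (trans (cong (λ b → ∣ S′ ∣ ℕ.+ 𝟙 b) (∈-lookup x∈S)) (ℕP.+-comm ∣ S′ ∣ 1))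
  ∣R₁∣≡ : ∣ R₁ ∣ ≡ ∣ extra (prv R) ⁅ x ⁆ ∣
  ∣R₁∣≡ = trans (cong (λ Z → ∣ extra Z (rot ⁅ x ⁆) ∣) (sym (rot-prv R)))
    (trans (cong ∣_∣ (sym (rot-zipWith _ (prv R) ⁅ x ⁆))) (∣rot∣ (extra (prv R) ⁅ x ⁆)))
  𝟙-mono : ∀ {x y} → (not x ∨ y) ≡ true → 𝟙 x ≤ 𝟙 y
  𝟙-mono {true} {true} e = ℕP.≤-refl
  𝟙-mono {false} e = z≤n
  AR≤ : ∣ A ∣ ℕ.+ ∣ R ∣ ≤ suc (∣ A′ ∣ ℕ.+ ∣ R′ ∣)
  AR≤ = begin
    ∣ A ∣ ℕ.+ ∣ R ∣ ≡⟨ cong₂ ℕ._+_ (∣extra-⁅⁆∣ A x) (trans (sym (∣prv∣ R)) (∣extra-⁅⁆∣ (prv R) x)) ⟩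
    (∣ A′ ∣ ℕ.+ α) ℕ.+ (∣ extra (prv R) ⁅ x ⁆ ∣ ℕ.+ π) ≡⟨ cong (λ z → ∣ A′ ∣ ℕ.+ α ℕ.+ (z ℕ.+ π))
        (trans (sym ∣R₁∣≡) (∣extra-⁅⁆∣ R₁ x)) ⟩
    (∣ A′ ∣ ℕ.+ α) ℕ.+ ((∣ R′ ∣ ℕ.+ 𝟙 (lookup R₁ x)) ℕ.+ π) ≤⟨ ℕP.+-monoʳ-≤ (∣ A′ ∣ ℕ.+ α)
        (ℕP.+-monoˡ-≤ π (ℕP.+-monoʳ-≤ ∣ R′ ∣ (𝟙-mono (lookup-⊑ (extra-⊑ R (rot ⁅ x ⁆)) x)))) ⟩
    (∣ A′ ∣ ℕ.+ α) ℕ.+ ((∣ R′ ∣ ℕ.+ 𝟙 (lookup R x)) ℕ.+ π) ≡⟨ lem (∣ A′ ∣) α (∣ R′ ∣) (𝟙 (lookup R x)) π ⟩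
    deg (lookup A x) (lookup R x) (lookup (prv R) x) ℕ.+ (∣ A′ ∣ ℕ.+ ∣ R′ ∣) ≤⟨ ℕP.+-monoˡ-≤ (∣ A′ ∣ ℕ.+ ∣ R′ ∣) deg≤1 ⟩
    suc (∣ A′ ∣ ℕ.+ ∣ R′ ∣) ∎
    where
    open ℕP.≤-Reasoning
    α = 𝟙 (lookup A x)
    π = 𝟙 (lookup (prv R) x)
    lem : ∀ a b c d e → (a ℕ.+ b) ℕ.+ ((c ℕ.+ d) ℕ.+ e) ≡ (b ℕ.+ (d ℕ.+ e)) ℕ.+ (a ℕ.+ c)
    lem = solve-∀ℕ
-- The surplus is one and all degrees on `S` are at least two. From 2∣S∣ ≤ ∣A∣ + 2∣R∣ and ∣A∣ + ∣R∣
-- = ∣S∣ + 1 at most two spokes remain.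
... | no noLow = result ∣ A ∣ refl (crowded-spoke v)
  where
  open Crowded v
  high : ∀ j → lookup S j ≡ true → 2 ≤ deg (lookup A j) (lookup R j) (lookup (prv R) j)
  high j e = ℕP.≰⇒> λ le → noLow (j , lookup-∈ S j e , le)
  AR≡ : ∣ A ∣ ℕ.+ ∣ R ∣ ≡ suc ∣ S ∣
  AR≡ = ℕP.≤-antisym (ℕP.≮⇒≥ notMore) crowd
  Σ≡ : degs A R (prv R) ≡ ∣ A ∣ ℕ.+ (∣ R ∣ ℕ.+ ∣ R ∣)
  Σ≡ = trans (degs-sum A R (prv R)) (cong (λ z → ∣ A ∣ ℕ.+ (∣ R ∣ ℕ.+ z)) (∣prv∣ R))
  bound : 2 ℕ.* ∣ S ∣ ≤ ∣ A ∣ ℕ.+ (∣ R ∣ ℕ.+ ∣ R ∣)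
  bound = subst (2 ℕ.* ∣ S ∣ ≤_) Σ≡ (double-≤ A R (prv R) S high)
  lem : ∀ k r s → k ℕ.+ r ≡ suc s → k ℕ.+ k ℕ.+ (r ℕ.+ r) ≡ 2 ℕ.+ 2 ℕ.* s
  lem k r s e = trans (shuffle k r) (trans (cong (λ z → z ℕ.+ z) e) (shuffle′ s))
    where
    shuffle : ∀ k r → k ℕ.+ k ℕ.+ (r ℕ.+ r) ≡ (k ℕ.+ r) ℕ.+ (k ℕ.+ r)
    shuffle = solve-∀ℕ
    shuffle′ : ∀ s → suc s ℕ.+ suc s ≡ 2 ℕ.+ 2 ℕ.* s
    shuffle′ = solve-∀ℕ
  result : ∀ k → ∣ A ∣ ≡ k → 0 < k → HasCycles A R
  -- With one spoke ∣R∣ = ∣S∣, so R = S is closed under rotation: it is the whole rim, and the cycle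
  -- found is the rim without the spoke.
  result 1 A≡1 _ = ⊥ , ⊤ , ⊆⇒⊑ (λ p → ⊥-elim (∉⊥ p)) , subst (_⊑ R) R≡⊤ (⊑-refl R) , rim-cycles m
    where
    R≡S : R ≡ S
    R≡S = ⊑-card-≡ R⊑S (ℕP.≤-reflexive (sym (ℕP.suc-injective (trans (cong (ℕ._+ ∣ R ∣) (sym A≡1)) AR≡))))
    R≡⊤ : R ≡ ⊤
    R≡⊤ with ⊑-rot-constant R (subst (λ Z → R ⊑ rot Z) (sym R≡S) R⊑rotS)
    ... | inj₁ e = e
    ... | inj₂ e = ⊥-elim (ℕP.<⇒≱ (subst (0 <_) (sym A≡1) (s≤s z≤n))
        (subst (∣ A ∣ ≤_) (trans (cong ∣_∣ (trans (sym R≡S) e)) (∣⊥∣≡0 (suc m))) (∣⊑∣ A⊑S)))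
  -- With two spokes the degree count is an equality, so all vertices of `S` have degree exactly two
  -- and the others degree zero.
  result 2 A≡2 _ = A , R , ⊑-refl A , ⊑-refl R , record
    { nonempty = subst (0 <_) (sym AR≡) (s≤s z≤n)
    ; hub = cong even A≡2
    ; vertices = double-≡ A R (prv R) S high (ℕP.≤-reflexive (trans Σ≡ (trans (cong (ℕ._+ (∣ R ∣ ℕ.+ ∣ R ∣)) A≡2)
        (ℕP.+-cancelˡ-≡ 2 _ _ (trans (sym (ℕP.+-assoc 2 2 _))
            (lem 2 (∣ R ∣) (∣ S ∣) (trans (cong (ℕ._+ ∣ R ∣) (sym A≡2)) AR≡)))))))
    }
  result (suc (suc (suc k))) A≡ _ = ⊥-elim (ℕP.<⇒≱ (ℕP.≤-reflexive refl)
    (ℕP.≤-trans (ℕP.m≤n+m 1 k) (ℕP.+-cancelˡ-≤ (2 ℕ.+ (3 ℕ.+ k ℕ.+ (∣ R ∣ ℕ.+ ∣ R ∣))) (k ℕ.+ 1) 0 (subst₂ _≤_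
      (trans (sym (lem (3 ℕ.+ k) (∣ R ∣) (∣ S ∣) (trans (cong (ℕ._+ ∣ R ∣) (sym A≡)) AR≡))) (rearr k (∣ R ∣ ℕ.+ ∣ R ∣)))
      (trans (cong (λ z → 2 ℕ.+ (z ℕ.+ (∣ R ∣ ℕ.+ ∣ R ∣))) A≡) (sym (ℕP.+-identityʳ _)))
      (s≤s (s≤s bound))))))
    where
    rearr : ∀ k x → 3 ℕ.+ k ℕ.+ (3 ℕ.+ k) ℕ.+ x ≡ 2 ℕ.+ (3 ℕ.+ k ℕ.+ x) ℕ.+ (k ℕ.+ 1)
    rearr = solve-∀ℕ

-- Degrees in the wheel graph

weigh : ∀ {m} → Subset m → (ℕ → ℕ) → ℕ
weigh X h = V.sum (tabulate (λ i → if lookup X i then h (toℕ i) else 0))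

weigh-cong : ∀ {m} (X : Subset m) (h h′ : ℕ → ℕ) → (∀ (i : Fin m) → h (toℕ i) ≡ h′ (toℕ i)) → weigh X h ≡ weigh X h′
weigh-cong [] h h′ e = refl
weigh-cong (x ∷ X) h h′ e = cong₂ ℕ._+_ (cong (λ z → if x then z else 0) (e zero)) (weigh-cong X (h ∘ suc) (h′ ∘ suc) (e ∘ suc))

weigh-+ : ∀ {m} (X : Subset m) (h h′ : ℕ → ℕ) → weigh X (λ i → h i ℕ.+ h′ i) ≡ weigh X h ℕ.+ weigh X h′
weigh-+ [] h h′ = refl
weigh-+ (true ∷ X) h h′ rewrite weigh-+ X (h ∘ suc) (h′ ∘ suc) = lem (h 0) (h′ 0) (weigh X (h ∘ suc)) (weigh X (h′ ∘ suc))
  where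
  lem : ∀ a b c d → a ℕ.+ b ℕ.+ (c ℕ.+ d) ≡ a ℕ.+ c ℕ.+ (b ℕ.+ d)
  lem = solve-∀ℕ
weigh-+ (false ∷ X) h h′ = weigh-+ X (h ∘ suc) (h′ ∘ suc)

weigh-0 : ∀ {m} (X : Subset m) → weigh X (λ _ → 0) ≡ 0
weigh-0 [] = refl
weigh-0 (true ∷ X) = weigh-0 X
weigh-0 (false ∷ X) = weigh-0 X

weigh-1 : ∀ {m} (X : Subset m) → weigh X (λ _ → 1) ≡ ∣ X ∣
weigh-1 [] = refl
weigh-1 (true ∷ X) = cong suc (weigh-1 X)
weigh-1 (false ∷ X) = weigh-1 X

at : ℕ → ℕ → ℕ
at j i = if i ≡ᵇ j then 1 else 0

weigh-at : ∀ {m} (X : Subset m) (j : Fin m) → weigh X (at (toℕ j)) ≡ 𝟙 (lookup X j)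
weigh-at (true ∷ X) zero = cong suc (weigh-0 X)
weigh-at (false ∷ X) zero = weigh-0 X
weigh-at (true ∷ X) (suc j) = weigh-at X j
weigh-at (false ∷ X) (suc j) = weigh-at X j

weigh-∷ʳ : ∀ {m} (X : Subset m) x h → weigh (X ∷ʳ x) h ≡ weigh X h ℕ.+ (if x then h m else 0)
weigh-∷ʳ [] x h = ℕP.+-identityʳ _
weigh-∷ʳ (y ∷ X) x h = trans (cong ((if y then h 0 else 0) ℕ.+_) (weigh-∷ʳ X x (h ∘ suc)))
    (sym (ℕP.+-assoc (if y then h 0 else 0) _ _))

rimEnd : ℕ → ℕ → ℕ
rimEnd m i = if suc i ≡ᵇ m then 1 else suc (suc i)

≡ᵇ-refl : ∀ n → (n ≡ᵇ n) ≡ true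
≡ᵇ-refl n = ≡⇒≡ᵇ {n} refl

-- In `rot P` the entry of the first rim vertex stands last, exactly where `rimEnd` returns to 1.
weigh-next : ∀ {m} (P : Subset m) (j : Fin m) → weigh (rot P) (λ i → if rimEnd m i ≡ᵇ suc (toℕ j) then 1 else 0) ≡ 𝟙 (lookup P j)
weigh-next {suc m} (p ∷ P) j = trans (weigh-∷ʳ P p (λ i → if rimEnd (suc m) i ≡ᵇ suc (toℕ j) then 1 else 0)) (trans (cong₂ ℕ._+_
    (weigh-cong P (λ i → if rimEnd (suc m) i ≡ᵇ suc (toℕ j) then 1 else 0) (λ i → if suc i ≡ᵇ toℕ j then 1 else 0)
        (λ i → cong (λ b → if (if b then 1 else suc (suc (toℕ i))) ≡ᵇ suc (toℕ j) then 1 else 0) (notLast i)))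
    (cong (λ b → if p then (if (if b then 1 else suc (suc m)) ≡ᵇ suc (toℕ j) then 1 else 0) else 0) (≡ᵇ-refl m))) (go p j))
  where
  notLast : ∀ (i : Fin m) → (toℕ i ≡ᵇ m) ≡ false
  notLast i = bool-ext {b = false} (λ h → ⊥-elim (ℕP.<⇒≢ (FP.toℕ<n i) (≡ᵇ⇒≡ {toℕ i} h))) (λ ())
  go : ∀ p j → weigh P (λ i → if suc i ≡ᵇ toℕ j then 1 else 0) ℕ.+ (if p then (if 0 ≡ᵇ toℕ j then 1 else 0) else 0) ≡ 𝟙
      (lookup (p ∷ P) j)
  go true zero rewrite weigh-0 P = refl
  go false zero rewrite weigh-0 P = refl
  go true (suc j) = trans (ℕP.+-identityʳ _) (weigh-at P j)
  go false (suc j) = trans (ℕP.+-identityʳ _) (weigh-at P j)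

sum-split : ∀ m {n} (f : Fin (m ℕ.+ n) → ℕ) → V.sum (tabulate f) ≡ V.sum (tabulate (λ i → f (i ↑ˡ n))) ℕ.+ V.sum
    (tabulate (λ i → f (m ↑ʳ i)))
sum-split zero f = refl
sum-split (suc m) f = trans (cong (f zero ℕ.+_) (sum-split m (f ∘ suc))) (sym (ℕP.+-assoc (f zero) _ _))

sum-cong : ∀ {m} {f g : Fin m → ℕ} → (∀ i → f i ≡ g i) → V.sum (tabulate f) ≡ V.sum (tabulate g)
sum-cong h = cong V.sum (VP.tabulate-cong h)

degree-wheel : ∀ {m} (A R : Subset m) v → degree (wheel m) (A V.++ R) v ≡
  weigh A (λ i → (if 0 ≡ᵇ v then 1 else 0) ℕ.+ (if suc i ≡ᵇ v then 1 else 0)) ℕ.+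
  weigh R (λ i → (if suc i ≡ᵇ v then 1 else 0) ℕ.+ (if rimEnd m i ≡ᵇ v then 1 else 0))
degree-wheel {m} A R v = trans (sum-split m _) (cong₂ ℕ._+_
  (sum-cong λ i → cong₂ incidence (VP.lookup-++ˡ A R i) (ends-spoke i))
  (sum-cong λ i → cong₂ incidence (VP.lookup-++ʳ A R i) (ends-rim i)))
  where
  ends-spoke : ∀ (i : Fin m) → ends (wheel m) (i ↑ˡ m) ≡ (0 , suc (toℕ i))
  ends-spoke i rewrite FP.toℕ-↑ˡ i m | <⇒<ᵇ (FP.toℕ<n i) = refl
  ends-rim : ∀ (i : Fin m) → ends (wheel m) (m ↑ʳ i) ≡ (suc (toℕ i) , rimEnd m (toℕ i))
  ends-rim i rewrite FP.toℕ-↑ʳ m i | bool-ext {m ℕ.+ toℕ i <ᵇ m} {false}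
      (λ h → ⊥-elim (ℕP.<⇒≱ (<ᵇ⇒< {m ℕ.+ toℕ i} h) (ℕP.m≤m+n m _))) (λ ())
    | ℕP.m+n∸m≡n m (toℕ i) = refl
  incidence : Bool → ℕ × ℕ → ℕ
  incidence b e = if b then (if proj₁ e ≡ᵇ v then 1 else 0) ℕ.+ (if proj₂ e ≡ᵇ v then 1 else 0) else 0

degree-hub : ∀ {m} (A R : Subset m) → degree (wheel m) (A V.++ R) 0 ≡ ∣ A ∣
degree-hub {m} A R = trans (degree-wheel A R 0) (trans (cong₂ ℕ._+_ (weigh-1 A)
  (trans (weigh-cong R (λ i → if rimEnd m i ≡ᵇ 0 then 1 else 0) (λ _ → 0) (λ i → pos (suc (toℕ i) ≡ᵇ m) (toℕ i)))
      (weigh-0 R))) (ℕP.+-identityʳ _))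
  where
  pos : ∀ b i → (if (if b then 1 else suc (suc i)) ≡ᵇ 0 then 1 else 0) ≡ 0
  pos true i = refl
  pos false i = refl

degree-vertex : ∀ {m} (A R : Subset m) (j : Fin m) → degree (wheel m) (A V.++ R) (suc (toℕ j)) ≡ deg (lookup A j)
    (lookup R j) (lookup (prv R) j)
degree-vertex {m} A R j = trans (degree-wheel A R (suc (toℕ j))) (cong₂ ℕ._+_ (weigh-at A j)
  (trans (weigh-+ R (at (toℕ j)) (λ i → if rimEnd m i ≡ᵇ suc (toℕ j) then 1 else 0)) (cong₂ ℕ._+_ (weigh-at R j)
    (trans (cong (λ Z → weigh Z (λ i → if rimEnd m i ≡ᵇ suc (toℕ j) then 1 else 0)) (sym (rot-prv R))) (weigh-next (prv R) j)))))

all-applyUpTo⁻ : ∀ {A : Set} (p : A → Bool) n (f : ℕ → A) → all p (L.applyUpTo f n) ≡ true → ∀ (i : Fin n) → p (f (toℕ i)) ≡ true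
all-applyUpTo⁻ p (suc n) f e zero = proj₁ (∧-true {p (f 0)} e)
all-applyUpTo⁻ p (suc n) f e (suc i) = all-applyUpTo⁻ p n (f ∘ suc) (proj₂ (∧-true {p (f 0)} e)) i

all-applyUpTo⁺ : ∀ {A : Set} (p : A → Bool) n (f : ℕ → A) → (∀ (i : Fin n) → p (f (toℕ i)) ≡ true) → all p (L.applyUpTo f n)
    ≡ true
all-applyUpTo⁺ p zero f h = refl
all-applyUpTo⁺ p (suc n) f h = cong₂ _∧_ (h zero) (all-applyUpTo⁺ p n (f ∘ suc) (h ∘ suc))

∣++∣ : ∀ {m n} (A : Subset m) (R : Subset n) → ∣ A V.++ R ∣ ≡ ∣ A ∣ ℕ.+ ∣ R ∣
∣++∣ {m} A R = trans (∣∣-++ m (A V.++ R)) (cong₂ (λ x y → ∣ x ∣ ℕ.+ ∣ y ∣) (take-++ A R) (drop-++ A R))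

cycles⁻ : ∀ {m} (A R : Subset m) → cyclesᵇ (wheel m) (A V.++ R) ≡ true → IsCycles A R
cycles⁻ {m} A R h = let (h₀ , h₁) = ∧-true {0 <ᵇ ∣ A V.++ R ∣} h
                        h₂ = all-applyUpTo⁻ _ (suc m) id h₁ in record
  { nonempty = subst (0 <_) (∣++∣ A R) (<ᵇ⇒< {0} h₀)
  ; hub = trans (cong even (sym (degree-hub A R))) (h₂ zero)
  ; vertices = λ j → trans (cong even (sym (degree-vertex A R j))) (h₂ (suc j)) }

cycles⁺ : ∀ {m} (A R : Subset m) → IsCycles A R → cyclesᵇ (wheel m) (A V.++ R) ≡ true
cycles⁺ {m} A R c = cong₂ _∧_ (<⇒<ᵇ (subst (0 <_) (sym (∣++∣ A R)) nonempty))
  (all-applyUpTo⁺ (λ v → even (degree (wheel m) (A V.++ R) v)) (suc m) id λ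
    { zero → trans (cong even (degree-hub A R)) hub ; (suc j) → trans (cong even (degree-vertex A R j)) (vertices j) })
  where open IsCycles c

any⁻ : ∀ {A : Set} (p : A → Bool) xs → any p xs ≡ true → ∃ λ x → x ∈ˡ xs × p x ≡ true
any⁻ p (x ∷ xs) e with p x in eq
... | true = x , here refl , eq
... | false = let (y , q , h) = any⁻ p xs e in y , there q , h

any⁺ : ∀ {A : Set} (p : A → Bool) {xs x} → x ∈ˡ xs → p x ≡ true → any p xs ≡ true
any⁺ p (here refl) h rewrite h = refl
any⁺ p {y ∷ xs} (there q) h with p y
... | true = refl
... | false = any⁺ p q h

∈-filterᵇ⁻ : ∀ {A : Set} (p : A → Bool) xs {x} → x ∈ˡ filterᵇ p xs → p x ≡ true × x ∈ˡ xs
∈-filterᵇ⁻ p (y ∷ xs) q with p y in eq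
∈-filterᵇ⁻ p (y ∷ xs) (here refl) | true = eq , here refl
∈-filterᵇ⁻ p (y ∷ xs) (there q) | true = let (h , r) = ∈-filterᵇ⁻ p xs q in h , there r
∈-filterᵇ⁻ p (y ∷ xs) q | false = let (h , r) = ∈-filterᵇ⁻ p xs q in h , there r

∈-filterᵇ⁺ : ∀ {A : Set} (p : A → Bool) {xs x} → x ∈ˡ xs → p x ≡ true → x ∈ˡ filterᵇ p xs
∈-filterᵇ⁺ p (here refl) h rewrite h = here refl
∈-filterᵇ⁺ p {y ∷ xs} (there q) h with p y
... | true = there (∈-filterᵇ⁺ p q h)
... | false = ∈-filterᵇ⁺ p q h

rim-++ : ∀ m → rim m ≡ ⊥ {m} V.++ ⊤
rim-++ m = trans (split m (λ j → m ≤ᵇ toℕ j)) (cong₂ V._++_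
   (trans (VP.tabulate-cong (λ i → bool-ext {b = false}
       (λ h → ⊥-elim (ℕP.<⇒≱ (FP.toℕ<n i) (subst (m ≤_) (FP.toℕ-↑ˡ i m) (≤ᵇ⇒≤ {m} h)))) (λ ()))) (const m false))
   (trans (VP.tabulate-cong (λ i → ≤⇒≤ᵇ (subst (m ≤_) (sym (FP.toℕ-↑ʳ m i)) (ℕP.m≤m+n m _)))) (const m true)))
  where
  split : ∀ k {l} (f : Fin (k ℕ.+ l) → Bool) → tabulate f ≡ tabulate (λ i → f (i ↑ˡ l)) V.++ tabulate (λ i → f (k ↑ʳ i))
  split zero f = refl
  split (suc k) f = cong (f zero ∷_) (split k (f ∘ suc))
  const : ∀ k (b : Bool) → tabulate {n = k} (λ _ → b) ≡ V.replicate k b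
  const zero b = refl
  const (suc k) b = cong (b ∷_) (const k b)

-- Independence in the whirl as a Hall condition

indep : ∀ m → Subset (m ℕ.+ m) → Bool
indep m X = isForestᵇ (wheel m) X ∨ (X ==ᵇ rim m)

⊑-++⁺ : ∀ {m n} {A A′ : Subset m} {R R′ : Subset n} → A ⊑ A′ → R ⊑ R′ → (A V.++ R) ⊑ (A′ V.++ R′)
⊑-++⁺ [] t = t
⊑-++⁺ (keep b s) t = keep b (⊑-++⁺ s t)
⊑-++⁺ (add s) t = add (⊑-++⁺ s t)

-- A spoke distinguishes the set from the rim, which is a cycle but is declared independent.
cycle-dependent : ∀ {m} (A R : Subset m) → HasCycles A R → 0 < ∣ A ∣ → indep m (A V.++ R) ≡ false
cycle-dependent {m} A R (A′ , R′ , A′⊑ , R′⊑ , c) spoke = cong₂ _∨_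
  (cong not (any⁺ (cyclesᵇ (wheel m)) (∈-filterᵇ⁺ (_⊆ᵇ (A V.++ R)) (∈-subsets (A′ V.++ R′)) (⊆⇒⊆ᵇ (⊑⇒⊆ (⊑-++⁺ A′⊑ R′⊑))))
      (cycles⁺ A′ R′ c)))
  (bool-ext {b = false} (λ h → ⊥-elim (ℕP.<⇒≢ spoke (sym (trans (cong ∣_∣ (trans (sym (take-++ A R))
     (trans (cong (V.take m) (trans (==ᵇ⇒≡ {X = A V.++ R} h) (rim-++ m))) (take-++ (⊥ {m}) (⊤ {m}))))) (∣⊥∣≡0 m))))) (λ ()))

-- Every element is either charged or supported on `S`. Hence ∣A∣ + ∣R∣ ≤ cost is the Hall condition
-- that `S` support no more elements than it has vertices.
supported : ∀ {m} → (A R S S′ : Subset m) → cost A R S S′ ℕ.+ (∣ A ∩ S ∣ ℕ.+ ∣ R ∩ (S ∩ S′) ∣) ≡ ∣ S ∣ ℕ.+ (∣ A ∣ ℕ.+ ∣ R ∣)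
supported [] [] [] [] = refl
supported (a ∷ A) (r ∷ R) (s ∷ S) (s′ ∷ S′)
  rewrite card-∷ a A | card-∷ r R | card-∷ s S | card-∷ (a ∧ s) (A ∩ S) | card-∷ (r ∧ (s ∧ s′)) (R ∩ (S ∩ S′)) =
  trans (lem (term a r s s′) _ (𝟙 (a ∧ s)) (∣ A ∩ S ∣) (𝟙 (r ∧ (s ∧ s′))) (∣ R ∩ (S ∩ S′) ∣))
    (trans (cong₂ ℕ._+_ (≡ᵇ⇒≡ {term a r s s′ ℕ.+ (𝟙 (a ∧ s) ℕ.+ 𝟙 (r ∧ (s ∧ s′)))} {𝟙 s ℕ.+ (𝟙 a ℕ.+ 𝟙 r)}
        (tauto 4 (λ { (a ∷ r ∷ s ∷ s′ ∷ []) →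
        term a r s s′ ℕ.+ (𝟙 (a ∧ s) ℕ.+ 𝟙 (r ∧ (s ∧ s′))) ≡ᵇ 𝟙 s ℕ.+ (𝟙 a ℕ.+ 𝟙 r) }) refl (a ∷ r ∷ s ∷ s′ ∷ [])))
            (supported A R S S′))
      (sym (lem (𝟙 s) (∣ S ∣) (𝟙 a) (∣ A ∣) (𝟙 r) (∣ R ∣))))
  where
  lem : ∀ t c x X y Y → t ℕ.+ c ℕ.+ (x ℕ.+ X ℕ.+ (y ℕ.+ Y)) ≡ (t ℕ.+ (x ℕ.+ y)) ℕ.+ (c ℕ.+ (X ℕ.+ Y))
  lem = solve-∀ℕ

indep⇒hall : ∀ {m} (A R : Subset (suc m)) → indep (suc m) (A V.++ R) ≡ true → ∀ S → ∣ A ∣ ℕ.+ ∣ R ∣ ≤ cost A R S (rot S)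
indep⇒hall {m} A R ind S = ℕP.≮⇒≥ λ lt → true≢false (trans (sym ind) (dep lt))
  where
  A₁ = A ∩ S
  R₁ = R ∩ (S ∩ rot S)
  dep : cost A R S (rot S) < ∣ A ∣ ℕ.+ ∣ R ∣ → indep (suc m) (A V.++ R) ≡ false
  dep lt = cycle-dependent A R (HasCycles-mono A₁⊑A (⊆⇒⊑ (p∩q⊆p R _)) (crowded-cycles _ A₁ R₁ S v ℕP.≤-refl))
     (ℕP.≤-trans (crowded-spoke v) (∣⊑∣ A₁⊑A))
    where
    A₁⊑A : A₁ ⊑ A
    A₁⊑A = ⊆⇒⊑ (p∩q⊆p A S)
    v : Crowded A₁ R₁ S
    v = record { A⊑S = ⊆⇒⊑ (p∩q⊆q A S)
      ; R⊑S = ⊆⇒⊑ (⊆-trans (p∩q⊆q R (S ∩ rot S)) (p∩q⊆p S (rot S)))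
      ; R⊑rotS = ⊆⇒⊑ (⊆-trans (p∩q⊆q R (S ∩ rot S)) (p∩q⊆q S (rot S)))
      ; crowd = ℕP.+-cancelʳ-≤ (∣ A ∣ ℕ.+ ∣ R ∣) (suc ∣ S ∣) (∣ A₁ ∣ ℕ.+ ∣ R₁ ∣)
          (subst₂ _≤_ (cong suc (supported A R S (rot S))) (ℕP.+-comm (∣ A ∣ ℕ.+ ∣ R ∣) _)
              (ℕP.+-monoˡ-≤ (∣ A₁ ∣ ℕ.+ ∣ R₁ ∣) lt)) }

even⁻ : ∀ {d} → even d ≡ true → d ≡ 0 ⊎ d ≡ 2
even⁻ {0} e = inj₁ refl
even⁻ {2} e = inj₂ refl

two : Bool → Bool → Bool → Bool
two a r p = deg a r p ≡ᵇ 2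

twos : ∀ {m} → (A R P : Subset m) → Subset m
twos [] [] [] = []
twos (a ∷ A) (r ∷ R) (p ∷ P) = two a r p ∷ twos A R P

cycles⇒not-hall : ∀ {m} {A R A′ R′ : Subset m} → A′ ⊑ A → R′ ⊑ R → IsCycles A′ R′ → ¬ (A ≡ ⊥ × R ≡ ⊤) →
  ∃ λ S → cost A R S (rot S) < ∣ A ∣ ℕ.+ ∣ R ∣
cycles⇒not-hall {m} {A} {R} {A′} {R′} A⊑ R⊑ c ≢rim with even⁻ {∣ A′ ∣} (IsCycles.hub c)
-- `S` consists of the vertices of degree two. The degree sum 2∣S∣ = 2 + 2∣R′∣ shows that it
-- supports ∣S∣ + 1 elements.
... | inj₂ ∣A′∣≡2 = S , ℕP.+-cancelʳ-≤ (∣ A₁ ∣ ℕ.+ ∣ R₁ ∣) _ _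
    (subst₂ _≤_ (cong suc (sym (supported A R S (rot S)))) (ℕP.+-comm (∣ A₁ ∣ ℕ.+ ∣ R₁ ∣) _)
      (ℕP.+-monoˡ-≤ (∣ A ∣ ℕ.+ ∣ R ∣) (ℕP.≤-trans (ℕP.≤-reflexive S≡) (ℕP.+-mono-≤ (∣⊑∣ A′⊑A₁) (∣⊑∣ R′⊑R₁)))))
  where
  P′ = prv R′
  S = twos A′ R′ P′
  A₁ = A ∩ S
  R₁ = R ∩ (S ∩ rot S)
  sub : ∀ {k} (A R P : Subset k) → (∀ j → even (deg (lookup A j) (lookup R j) (lookup P j)) ≡ true) →
    A ⊑ twos A R P × R ⊑ twos A R P × P ⊑ twos A R P × degs A R P ≡ 2 ℕ.* ∣ twos A R P ∣
  sub [] [] [] h = [] , [] , [] , refl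
  sub (a ∷ A) (r ∷ R) (p ∷ P) h with sub A R P (h ∘ suc)
  ... | x , y , z , e = ⊑-cons (imp (λ { (a ∷ r ∷ p ∷ []) → a }) refl) x , ⊑-cons (imp (λ { (a ∷ r ∷ p ∷ []) → r }) refl) y ,
      ⊑-cons (imp (λ { (a ∷ r ∷ p ∷ []) → p }) refl) z ,
      trans (cong₂ ℕ._+_ (≡ᵇ⇒≡ {deg a r p} {2 ℕ.* 𝟙 (two a r p)}
          (implies (tauto 3 (λ { (a ∷ r ∷ p ∷ []) → not (even (deg a r p)) ∨ (deg a r p ≡ᵇ 2 ℕ.* 𝟙 (two a r p)) }) refl
          (a ∷ r ∷ p ∷ [])) (h zero))) e)
        (trans (sym (ℕP.*-distribˡ-+ 2 (𝟙 (two a r p)) _)) (cong (2 ℕ.*_) (sym (card-∷ (two a r p) (twos A R P)))))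
    where
    imp : ∀ (f : Vec Bool 3 → Bool) → allBools 3 (λ { v@(a ∷ r ∷ p ∷ []) → not (even (deg a r p)) ∨ (not (f v) ∨ two a r p)
        }) ≡ true →
      (not (f (a ∷ r ∷ p ∷ [])) ∨ two a r p) ≡ true
    imp f e = implies (tauto 3 (λ { v@(a ∷ r ∷ p ∷ []) → not (even (deg a r p)) ∨ (not (f v) ∨ two a r p) }) e
        (a ∷ r ∷ p ∷ [])) (h zero)
  facts = sub A′ R′ P′ (IsCycles.vertices c)
  A′⊑A₁ : A′ ⊑ A₁
  A′⊑A₁ = ⊆⇒⊑ λ p → x∈p∩q⁺ (⊑⇒⊆ A⊑ p , ⊑⇒⊆ (proj₁ facts) p)
  R′⊑rotS : R′ ⊑ rot S
  R′⊑rotS = subst (_⊑ rot S) (rot-prv R′) (⊑-rot (proj₁ (proj₂ (proj₂ facts))))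
  R′⊑R₁ : R′ ⊑ R₁
  R′⊑R₁ = ⊆⇒⊑ λ p → x∈p∩q⁺ (⊑⇒⊆ R⊑ p , x∈p∩q⁺ (⊑⇒⊆ (proj₁ (proj₂ facts)) p , ⊑⇒⊆ R′⊑rotS p))
  S≡ : suc ∣ S ∣ ≡ ∣ A′ ∣ ℕ.+ ∣ R′ ∣
  S≡ = ℕP.*-cancelˡ-≡ (suc ∣ S ∣) (∣ A′ ∣ ℕ.+ ∣ R′ ∣) 2 (trans (ℕP.*-suc 2 (∣ S ∣)) (trans (cong (2 ℕ.+_)
     (trans (sym (proj₂ (proj₂ (proj₂ facts)))) (trans (degs-sum A′ R′ P′)
         (cong₂ (λ x y → x ℕ.+ (∣ R′ ∣ ℕ.+ y)) ∣A′∣≡2 (∣prv∣ R′)))))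
     (trans (lem (∣ R′ ∣)) (cong (λ z → 2 ℕ.* (z ℕ.+ ∣ R′ ∣)) (sym ∣A′∣≡2)))))
    where
    lem : ∀ r → 2 ℕ.+ (2 ℕ.+ (r ℕ.+ r)) ≡ 2 ℕ.* (2 ℕ.+ r)
    lem = solve-∀ℕ
-- A cycle avoiding the hub is the whole rim. As the set is not just the rim, it also has a spoke,
-- so the cover by all m vertices is cheaper than the number of elements.
... | inj₁ ∣A′∣≡0 = ⊤ , subst (_< ∣ A ∣ ℕ.+ ∣ R ∣) (sym (trans (cong (cost A R ⊤) (rot-replicate m true)) (cost-on-⊤ A R)))
      (subst₂ (λ x y → x < ∣ A ∣ ℕ.+ ∣ y ∣) (∣⊤∣≡n m) (sym R≡⊤) (ℕP.m<n+m ∣ ⊤ {m} ∣ A>0))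
  where
  closed : R′ ⊑ rot R′
  closed = subst (_⊑ rot R′) (rot-prv R′) (⊑-rot (⊑-lookup {X = prv R′} {R′} λ j → go j (lookup A′ j)
      (trans (cong (λ Z → lookup Z j) (∣∣≡0⇒⊥ A′ ∣A′∣≡0)) (lookup-⊥ j)) (IsCycles.vertices c j)))
    where
    go : ∀ j a → a ≡ false → even (deg a (lookup R′ j) (lookup (prv R′) j)) ≡ true → (not (lookup (prv R′) j) ∨ lookup R′ j)
        ≡ true
    go j .false refl h with lookup R′ j | lookup (prv R′) j
    ... | true | true = refl
    ... | true | false = refl
    ... | false | false = refl
  R≡⊤ : R ≡ ⊤
  R≡⊤ with ⊑-rot-constant R′ closed
  ... | inj₁ e = ⊤⊑⇒≡ (subst (_⊑ R) e R⊑)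
  ... | inj₂ e = ⊥-elim (ℕP.<⇒≢ (IsCycles.nonempty c) (sym (cong₂ ℕ._+_ ∣A′∣≡0 (trans (cong ∣_∣ e) (∣⊥∣≡0 m)))))
  A>0 : 0 < ∣ A ∣
  A>0 = ℕP.n≢0⇒n>0 λ e → ≢rim (∣∣≡0⇒⊥ A e , R≡⊤)

hall⇒indep : ∀ {m} (A R : Subset m) → (∀ S → ∣ A ∣ ℕ.+ ∣ R ∣ ≤ cost A R S (rot S)) → indep m (A V.++ R) ≡ true
hall⇒indep {m} A R hall with (A V.++ R) ==ᵇ rim m in eqRim
... | true = ∨-zeroʳ _
... | false with any (cyclesᵇ (wheel m)) (subsetsOf (A V.++ R)) in eqAny
... | false = refl
... | true with any⁻ (cyclesᵇ (wheel m)) (subsetsOf (A V.++ R)) eqAny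
... | C , C∈ , cyc = ⊥-elim (ℕP.<⇒≱ (proj₂ bad) (hall (proj₁ bad)))
  where
  C⊑ : C ⊑ (A V.++ R)
  C⊑ = ⊆⇒⊑ (⊆ᵇ⇒⊆ (proj₁ (∈-filterᵇ⁻ (_⊆ᵇ (A V.++ R)) (subsets (m ℕ.+ m)) C∈)))
  bad = cycles⇒not-hall (subst (V.take m C ⊑_) (take-++ A R) (⊑-take m C⊑)) (subst (V.drop m C ⊑_) (drop-++ A R) (⊑-drop m C⊑))
    (cycles⁻ (V.take m C) (V.drop m C) (trans (cong (cyclesᵇ (wheel m)) (VP.take++drop≡id m C)) cyc))
    λ { (refl , refl) → true≢false (trans (sym (trans (cong ((⊥ {m} V.++ ⊤ {m}) ==ᵇ_) (rim-++ m))
        (==ᵇ-refl (⊥ {m} V.++ ⊤ {m})))) eqRim) }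

-- Recovering a rank function from its independent sets

module Basis {m} (r : Subset m → ℕ) (mat : IsMatroid (rmat m ⊤ r)) where

  open IsMatroid mat
  open Contraction r mat using (mono; r⊥; subadd)

  ∣∪⁅⁆∣ : ∀ {k} (X : Subset k) x → ∣ X ∪ ⁅ x ⁆ ∣ ≤ suc ∣ X ∣
  ∣∪⁅⁆∣ (true ∷ X) zero = ℕP.≤-trans (ℕP.≤-reflexive (cong (suc ∘ ∣_∣) (∪-identityʳ X))) (ℕP.n≤1+n _)
  ∣∪⁅⁆∣ (false ∷ X) zero = ℕP.≤-reflexive (cong (suc ∘ ∣_∣) (∪-identityʳ X))
  ∣∪⁅⁆∣ (true ∷ X) (suc x) = s≤s (∣∪⁅⁆∣ X x)
  ∣∪⁅⁆∣ (false ∷ X) (suc x) = ∣∪⁅⁆∣ X x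

  -- Greedy choice: a basis `I` of `X - x` is enlarged by `x` if this raises its rank. If not,
  -- submodularity at `X - x` and `I ∪ ⁅ x ⁆` shows that `x` does not raise the rank of `X - x`
  -- either.
  basis : ∀ n X → ∣ X ∣ ≤ n → ∃ λ I → I ⊆ X × r I ≡ ∣ I ∣ × r I ≡ r X
  basis n X le with nonempty? X
  ... | no empty = X , ⊆-refl , trans (trans (cong r X≡⊥) r⊥) (sym (trans (cong ∣_∣ X≡⊥) (∣⊥∣≡0 m))) , refl
    where X≡⊥ = Empty-unique {p = X} empty
  basis zero X le | yes (x , x∈X) = ⊥-elim (ℕP.<⇒≱ (x∈p⇒∣p-x∣<∣p∣ x∈X) (ℕP.≤-trans le z≤n))
  basis (suc n) X le | yes (x , x∈X) with basis n (X - x) (ℕP.≤-pred (ℕP.≤-trans (x∈p⇒∣p-x∣<∣p∣ x∈X) le))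
  ... | I , I⊆ , rI≡∣I∣ , rI≡ with suc (r I) ℕP.≤? r (I ∪ ⁅ x ⁆)
  ... | yes gain = I⁺ , I⁺⊆X , ℕP.≤-antisym (rk-bound I⁺ ⊆⊤) ∣I⁺∣≤ , ℕP.≤-antisym (mono I⁺⊆X) rX≤
    where
    I⁺ = I ∪ ⁅ x ⁆
    I⊆X : I ⊆ X
    I⊆X p = p─q⊆p X ⁅ x ⁆ (I⊆ p)
    I⁺⊆X : I⁺ ⊆ X
    I⁺⊆X p with x∈p∪q⁻ I ⁅ x ⁆ p
    ... | inj₁ q = I⊆X q
    ... | inj₂ q = subst (_∈ X) (sym (x∈⁅y⁆⇒x≡y x q)) x∈X
    ∣I⁺∣≤ : ∣ I⁺ ∣ ≤ r I⁺
    ∣I⁺∣≤ = ℕP.≤-trans (∣∪⁅⁆∣ I x) (subst (λ z → suc z ≤ r I⁺) rI≡∣I∣ gain)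
    X⊆ : X ⊆ (X - x) ∪ ⁅ x ⁆
    X⊆ {y} p with y FP.≟ x
    ... | yes refl = q⊆p∪q (X - x) ⁅ x ⁆ (x∈⁅x⁆ x)
    ... | no y≢x = p⊆p∪q ⁅ x ⁆ (x∈p∧x≢y⇒x∈p-y p y≢x)
    rX≤ : r X ≤ r I⁺
    rX≤ = ℕP.≤-trans (mono X⊆) (ℕP.≤-trans (subadd (X - x) ⁅ x ⁆)
      (ℕP.≤-trans (ℕP.+-mono-≤ (ℕP.≤-reflexive (sym rI≡)) (ℕP.≤-trans (rk-bound ⁅ x ⁆ ⊆⊤) (ℕP.≤-reflexive (∣⁅x⁆∣≡1 x))))
        (subst (_≤ r I⁺) (ℕP.+-comm 1 (r I)) gain)))
  ... | no noGain = I , (λ p → p─q⊆p X ⁅ x ⁆ (I⊆ p)) , rI≡∣I∣ , ℕP.≤-antisym (mono (λ p → p─q⊆p X ⁅ x ⁆ (I⊆ p))) rX≤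
    where
    Y = X - x
    I⁺ = I ∪ ⁅ x ⁆
    X⊆ : X ⊆ Y ∪ I⁺
    X⊆ {y} p with y FP.≟ x
    ... | yes refl = q⊆p∪q Y I⁺ (q⊆p∪q I ⁅ x ⁆ (x∈⁅x⁆ x))
    ... | no y≢x = p⊆p∪q I⁺ (x∈p∧x≢y⇒x∈p-y p y≢x)
    rX≤ : r X ≤ r I
    rX≤ = ℕP.≤-trans (mono X⊆) (ℕP.+-cancelʳ-≤ (r I) _ _ (ℕP.≤-trans
      (ℕP.+-monoʳ-≤ (r (Y ∪ I⁺)) (mono {I} {Y ∩ I⁺} λ p → x∈p∩q⁺ (I⊆ p , p⊆p∪q ⁅ x ⁆ p)))
      (ℕP.≤-trans (rk-submod Y I⁺ ⊆⊤ ⊆⊤) (ℕP.+-mono-≤ (ℕP.≤-reflexive (sym rI≡)) (ℕP.≤-pred (ℕP.≰⇒> noGain))))))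

maxℕ-≤ : ∀ {A : Set} (f : A → ℕ) xs {k} → (∀ {x} → x ∈ˡ xs → f x ≤ k) → maxℕ (L.map f xs) ≤ k
maxℕ-≤ f [] h = z≤n
maxℕ-≤ f (x ∷ xs) h = ℕP.⊔-lub (h (here refl)) (maxℕ-≤ f xs (h ∘ there))

≤-maxℕ : ∀ {A : Set} (f : A → ℕ) {xs x} → x ∈ˡ xs → f x ≤ maxℕ (L.map f xs)
≤-maxℕ f (here refl) = ℕP.m≤m⊔n _ _
≤-maxℕ f {y ∷ xs} (there q) = ℕP.≤-trans (≤-maxℕ f q) (ℕP.m≤n⊔m (f y) _)

fromIndep-rank : ∀ {m} (ind : Subset m → Bool) (r : Subset m → ℕ) → IsMatroid (rmat m ⊤ r) →
  (∀ I → ind I ≡ true → ∣ I ∣ ≤ r I) → (∀ I → r I ≡ ∣ I ∣ → ind I ≡ true) → ∀ X → rk (fromIndep m ind) X ≡ r X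
fromIndep-rank {m} ind r mat sound complete X = ℕP.≤-antisym
  (maxℕ-≤ ∣_∣ (filterᵇ ind (subsetsOf X)) λ {I} I∈ → let (h , I∈′) = ∈-filterᵇ⁻ ind (subsetsOf X) I∈
     in ℕP.≤-trans (sound I h) (IsMatroid.rk-mono mat I X ⊆⊤ (⊆ᵇ⇒⊆ (proj₁ (∈-filterᵇ⁻ (_⊆ᵇ X) (subsets m) I∈′)))))
  lower
  where
  lower : r X ≤ rk (fromIndep m ind) X
  lower with Basis.basis r mat (∣ X ∣) X ℕP.≤-refl
  ... | I , I⊆X , rI , rI≡ = subst (_≤ rk (fromIndep m ind) X) (trans (sym rI) rI≡)
        (≤-maxℕ ∣_∣ (∈-filterᵇ⁺ ind (∈-filterᵇ⁺ (_⊆ᵇ X) (∈-subsets I) (⊆⇒⊆ᵇ I⊆X)) (complete I rI)))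

whirl-rank : ∀ m X → rk (fromIndep (suc m ℕ.+ suc m) (indep (suc m))) X ≡ wrank (suc m) X
whirl-rank m = fromIndep-rank (indep (suc m)) (wrank (suc m)) (wrank-matroid (suc m))
  (λ I h → subst (_≤ wrank (suc m) I) (sym (∣∣-++ (suc m) I)) (bounded I h))
  (λ I rI → trans (cong (indep (suc m)) (sym (VP.take++drop≡id (suc m) I))) (hall⇒indep (V.take (suc m) I) (V.drop (suc m) I)
    (λ S → ℕP.≤-trans (ℕP.≤-reflexive (trans (sym (∣∣-++ (suc m) I)) (sym rI))) (wrank-≤ (suc m) I S))))
  where
  bounded : ∀ I → indep (suc m) I ≡ true → ∣ V.take (suc m) I ∣ ℕ.+ ∣ V.drop (suc m) I ∣ ≤ wrank (suc m) I
  bounded I h with rankAR-isRank (V.take (suc m) I) (V.drop (suc m) I)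
  ... | _ , S , eq = subst (∣ V.take (suc m) I ∣ ℕ.+ ∣ V.drop (suc m) I ∣ ≤_) eq
    (indep⇒hall (V.take (suc m) I) (V.drop (suc m) I) (trans (cong (indep (suc m)) (VP.take++drop≡id (suc m) I)) h) S)

-- Power series

-- Used twice, over ℤ for series in t and over the result for series in u: coefficient functions
-- carry no bound on the degree, so polynomials in t are treated as series. The product recurses on
-- its first factor, which makes the ring laws inductions on the index.
module PowerSeries (K : CommutativeRing 0ℓ 0ℓ) where

  open CommutativeRing K renaming (Carrier to C; refl to ≈-refl; sym to ≈-sym; trans to ≈-trans)
  open import Relation.Binary.Reasoning.Setoid setoid
  open Algebra.Solver.Ring.NaturalCoefficients.Default commutativeSemiring using (solve; _:=_; _:+_; _:*_)
  open Algebra.Properties.Semiring.Mult semiring using (×-comm-*; ×-assoc-*) renaming (_×_ to _·_; ×-congʳ to ·-cong)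
  open Algebra.Properties.CommutativeMonoid.Mult +-commutativeMonoid using () renaming (×-distrib-+ to ·-distrib-+)

  Series : Set
  Series = ℕ → C

  _≋_ : Series → Series → Set
  f ≋ g = ∀ n → f n ≈ g n

  _⊛_ : Series → Series → Series
  (f ⊛ g) zero = f 0 * g 0
  (f ⊛ g) (suc n) = f 0 * g (suc n) + ((f ∘ suc) ⊛ g) n

  _⊞_ : Series → Series → Series
  (f ⊞ g) n = f n + g n

  𝟎 𝟏 : Series
  𝟎 n = 0#
  𝟏 zero = 1#
  𝟏 (suc n) = 0#

  ⊛-cong : ∀ {f f′ g g′} → f ≋ f′ → g ≋ g′ → (f ⊛ g) ≋ (f′ ⊛ g′)
  ⊛-cong p q zero = *-cong (p 0) (q 0)
  ⊛-cong p q (suc n) = +-cong (*-cong (p 0) (q (suc n))) (⊛-cong (p ∘ suc) q n)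

  ⊛-zeroˡ : ∀ g → (𝟎 ⊛ g) ≋ 𝟎
  ⊛-zeroˡ g zero = zeroˡ (g 0)
  ⊛-zeroˡ g (suc n) = ≈-trans (+-cong (zeroˡ _) (⊛-zeroˡ g n)) (+-identityˡ 0#)

  ⊛-identityˡ : ∀ g → (𝟏 ⊛ g) ≋ g
  ⊛-identityˡ g zero = *-identityˡ (g 0)
  ⊛-identityˡ g (suc n) = ≈-trans (+-cong (*-identityˡ _) (⊛-zeroˡ g n)) (+-identityʳ _)

  ⊛-distribʳ : ∀ h f g → ((f ⊞ g) ⊛ h) ≋ ((f ⊛ h) ⊞ (g ⊛ h))
  ⊛-distribʳ h f g zero = distribʳ (h 0) (f 0) (g 0)
  ⊛-distribʳ h f g (suc n) = ≈-trans (+-cong (distribʳ (h (suc n)) (f 0) (g 0)) (⊛-distribʳ h (f ∘ suc) (g ∘ suc) n))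
    (solve 4 (λ a b c d → (a :+ b) :+ (c :+ d) := (a :+ c) :+ (b :+ d)) ≈-refl _ _ _ _)

  ⊛-scale : ∀ c f g → ((λ n → c * f n) ⊛ g) ≋ (λ n → c * (f ⊛ g) n)
  ⊛-scale c f g zero = *-assoc c (f 0) (g 0)
  ⊛-scale c f g (suc n) = ≈-trans (+-cong (*-assoc c (f 0) (g (suc n))) (⊛-scale c (f ∘ suc) g n)) (≈-sym (distribˡ c _ _))

  ⊛-last : ∀ f g n → (f ⊛ g) (suc n) ≈ (f ⊛ (g ∘ suc)) n + f (suc n) * g 0
  ⊛-last f g zero = ≈-refl
  ⊛-last f g (suc n) = ≈-trans (+-cong ≈-refl (⊛-last (f ∘ suc) g n)) (≈-sym (+-assoc _ _ _))

  ⊛-comm : ∀ f g → (f ⊛ g) ≋ (g ⊛ f)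
  ⊛-comm f g zero = *-comm (f 0) (g 0)
  ⊛-comm f g (suc n) = begin
    f 0 * g (suc n) + ((f ∘ suc) ⊛ g) n ≈⟨ +-cong (*-comm _ _) (⊛-comm (f ∘ suc) g n) ⟩
    g (suc n) * f 0 + (g ⊛ (f ∘ suc)) n ≈⟨ +-comm _ _ ⟩
    (g ⊛ (f ∘ suc)) n + g (suc n) * f 0 ≈⟨ ≈-sym (⊛-last g f n) ⟩
    (g ⊛ f) (suc n) ∎

  ⊛-assoc : ∀ f g h → ((f ⊛ g) ⊛ h) ≋ (f ⊛ (g ⊛ h))
  ⊛-assoc f g h zero = *-assoc (f 0) (g 0) (h 0)
  ⊛-assoc f g h (suc n) = begin
    f 0 * g 0 * h (suc n) + (((f ⊛ g) ∘ suc) ⊛ h) n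
      ≈⟨ +-cong ≈-refl (⊛-distribʳ h (λ i → f 0 * g (suc i)) ((f ∘ suc) ⊛ g) n) ⟩
    f 0 * g 0 * h (suc n) + (((λ i → f 0 * g (suc i)) ⊛ h) n + (((f ∘ suc) ⊛ g) ⊛ h) n)
      ≈⟨ +-cong ≈-refl (+-cong (⊛-scale (f 0) (g ∘ suc) h n) (⊛-assoc (f ∘ suc) g h n)) ⟩
    f 0 * g 0 * h (suc n) + (f 0 * ((g ∘ suc) ⊛ h) n + ((f ∘ suc) ⊛ (g ⊛ h)) n)
      ≈⟨ solve 5 (λ a b c d e → a :* b :* c :+ (a :* d :+ e) := a :* (b :* c :+ d) :+ e) ≈-refl (f 0) (g 0) (h (suc n)) _ _ ⟩
    f 0 * (g 0 * h (suc n) + ((g ∘ suc) ⊛ h) n) + ((f ∘ suc) ⊛ (g ⊛ h)) n ∎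

  seriesRing : CommutativeRing 0ℓ 0ℓ
  seriesRing = record
    { Carrier = Series ; _≈_ = _≋_ ; _+_ = _⊞_ ; _*_ = _⊛_ ; -_ = λ f n → - f n ; 0# = 𝟎 ; 1# = 𝟏
    ; isCommutativeRing = record
      { isRing = record
        { +-isAbelianGroup = record
          { isGroup = record
            { isMonoid = record
              { isSemigroup = record
                { isMagma = record
                  { isEquivalence = record { refl = λ n → ≈-refl ; sym = λ p n → ≈-sym (p n) ; trans = λ p q n → ≈-trans
                      (p n) (q n) }
                  ; ∙-cong = λ p q n → +-cong (p n) (q n) }
                ; assoc = λ f g h n → +-assoc (f n) (g n) (h n) }
              ; identity = (λ f n → +-identityˡ (f n)) , (λ f n → +-identityʳ (f n)) }
            ; inverse = (λ f n → -‿inverseˡ (f n)) , (λ f n → -‿inverseʳ (f n))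
            ; ⁻¹-cong = λ p n → -‿cong (p n) }
          ; comm = λ f g n → +-comm (f n) (g n) }
        ; *-cong = ⊛-cong
        ; *-assoc = ⊛-assoc
        ; *-identity = ⊛-identityˡ , (λ f n → ≈-trans (⊛-comm f 𝟏 n) (⊛-identityˡ f n))
        ; distrib = (λ h f g n → ≈-trans (⊛-comm h (f ⊞ g) n)
            (≈-trans (⊛-distribʳ h f g n) (+-cong (⊛-comm f h n) (⊛-comm g h n))))
                  , ⊛-distribʳ }
      ; *-comm = ⊛-comm } }

  θ : Series → Series
  θ f n = n · f n

  θ-⊛ : ∀ f g → θ (f ⊛ g) ≋ ((θ f ⊛ g) ⊞ (f ⊛ θ g))
  θ-⊛ f g zero = ≈-sym (≈-trans (+-cong (zeroˡ (g 0)) (zeroʳ (f 0))) (+-identityˡ 0#))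
  θ-⊛ f g (suc n) = begin
    suc n · (f 0 * g (suc n) + (f′ ⊛ g) n)
      ≈⟨ ·-distrib-+ _ _ (suc n) ⟩
    suc n · (f 0 * g (suc n)) + ((f′ ⊛ g) n + n · (f′ ⊛ g) n)
      ≈⟨ +-cong (≈-sym (×-comm-* (suc n) (f 0) (g (suc n)))) (+-cong ≈-refl (θ-⊛ f′ g n)) ⟩
    f 0 * θ g (suc n) + ((f′ ⊛ g) n + ((θ f′ ⊛ g) n + (f′ ⊛ θ g) n))
      ≈⟨ solve 4 (λ a b c d → a :+ (b :+ (c :+ d)) := (b :+ c) :+ (a :+ d)) ≈-refl _ _ _ _ ⟩
    ((f′ ⊛ g) n + (θ f′ ⊛ g) n) + (f 0 * θ g (suc n) + (f′ ⊛ θ g) n)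
      ≈⟨ +-cong (≈-sym (⊛-distribʳ g f′ (θ f′) n)) ≈-refl ⟩
    ((θ f ∘ suc) ⊛ g) n + (f ⊛ θ g) (suc n)
      ≈⟨ +-cong (≈-sym (≈-trans (+-cong (zeroˡ _) ≈-refl) (+-identityˡ _))) ≈-refl ⟩
    (θ f ⊛ g) (suc n) + (f ⊛ θ g) (suc n) ∎
    where f′ = f ∘ suc

  θ-⊞ : ∀ f g → θ (f ⊞ g) ≋ (θ f ⊞ θ g)
  θ-⊞ f g n = ·-distrib-+ (f n) (g n) n

  θ-cong : ∀ {f g} → f ≋ g → θ f ≋ θ g
  θ-cong p n = ·-cong n (p n)

  𝐮 : Series
  𝐮 (suc zero) = 1#
  𝐮 _ = 0#

  𝐮⊛ : ∀ f n → (𝐮 ⊛ f) (suc n) ≈ f n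
  𝐮⊛ f n = ≈-trans (+-cong (zeroˡ _) (≈-trans (⊛-cong shape (λ _ → ≈-refl) n) (⊛-identityˡ f n))) (+-identityˡ _)
    where
    shape : (𝐮 ∘ suc) ≋ 𝟏
    shape zero = ≈-refl
    shape (suc n) = ≈-refl

  𝐮⊛-zero : ∀ f → (𝐮 ⊛ f) 0 ≈ 0#
  𝐮⊛-zero f = zeroˡ (f 0)

  const : C → Series
  const c zero = c
  const c (suc n) = 0#

  const⊛ : ∀ c f n → (const c ⊛ f) n ≈ c * f n
  const⊛ c f zero = ≈-refl
  const⊛ c f (suc n) = ≈-trans (+-cong ≈-refl (⊛-zeroˡ f n)) (+-identityʳ _)

-- The generating function of the squared binomial coefficients

c : ℕ → ℕ → ℤ
c zero k = δ k
c (suc n) zero = c n zero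
c (suc n) (suc k) = c n k ℤ.+ c n (suc k)

c-zero : ∀ n → c n 0 ≡ + 1
c-zero zero = refl
c-zero (suc n) = c-zero n

c-> : ∀ {n k} → n < k → c n k ≡ + 0
c-> {zero} {suc k} lt = refl
c-> {suc n} {suc k} (s≤s lt) = cong₂ ℤ._+_ (c-> lt) (c-> (ℕP.m≤n⇒m≤1+n lt))

-- The difference n - k is taken in ℤ, so that the rule holds on and beyond the diagonal, where both
-- sides are zero.
absorption : ∀ n k → + suc k ℤ.* c n (suc k) ≡ (+ n ℤ.- + k) ℤ.* c n k
absorption zero zero = refl
absorption zero (suc k) = trans (ℤP.*-zeroʳ (+ suc (suc k))) (sym (ℤP.*-zeroʳ (+ 0 ℤ.- + suc k)))
absorption (suc n) zero = trans (lem₁ (c n 0) (c n 1)) (trans (cong (λ z → c n 0 ℤ.+ z) (absorption n 0)) (lem₂ (+ n) (c n 0)))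
  where
  lem₁ : ∀ x y → + 1 ℤ.* (x ℤ.+ y) ≡ x ℤ.+ + 1 ℤ.* y
  lem₁ = solve-∀
  lem₂ : ∀ n x → x ℤ.+ (n ℤ.- + 0) ℤ.* x ≡ ((+ 1 ℤ.+ n) ℤ.- + 0) ℤ.* x
  lem₂ = solve-∀
absorption (suc n) (suc k) = trans (ℤP.*-distribˡ-+ (+ suc (suc k)) (c n (suc k)) (c n (suc (suc k))))
  (trans (cong (λ z → + suc (suc k) ℤ.* c n (suc k) ℤ.+ z) (absorption n (suc k)))
    (trans (lem₁ (+ n) (+ k) (c n (suc k)))
      (trans (cong (λ z → z ℤ.+ (+ n ℤ.- + k) ℤ.* c n (suc k)) (absorption n k)) (lem₂ (+ n) (+ k) (c n k) (c n (suc k))))))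
  where
  lem₁ : ∀ n k y → (+ 2 ℤ.+ k) ℤ.* y ℤ.+ (n ℤ.- (+ 1 ℤ.+ k)) ℤ.* y ≡ (+ 1 ℤ.+ k) ℤ.* y ℤ.+ (n ℤ.- k) ℤ.* y
  lem₁ = solve-∀
  lem₂ : ∀ n k x y → (n ℤ.- k) ℤ.* x ℤ.+ (n ℤ.- k) ℤ.* y ≡ ((+ 1 ℤ.+ n) ℤ.- (+ 1 ℤ.+ k)) ℤ.* (x ℤ.+ y)
  lem₂ = solve-∀

B : Ser
B n k = c n k ℤ.* c n k

module Contiguous where

  open ≡-Reasoning

  lhs rhs : ℤ → ℤ → ℤ → ℤ → ℤ
  lhs N x y z = N ℤ.* (y ℤ.* y)
  rhs N x y z = x ℤ.* y ℤ.+ y ℤ.* z ℤ.+ (+ 2 ℤ.+ N) ℤ.* (x ℤ.* z)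

  vanish : ∀ N z → lhs N (+ 0) (+ 0) z ≡ rhs N (+ 0) (+ 0) z
  vanish N z = lem N z
    where
    lem : ∀ N z → N ℤ.* (+ 0 ℤ.* + 0) ≡ + 0 ℤ.* + 0 ℤ.+ + 0 ℤ.* z ℤ.+ (+ 2 ℤ.+ N) ℤ.* (+ 0 ℤ.* z)
    lem = solve-∀

  expand : ∀ s d N M x y z → (s ℤ.* d) ℤ.* (N ℤ.* (y ℤ.* y) ℤ.- (x ℤ.* y ℤ.+ y ℤ.* z ℤ.+ M ℤ.* (x ℤ.* z))) ≡
    (s ℤ.* d) ℤ.* (N ℤ.* (y ℤ.* y)) ℤ.- (d ℤ.* (y ℤ.* (s ℤ.* x)) ℤ.+ s ℤ.* (y ℤ.* (d ℤ.* z)) ℤ.+ M ℤ.* ((s ℤ.* x) ℤ.* (d ℤ.* z)))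
  expand = solve-∀

  collapse : ∀ p r y → ((+ 1 ℤ.+ r) ℤ.* (+ 1 ℤ.+ p)) ℤ.* ((p ℤ.+ r) ℤ.* (y ℤ.* y)) ℤ.-
    ((+ 1 ℤ.+ p) ℤ.* (y ℤ.* (p ℤ.* y)) ℤ.+ (+ 1 ℤ.+ r) ℤ.* (y ℤ.* (r ℤ.* y)) ℤ.+ (+ 2 ℤ.+ (p ℤ.+ r)) ℤ.*
        ((p ℤ.* y) ℤ.* (r ℤ.* y))) ≡ + 0
  collapse = solve-∀

  scaled : ∀ s d N p r x y z → s ≡ + 1 ℤ.+ r → d ≡ + 1 ℤ.+ p → N ≡ p ℤ.+ r → s ℤ.* x ≡ p ℤ.* y → d ℤ.* z ≡ r ℤ.* y →
    (s ℤ.* d) ℤ.* (lhs N x y z ℤ.- rhs N x y z) ≡ + 0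
  scaled s d N p r x y z refl refl refl sx dz = trans (expand s d N (+ 2 ℤ.+ N) x y z)
    (trans (cong₂ (λ f g → (s ℤ.* d) ℤ.* (N ℤ.* (y ℤ.* y)) ℤ.-
        (d ℤ.* (y ℤ.* f) ℤ.+ s ℤ.* (y ℤ.* g) ℤ.+ (+ 2 ℤ.+ N) ℤ.* (f ℤ.* g))) sx dz) (collapse p r y))

  d≡ : ∀ N J → N ℤ.- J ≡ + 1 ℤ.+ (N ℤ.- (+ 1 ℤ.+ J))
  d≡ = solve-∀

  N≡ : ∀ N r → N ≡ (N ℤ.- r) ℤ.+ r
  N≡ = solve-∀

  -- Absorption expresses both outer binomials through the middle one after multiplication by (j +
  -- 2)(n - j). In terms of p = n - j - 1 and r = j + 1 a polynomial identity remains, and the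
  -- factor is cancelled.
  contiguous : ∀ n j → lhs (+ n) (c n (suc (suc j))) (c n (suc j)) (c n j) ≡ rhs (+ n) (c n (suc (suc j))) (c n (suc j)) (c n j)
  contiguous n j with n ℕP.≟ j
  -- The one case in which the factor n - j is zero; here the two upper binomials vanish.
  ... | yes refl = subst₂ (λ x y → lhs (+ n) x y (c n n) ≡ rhs (+ n) x y (c n n))
    (sym (c-> {n} {suc (suc n)} (ℕP.m<n⇒m<1+n (ℕP.n<1+n n)))) (sym (c-> {n} {suc n} (ℕP.n<1+n n))) (vanish (+ n) (c n n))
  ... | no n≢j with ℤP.i*j≡0⇒i≡0∨j≡0 (+ suc (suc j) ℤ.* (+ n ℤ.- + j))
      (scaled (+ suc (suc j)) (+ n ℤ.- + j) (+ n) (+ n ℤ.- + suc j) (+ suc j) (c n (suc (suc j))) (c n (suc j)) (c n j)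
        refl (d≡ (+ n) (+ j)) (N≡ (+ n) (+ suc j)) (absorption n (suc j)) (sym (absorption n j)))
  ... | inj₂ e = ℤP.i-j≡0⇒i≡j _ _ e
  ... | inj₁ e with ℤP.i*j≡0⇒i≡0∨j≡0 (+ suc (suc j)) e
  ... | inj₂ e′ = ⊥-elim (n≢j (ℤP.+-injective (ℤP.i-j≡0⇒i≡j (+ n) (+ j) e′)))

-- The constant coefficient of (n+2) B_{n+2} = (2n+3)(1+t) B_{n+1} - (n+1)(1-t)² B_n, the recurrence
-- of the Legendre polynomials in homogeneous form; the next two lemmas give its other coefficients.
recurrence₀ : ∀ n → (+ 2 ℤ.+ + n) ℤ.* B (suc (suc n)) 0 ≡
  (+ 3 ℤ.+ + 2 ℤ.* + n) ℤ.* B (suc n) 0 ℤ.- (+ 1 ℤ.+ + n) ℤ.* B n 0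
recurrence₀ n rewrite c-zero n = lem (+ n)
  where
  lem : ∀ N → (+ 2 ℤ.+ N) ℤ.* + 1 ≡ (+ 3 ℤ.+ + 2 ℤ.* N) ℤ.* + 1 ℤ.- (+ 1 ℤ.+ N) ℤ.* + 1
  lem = solve-∀

recurrence₁ : ∀ n → (+ 2 ℤ.+ + n) ℤ.* B (suc (suc n)) 1 ≡
  (+ 3 ℤ.+ + 2 ℤ.* + n) ℤ.* (B (suc n) 1 ℤ.+ B (suc n) 0) ℤ.- (+ 1 ℤ.+ + n) ℤ.* (B n 1 ℤ.- + 2 ℤ.* B n 0)
recurrence₁ n rewrite c-zero n | trans (sym (ℤP.*-identityˡ (c n 1)))
    (trans (absorption n 0) (cong ((+ n ℤ.- + 0) ℤ.*_) (c-zero n))) = lem (+ n)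
  where
  lem : ∀ N → let x = (N ℤ.- + 0) ℤ.* + 1 in (+ 2 ℤ.+ N) ℤ.* ((+ 1 ℤ.+ (+ 1 ℤ.+ x)) ℤ.* (+ 1 ℤ.+ (+ 1 ℤ.+ x))) ≡
    (+ 3 ℤ.+ + 2 ℤ.* N) ℤ.* ((+ 1 ℤ.+ x) ℤ.* (+ 1 ℤ.+ x) ℤ.+ + 1) ℤ.- (+ 1 ℤ.+ N) ℤ.* (x ℤ.* x ℤ.- + 2 ℤ.* + 1)
  lem = solve-∀

-- By Pascal's rule everything is quadratic in three consecutive binomials of row n, and the two
-- sides differ by twice the contiguous relation.
recurrence₂ : ∀ n k → (+ 2 ℤ.+ + n) ℤ.* B (suc (suc n)) (suc (suc k)) ≡
  (+ 3 ℤ.+ + 2 ℤ.* + n) ℤ.* (B (suc n) (suc (suc k)) ℤ.+ B (suc n) (suc k)) ℤ.-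
  (+ 1 ℤ.+ + n) ℤ.* (B n (suc (suc k)) ℤ.- + 2 ℤ.* B n (suc k) ℤ.+ B n k)
recurrence₂ n k = ℤP.i-j≡0⇒i≡j _ _ (trans (lem (+ n) x y z)
    (trans (cong (λ e → + 2 ℤ.* (e ℤ.- + n ℤ.* (y ℤ.* y))) (sym (Contiguous.contiguous n k))) (cancel (+ n ℤ.* (y ℤ.* y)))))
  where
  x = c n (suc (suc k))
  y = c n (suc k)
  z = c n k
  cancel : ∀ e → + 2 ℤ.* (e ℤ.- e) ≡ + 0
  cancel = solve-∀
  lem : ∀ N x y z → (+ 2 ℤ.+ N) ℤ.* (((z ℤ.+ y) ℤ.+ (y ℤ.+ x)) ℤ.* ((z ℤ.+ y) ℤ.+ (y ℤ.+ x))) ℤ.-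
    ((+ 3 ℤ.+ + 2 ℤ.* N) ℤ.* ((y ℤ.+ x) ℤ.* (y ℤ.+ x) ℤ.+ (z ℤ.+ y) ℤ.* (z ℤ.+ y)) ℤ.-
     (+ 1 ℤ.+ N) ℤ.* (x ℤ.* x ℤ.- + 2 ℤ.* (y ℤ.* y) ℤ.+ z ℤ.* z)) ≡
    + 2 ℤ.* ((x ℤ.* y ℤ.+ y ℤ.* z ℤ.+ (+ 2 ℤ.+ N) ℤ.* (x ℤ.* z)) ℤ.- N ℤ.* (y ℤ.* y))
  lem = solve-∀

module ℤ[t] = PowerSeries ℤP.+-*-commutativeRing
module ℤ[t][u] = PowerSeries ℤ[t].seriesRing

conv-⊛ : ∀ (p q : Poly) k → conv p q k ≡ (p ℤ[t].⊛ q) k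
conv-⊛ p q zero = ℤP.+-identityʳ _
conv-⊛ p q (suc k) = trans (∑-upTo-suc (suc k) (λ i → p i ℤ.* q (suc k ∸ i)))
    (cong (λ z → p 0 ℤ.* q (suc k) ℤ.+ z) (conv-⊛ (p ∘ suc) q k))

*S-⊛ : ∀ (f g : Ser) n k → (f *S g) n k ≡ (f ℤ[t][u].⊛ g) n k
*S-⊛ f g zero k = trans (ℤP.+-identityʳ _) (conv-⊛ (f 0) (g 0) k)
*S-⊛ f g (suc n) k = trans (∑-upTo-suc (suc n) (λ i → conv (f i) (g (suc n ∸ i)) k))
  (cong₂ ℤ._+_ (conv-⊛ (f 0) (g (suc n)) k) (*S-⊛ (f ∘ suc) g n k))

-- The differential equation and the square

module GeneratingFunction where

  open ℤ[t][u] using (_⊛_; _⊞_; θ; θ-⊛; θ-⊞; θ-cong)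
  open CommutativeRing ℤ[t][u].seriesRing
    using (_≈_; -_; 0#; 1#; +-cong; *-cong; -‿cong; commutativeSemiring; zeroʳ; *-assoc; *-comm; *-identityˡ; *-identityʳ;
        distribʳ; setoid)
    renaming (refl to ≈-refl; sym to ≈-sym; trans to ≈-trans; ring to ser-ring)
  open Algebra.Properties.Ring ser-ring using (-‿distribˡ-*)
  open Algebra.Solver.Ring.NaturalCoefficients.Default commutativeSemiring using (solve; _:=_; _:+_; _:*_; con)
  open import Relation.Binary.Reasoning.Setoid setoid

  -- Multiplication by u, t, -(t+1)u and -4tu² as shifts of indices, so that coefficients of
  -- products with them compute.
  Uf Tf Vf Qf : Ser → Ser
  Uf f zero k = + 0
  Uf f (suc n) k = f n k
  Tf f n zero = + 0
  Tf f n (suc k) = f n k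
  Vf f n k = ℤ.- (Tf (Uf f) n k ℤ.+ Uf f n k)
  Qf f n k = ℤ.- (+ 4 ℤ.* Tf (Uf (Uf f)) n k)

  Tf-cong : ∀ {f g : Ser} → f ≈ g → Tf f ≈ Tf g
  Tf-cong e n zero = refl
  Tf-cong e n (suc k) = e n k

  Uf-cong : ∀ {f g : Ser} → f ≈ g → Uf f ≈ Uf g
  Uf-cong e zero k = refl
  Uf-cong e (suc n) k = e n k

  Vf-cong : ∀ {f g : Ser} → f ≈ g → Vf f ≈ Vf g
  Vf-cong e n k = cong₂ (λ x y → ℤ.- (x ℤ.+ y)) (Tf-cong (Uf-cong e) n k) (Uf-cong e n k)

  uS≈𝐮 : uS ≈ ℤ[t][u].𝐮
  uS≈𝐮 zero k = refl
  uS≈𝐮 (suc zero) zero = refl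
  uS≈𝐮 (suc zero) (suc k) = refl
  uS≈𝐮 (suc (suc n)) k = refl

  u⊛ : ∀ f → (uS ⊛ f) ≈ Uf f
  u⊛ f zero k = trans (ℤ[t][u].⊛-cong {uS} {ℤ[t][u].𝐮} {f} {f} uS≈𝐮 (λ n k → refl) 0 k) (ℤ[t][u].𝐮⊛-zero f k)
  u⊛ f (suc n) k = trans (ℤ[t][u].⊛-cong {uS} {ℤ[t][u].𝐮} {f} {f} uS≈𝐮 (λ n k → refl) (suc n) k) (ℤ[t][u].𝐮⊛ f n k)

  t⊛ : ∀ f → (tS ⊛ f) ≈ Tf f
  t⊛ f n k = trans (ℤ[t][u].⊛-cong {tS} {ℤ[t][u].const ℤ[t].𝐮} shape (λ n k → refl) n k)
      (trans (ℤ[t][u].const⊛ ℤ[t].𝐮 f n k) (go k))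
    where
    shape : tS ≈ ℤ[t][u].const ℤ[t].𝐮
    shape zero zero = refl
    shape zero (suc zero) = refl
    shape zero (suc (suc k)) = refl
    shape (suc n) k = refl
    go : ∀ k → (ℤ[t].𝐮 ℤ[t].⊛ f n) k ≡ Tf f n k
    go zero = ℤ[t].𝐮⊛-zero (f n)
    go (suc k) = ℤ[t].𝐮⊛ (f n) k

  four⊛ : ∀ f → (constS (+ 4) ⊛ f) ≈ (λ n k → + 4 ℤ.* f n k)
  four⊛ f n k = trans (ℤ[t][u].⊛-cong {constS (+ 4)} {ℤ[t][u].const (ℤ[t].const (+ 4))} shape (λ n k → refl) n k)
    (trans (ℤ[t][u].const⊛ (ℤ[t].const (+ 4)) f n k) (ℤ[t].const⊛ (+ 4) (f n) k))
    where
    shape : constS (+ 4) ≈ ℤ[t][u].const (ℤ[t].const (+ 4))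
    shape zero zero = refl
    shape zero (suc k) = refl
    shape (suc n) k = refl

  one≈ : oneS ≈ 1#
  one≈ zero zero = refl
  one≈ zero (suc k) = refl
  one≈ (suc n) k = refl

  -- The series under the root as (1 + v)² + q with `v` and `q` homogeneous in u of degrees 1 and 2,
  -- so that θ multiplies them by 1 and 2.
  v q D : Ser
  v = - ((tS ⊞ oneS) ⊛ uS)
  q = - (((constS (+ 4) ⊛ tS) ⊛ uS) ⊛ uS)
  D = ((1# ⊞ v) ⊛ (1# ⊞ v)) ⊞ q

  Dser≈D : Dser ≈ D
  Dser≈D n k = cong₂ (λ x y → x ℤ.+ ℤ.- y)
    (trans (*S-⊛ _ _ n k) (*-cong first first n k))
    (trans (*S-⊛ _ _ n k) (*-cong (λ n k → trans (*S-⊛ _ _ n k) (*-cong (λ n k → *S-⊛ _ _ n k) ≈-refl n k)) ≈-refl n k))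
    where
    first : (oneS -S (tS +S oneS) *S uS) ≈ (1# ⊞ v)
    first n k = cong₂ (λ x y → x ℤ.+ ℤ.- y) (one≈ n k) (*S-⊛ _ _ n k)

  v⊛ : ∀ f → (v ⊛ f) ≈ Vf f
  v⊛ f = begin
    v ⊛ f ≈⟨ ≈-sym (-‿distribˡ-* ((tS ⊞ oneS) ⊛ uS) f) ⟩
    - (((tS ⊞ oneS) ⊛ uS) ⊛ f) ≈⟨ -‿cong (≈-trans (*-assoc (tS ⊞ oneS) uS f)
        (≈-trans (*-cong {tS ⊞ oneS} ≈-refl (u⊛ f)) (≈-trans (distribʳ (Uf f) tS oneS)
       (+-cong (t⊛ (Uf f)) (≈-trans (*-cong {u = Uf f} one≈ ≈-refl) (*-identityˡ (Uf f))))))) ⟩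
    Vf f ∎

  q⊛ : ∀ f → (q ⊛ f) ≈ Qf f
  q⊛ f = begin
    q ⊛ f ≈⟨ ≈-sym (-‿distribˡ-* (((constS (+ 4) ⊛ tS) ⊛ uS) ⊛ uS) f) ⟩
    - ((((constS (+ 4) ⊛ tS) ⊛ uS) ⊛ uS) ⊛ f) ≈⟨ -‿cong
        (solve 4 (λ a b c d → a :* b :* c :* c :* d := a :* (b :* (c :* (c :* d)))) ≈-refl (constS (+ 4)) tS uS f) ⟩
    - (constS (+ 4) ⊛ (tS ⊛ (uS ⊛ (uS ⊛ f)))) ≈⟨ -‿cong
        (≈-trans (*-cong {constS (+ 4)} ≈-refl (≈-trans (*-cong {tS} ≈-refl
        (≈-trans (*-cong {uS} ≈-refl (u⊛ f)) (u⊛ (Uf f)))) (t⊛ (Uf (Uf f)))))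
        (four⊛ (Tf (Uf (Uf f))))) ⟩
    Qf f ∎

  vv⊛ : ∀ f → (v ⊛ (v ⊛ f)) ≈ Vf (Vf f)
  vv⊛ f = ≈-trans (v⊛ (v ⊛ f)) (Vf-cong (v⊛ f))

  D⊛ : ∀ f → (D ⊛ f) ≈ (((f ⊞ Vf f) ⊞ (Vf f ⊞ Vf (Vf f))) ⊞ Qf f)
  D⊛ f = begin
    D ⊛ f ≈⟨ solve 3 (λ v q f → ((con 1 :+ v) :* (con 1 :+ v) :+ q) :* f := (f :+ v :* f) :+ (v :* f :+ v :* (v :* f)) :+ q
        :* f) ≈-refl v q f ⟩
    ((f ⊞ (v ⊛ f)) ⊞ ((v ⊛ f) ⊞ (v ⊛ (v ⊛ f)))) ⊞ (q ⊛ f) ≈⟨ +-cong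
        (+-cong (+-cong {f} ≈-refl (v⊛ f)) (+-cong (v⊛ f) (vv⊛ f))) (q⊛ f) ⟩
    ((f ⊞ Vf f) ⊞ (Vf f ⊞ Vf (Vf f))) ⊞ Qf f ∎

  open Algebra.Properties.Semiring.Mult (CommutativeRing.semiring ℤ[t].seriesRing) using () renaming (_×_ to _·_)

  ·-pointwise : ∀ n (p : Poly) k → (n · p) k ≡ + n ℤ.* p k
  ·-pointwise zero p k = sym (ℤP.*-zeroˡ (p k))
  ·-pointwise (suc n) p k = trans (cong (λ z → p k ℤ.+ z) (·-pointwise n p k)) (lem (+ n) (p k))
    where
    lem : ∀ n x → x ℤ.+ n ℤ.* x ≡ (+ 1 ℤ.+ n) ℤ.* x
    lem = solve-∀

  θ-pointwise : ∀ f n k → θ f n k ≡ + n ℤ.* f n k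
  θ-pointwise f n k = ·-pointwise n (f n) k

  θv : θ v ≈ v
  θv n k = trans (θ-pointwise v n k) (trans (cong (λ z → + n ℤ.* z) (v≡ n k)) (trans (go n k) (sym (v≡ n k))))
    where
    v≡ : ∀ n k → v n k ≡ Vf 1# n k
    v≡ = ≈-trans (≈-sym (*-identityʳ v)) (v⊛ 1#)
    go : ∀ n k → + n ℤ.* Vf 1# n k ≡ Vf 1# n k
    go zero zero = refl
    go zero (suc k) = refl
    go (suc zero) k = ℤP.*-identityˡ _
    go (suc (suc n)) zero = ℤP.*-zeroʳ (+ suc (suc n))
    go (suc (suc n)) (suc k) = ℤP.*-zeroʳ (+ suc (suc n))

  θq : θ q ≈ (q ⊞ q)
  θq n k = trans (θ-pointwise q n k) (trans (cong (λ z → + n ℤ.* z) (q≡ n k))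
      (trans (go n k) (sym (cong₂ ℤ._+_ (q≡ n k) (q≡ n k)))))
    where
    q≡ : ∀ n k → q n k ≡ Qf 1# n k
    q≡ = ≈-trans (≈-sym (*-identityʳ q)) (q⊛ 1#)
    dbl : ∀ x → + 2 ℤ.* x ≡ x ℤ.+ x
    dbl = solve-∀
    go : ∀ n k → + n ℤ.* Qf 1# n k ≡ Qf 1# n k ℤ.+ Qf 1# n k
    go zero zero = refl
    go zero (suc k) = refl
    go (suc zero) zero = refl
    go (suc zero) (suc k) = refl
    go (suc (suc zero)) k = dbl (Qf 1# 2 k)
    go (suc (suc (suc n))) zero = ℤP.*-zeroʳ (+ suc (suc (suc n)))
    go (suc (suc (suc n))) (suc k) = ℤP.*-zeroʳ (+ suc (suc (suc n)))

  θ1 : θ 1# ≈ 0#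
  θ1 n k = trans (θ-pointwise 1# n k) (go n k)
    where
    go : ∀ n k → + n ℤ.* ℤ[t][u].𝟏 n k ≡ + 0
    go zero k = ℤP.*-zeroˡ (ℤ[t][u].𝟏 0 k)
    go (suc n) k = ℤP.*-zeroʳ (+ suc n)

  θD⊛ : ∀ f → (θ D ⊛ f) ≈ (((Vf f ⊞ Vf (Vf f)) ⊞ (Vf f ⊞ Vf (Vf f))) ⊞ (Qf f ⊞ Qf f))
  θD⊛ f = begin
    θ D ⊛ f ≈⟨ *-cong {u = f} (≈-trans (θ-⊞ ((1# ⊞ v) ⊛ (1# ⊞ v)) q)
        (+-cong (≈-trans (θ-⊛ (1# ⊞ v) (1# ⊞ v)) (+-cong (*-cong {u = 1# ⊞ v} θ1v ≈-refl) (*-cong {1# ⊞ v} ≈-refl θ1v))) θq))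
        ≈-refl ⟩
    (((v ⊛ (1# ⊞ v)) ⊞ ((1# ⊞ v) ⊛ v)) ⊞ (q ⊞ q)) ⊛ f
      ≈⟨ solve 3 (λ v q f → ((v :* (con 1 :+ v) :+ (con 1 :+ v) :* v) :+ (q :+ q)) :* f :=
          ((v :* f :+ v :* (v :* f)) :+ (v :* f :+ v :* (v :* f))) :+ (q :* f :+ q :* f)) ≈-refl v q f ⟩
    (((v ⊛ f) ⊞ (v ⊛ (v ⊛ f))) ⊞ ((v ⊛ f) ⊞ (v ⊛ (v ⊛ f)))) ⊞ ((q ⊛ f) ⊞ (q ⊛ f))
      ≈⟨ +-cong (+-cong (+-cong (v⊛ f) (vv⊛ f)) (+-cong (v⊛ f) (vv⊛ f))) (+-cong (q⊛ f) (q⊛ f)) ⟩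
    ((Vf f ⊞ Vf (Vf f)) ⊞ (Vf f ⊞ Vf (Vf f))) ⊞ (Qf f ⊞ Qf f) ∎
    where
    θ1v : θ (1# ⊞ v) ≈ v
    θ1v = ≈-trans (θ-⊞ 1# v) (≈-trans (+-cong θ1 θv) (λ n k → ℤP.+-identityˡ (v n k)))

  G : Ser
  G n k = + n ℤ.* B n k

  comb : (g vg vvg qg vb vvb qb : ℤ) → ℤ
  comb g vg vvg qg vb vvb qb = ((((g ℤ.+ vg) ℤ.+ (vg ℤ.+ vvg)) ℤ.+ qg) ℤ.+ (((g ℤ.+ vg) ℤ.+ (vg ℤ.+ vvg)) ℤ.+ qg))
    ℤ.+ (((vb ℤ.+ vvb) ℤ.+ (vb ℤ.+ vvb)) ℤ.+ (qb ℤ.+ qb))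

  -- `comb` is a coefficient of 2 D θB + (θD) B, taken at u^(N+2). There `b`, `d₀`, `d₁` stand for
  -- the coefficients of (1+t) B_{N+1}, (1+t²) B_N and t B_N, and the equation for `g` is the
  -- three-term recurrence.
  comb-vanishes : ∀ N b d₀ d₁ {g vg vvg qg vb vvb qb} →
    g ≡ (+ 3 ℤ.+ + 2 ℤ.* N) ℤ.* b ℤ.- (+ 1 ℤ.+ N) ℤ.* (d₀ ℤ.- + 2 ℤ.* d₁) →
    vg ≡ ℤ.- ((+ 1 ℤ.+ N) ℤ.* b) → vvg ≡ N ℤ.* (d₀ ℤ.+ + 2 ℤ.* d₁) → qg ≡ ℤ.- (+ 4 ℤ.* (N ℤ.* d₁)) →
    vb ≡ ℤ.- b → vvb ≡ d₀ ℤ.+ + 2 ℤ.* d₁ → qb ≡ ℤ.- (+ 4 ℤ.* d₁) → comb g vg vvg qg vb vvb qb ≡ + 0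
  comb-vanishes N b d₀ d₁ refl refl refl refl refl refl refl = lem N b d₀ d₁
    where
    lem : ∀ N b d₀ d₁ → let g = (+ 3 ℤ.+ + 2 ℤ.* N) ℤ.* b ℤ.- (+ 1 ℤ.+ N) ℤ.* (d₀ ℤ.- + 2 ℤ.* d₁)
                            vg = ℤ.- ((+ 1 ℤ.+ N) ℤ.* b)
                            vvg = N ℤ.* (d₀ ℤ.+ + 2 ℤ.* d₁)
                            qg = ℤ.- (+ 4 ℤ.* (N ℤ.* d₁))
                            vvb = d₀ ℤ.+ + 2 ℤ.* d₁
                            qb = ℤ.- (+ 4 ℤ.* d₁)
      in ((((g ℤ.+ vg) ℤ.+ (vg ℤ.+ vvg)) ℤ.+ qg) ℤ.+ (((g ℤ.+ vg) ℤ.+ (vg ℤ.+ vvg)) ℤ.+ qg))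
         ℤ.+ (((ℤ.- b ℤ.+ vvb) ℤ.+ (ℤ.- b ℤ.+ vvb)) ℤ.+ (qb ℤ.+ qb)) ≡ + 0
    lem = solve-∀

  ODE : ℕ → ℕ → Set
  ODE n k = comb (G n k) (Vf G n k) (Vf (Vf G) n k) (Qf G n k) (Vf B n k) (Vf (Vf B) n k) (Qf B n k) ≡ + 0

  ode-step : ∀ n k N b d₀ d₁ →
    G n k ≡ (+ 3 ℤ.+ + 2 ℤ.* N) ℤ.* b ℤ.- (+ 1 ℤ.+ N) ℤ.* (d₀ ℤ.- + 2 ℤ.* d₁) →
    Vf G n k ≡ ℤ.- ((+ 1 ℤ.+ N) ℤ.* b) → Vf (Vf G) n k ≡ N ℤ.* (d₀ ℤ.+ + 2 ℤ.* d₁) → Qf G n k ≡ ℤ.- (+ 4 ℤ.* (N ℤ.* d₁)) →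
    Vf B n k ≡ ℤ.- b → Vf (Vf B) n k ≡ d₀ ℤ.+ + 2 ℤ.* d₁ → Qf B n k ≡ ℤ.- (+ 4 ℤ.* d₁) → ODE n k
  ode-step n k N b d₀ d₁ = comb-vanishes N b d₀ d₁ {G n k} {Vf G n k} {Vf (Vf G) n k} {Qf G n k} {Vf B n k} {Vf (Vf B) n k}
      {Qf B n k}

  ode-pointwise : ∀ n k → ODE n k
  ode-pointwise zero zero = refl
  ode-pointwise zero (suc zero) = refl
  ode-pointwise zero (suc (suc k)) = refl
  ode-pointwise (suc zero) zero = refl
  ode-pointwise (suc zero) (suc zero) = refl
  ode-pointwise (suc zero) (suc (suc k)) = refl
  ode-pointwise (suc (suc n)) zero = ode-step (suc (suc n)) 0 (+ n) (B (suc n) 0) (B n 0) (+ 0)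
    (trans (recurrence₀ n) (fix (+ n) (B (suc n) 0) (B n 0)))
    (vg (+ suc n) (B (suc n) 0)) (vvg (+ n) (B n 0)) (qg (+ n)) (vb (B (suc n) 0)) (vvb (B n 0)) refl
    where
    vg : ∀ M b → ℤ.- (+ 0 ℤ.+ M ℤ.* b) ≡ ℤ.- (M ℤ.* b)
    vg = solve-∀
    vvg : ∀ N d → ℤ.- (+ 0 ℤ.+ ℤ.- (+ 0 ℤ.+ N ℤ.* d)) ≡ N ℤ.* (d ℤ.+ + 2 ℤ.* + 0)
    vvg = solve-∀
    qg : ∀ N → + 0 ≡ ℤ.- (+ 4 ℤ.* (N ℤ.* + 0))
    qg = solve-∀
    vb : ∀ b → ℤ.- (+ 0 ℤ.+ b) ≡ ℤ.- b
    vb = solve-∀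
    vvb : ∀ d → ℤ.- (+ 0 ℤ.+ ℤ.- (+ 0 ℤ.+ d)) ≡ d ℤ.+ + 2 ℤ.* + 0
    vvb = solve-∀
    fix : ∀ N b d → (+ 3 ℤ.+ + 2 ℤ.* N) ℤ.* b ℤ.- (+ 1 ℤ.+ N) ℤ.* d ≡ (+ 3 ℤ.+ + 2 ℤ.* N) ℤ.* b ℤ.- (+ 1 ℤ.+ N) ℤ.*
        (d ℤ.- + 2 ℤ.* + 0)
    fix = solve-∀
  ode-pointwise (suc (suc n)) (suc zero) = ode-step (suc (suc n)) 1 (+ n) (B (suc n) 1 ℤ.+ B (suc n) 0) (B n 1) (B n 0)
    (recurrence₁ n) (vg (+ suc n) (B (suc n) 0) (B (suc n) 1)) (vvg (+ n) (B n 1) (B n 0)) refl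
    (vb (B (suc n) 0) (B (suc n) 1)) (vvb (B n 1) (B n 0)) refl
    where
    vg : ∀ M b₁ b → ℤ.- (M ℤ.* b₁ ℤ.+ M ℤ.* b) ≡ ℤ.- (M ℤ.* (b ℤ.+ b₁))
    vg = solve-∀
    vvg : ∀ N d d₁ → ℤ.- (ℤ.- (+ 0 ℤ.+ N ℤ.* d₁) ℤ.+ ℤ.- (N ℤ.* d₁ ℤ.+ N ℤ.* d)) ≡ N ℤ.* (d ℤ.+ + 2 ℤ.* d₁)
    vvg = solve-∀
    vb : ∀ b₁ b → ℤ.- (b₁ ℤ.+ b) ≡ ℤ.- (b ℤ.+ b₁)
    vb = solve-∀
    vvb : ∀ d d₁ → ℤ.- (ℤ.- (+ 0 ℤ.+ d₁) ℤ.+ ℤ.- (d₁ ℤ.+ d)) ≡ d ℤ.+ + 2 ℤ.* d₁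
    vvb = solve-∀
  ode-pointwise (suc (suc n)) (suc (suc k)) = ode-step (suc (suc n)) (suc (suc k)) (+ n)
    (B (suc n) (suc (suc k)) ℤ.+ B (suc n) (suc k)) (B n (suc (suc k)) ℤ.+ B n k) (B n (suc k))
    (trans (recurrence₂ n k) (cong (λ z → (+ 3 ℤ.+ + 2 ℤ.* + n) ℤ.* (B (suc n) (suc (suc k)) ℤ.+ B (suc n) (suc k)) ℤ.-
        (+ 1 ℤ.+ + n) ℤ.* z)
      (fix (B n (suc (suc k))) (B n (suc k)) (B n k))))
    (vg (+ suc n) (B (suc n) (suc k)) (B (suc n) (suc (suc k)))) (vvg (+ n) (B n (suc (suc k))) (B n (suc k)) (B n k)) refl
    (vb (B (suc n) (suc k)) (B (suc n) (suc (suc k)))) (vvb (B n (suc (suc k))) (B n (suc k)) (B n k)) refl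
    where
    vg : ∀ M b₁ b → ℤ.- (M ℤ.* b₁ ℤ.+ M ℤ.* b) ≡ ℤ.- (M ℤ.* (b ℤ.+ b₁))
    vg = solve-∀
    vvg : ∀ N d d₁ d₂ → ℤ.- (ℤ.- (N ℤ.* d₂ ℤ.+ N ℤ.* d₁) ℤ.+ ℤ.- (N ℤ.* d₁ ℤ.+ N ℤ.* d)) ≡ N ℤ.* (d ℤ.+ d₂ ℤ.+ + 2 ℤ.* d₁)
    vvg = solve-∀
    vb : ∀ b₁ b → ℤ.- (b₁ ℤ.+ b) ≡ ℤ.- (b ℤ.+ b₁)
    vb = solve-∀
    vvb : ∀ d d₁ d₂ → ℤ.- (ℤ.- (d₂ ℤ.+ d₁) ℤ.+ ℤ.- (d₁ ℤ.+ d)) ≡ d ℤ.+ d₂ ℤ.+ + 2 ℤ.* d₁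
    vvb = solve-∀
    fix : ∀ d d₁ d₂ → d ℤ.- + 2 ℤ.* d₁ ℤ.+ d₂ ≡ d ℤ.+ d₂ ℤ.- + 2 ℤ.* d₁
    fix = solve-∀

  θB : θ B ≈ G
  θB n k = θ-pointwise B n k

  ode : (((D ⊛ θ B) ⊞ (D ⊛ θ B)) ⊞ (θ D ⊛ B)) ≈ 0#
  ode = ≈-trans (+-cong (+-cong DG DG) (θD⊛ B)) ode-pointwise
    where
    DG = ≈-trans (*-cong {D} ≈-refl θB) (D⊛ G)

  θ[BBD] : θ ((B ⊛ B) ⊛ D) ≈ 0#
  θ[BBD] = begin
    θ ((B ⊛ B) ⊛ D) ≈⟨ ≈-trans (θ-⊛ (B ⊛ B) D) (+-cong (*-cong {u = D} (θ-⊛ B B) ≈-refl) ≈-refl) ⟩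
    (((θ B ⊛ B) ⊞ (B ⊛ θ B)) ⊛ D) ⊞ ((B ⊛ B) ⊛ θ D)
      ≈⟨ solve 4 (λ b g d e → (g :* b :+ b :* g) :* d :+ (b :* b) :* e := b :* ((d :* g :+ d :* g) :+ e :* b)) ≈-refl B (θ B)
          D (θ D) ⟩
    B ⊛ (((D ⊛ θ B) ⊞ (D ⊛ θ B)) ⊞ (θ D ⊛ B)) ≈⟨ ≈-trans (*-cong {B} ≈-refl ode) (zeroʳ B) ⟩
    0# ∎

  D₀ : ∀ k → D 0 k ≡ δ k
  D₀ k = trans (≈-sym (*-identityʳ D) 0 k) (trans (D⊛ 1# 0 k) (go k))
    where
    go : ∀ k → (((1# ⊞ Vf 1#) ⊞ (Vf 1# ⊞ Vf (Vf 1#))) ⊞ Qf 1#) 0 k ≡ δ k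
    go zero = refl
    go (suc zero) = refl
    go (suc (suc k)) = refl

  -- A series killed by θ is determined by its constant term in u, because positive integers can be
  -- cancelled in ℤ; that term is computed directly.
  BBD : ((B ⊛ B) ⊛ D) ≈ oneS
  BBD zero k = trans (ℤ[t].⊛-cong (λ k → trans (ℤ[t].⊛-cong B₀ B₀ k) (ℤ[t].⊛-identityˡ ℤ[t].𝟏 k)) (λ k → trans (D₀ k) (δ≡ k)) k)
      (trans (ℤ[t].⊛-identityˡ ℤ[t].𝟏 k) (sym (one≈ 0 k)))
    where
    δ≡ : ∀ k → δ k ≡ ℤ[t].𝟏 k
    δ≡ zero = refl
    δ≡ (suc k) = refl
    B₀ : ∀ k → B 0 k ≡ ℤ[t].𝟏 k
    B₀ zero = refl
    B₀ (suc k) = refl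
  BBD (suc n) k = cancel-suc n (((B ⊛ B) ⊛ D) (suc n) k) (trans (sym (θ-pointwise ((B ⊛ B) ⊛ D) (suc n) k)) (θ[BBD] (suc n) k))
    where
    cancel-suc : ∀ n x → + suc n ℤ.* x ≡ + 0 → x ≡ + 0
    cancel-suc n x e with ℤP.i*j≡0⇒i≡0∨j≡0 (+ suc n) e
    ... | inj₂ x≡0 = x≡0

  square-identity : ∀ n k → (B *S B *S Dser) n k ≡ oneS n k
  square-identity n k = trans (*S-⊛ (B *S B) Dser n k) (trans (*-cong (*S-⊛ B B) Dser≈D n k) (BBD n k))

-- Counting balanced words; conclusion

∑-card : ∀ n k → ∑ (subsets n) (λ X → ⟦ ∣ X ∣ ≡ᵇ k ⟧) ≡ c n k
∑-card zero zero = refl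
∑-card zero (suc k) = refl
∑-card (suc n) zero = trans (∑-subsets-suc n _) (trans (cong₂ ℤ._+_ (∑-card n 0) (∑-zero (subsets n))) (ℤP.+-identityʳ (c n 0)))
∑-card (suc n) (suc k) = trans (∑-subsets-suc n _)
    (trans (cong₂ ℤ._+_ (∑-card n (suc k)) (∑-card n k)) (ℤP.+-comm (c n (suc k)) (c n k)))

∑-cocard : ∀ n k → ∑ (subsets n) (λ X → ⟦ k ℕ.+ ∣ X ∣ ≡ᵇ n ⟧) ≡ c n k
∑-cocard zero zero = refl
∑-cocard zero (suc k) = refl
∑-cocard (suc n) k = trans (∑-subsets-suc n _) (trans (cong (λ z → ∑ (subsets n) (λ X → ⟦ k ℕ.+ ∣ X ∣ ≡ᵇ suc n ⟧) ℤ.+ z)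
    (∑-cong (subsets n) λ X → cong (λ s → ⟦ s ≡ᵇ suc n ⟧) (ℕP.+-suc k ∣ X ∣))) (go k))
  where
  go : ∀ k → ∑ (subsets n) (λ X → ⟦ k ℕ.+ ∣ X ∣ ≡ᵇ suc n ⟧) ℤ.+ ∑ (subsets n) (λ X → ⟦ k ℕ.+ ∣ X ∣ ≡ᵇ n ⟧) ≡ c (suc n) k
  go zero = trans (cong₂ ℤ._+_ (∑-zero′ (subsets n) λ X → cong ⟦_⟧ (bool-ext {b = false}
      (λ h → ⊥-elim (ℕP.<⇒≢ (s≤s (∣p∣≤n X)) (≡ᵇ⇒≡ {∣ X ∣} h))) (λ ()))) (∑-cocard n 0)) (ℤP.+-identityˡ (c n 0))
  go (suc k) = cong₂ ℤ._+_ (∑-cocard n k) (∑-cocard n (suc k))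

-- With k ups among the b, balance leaves n - k ups for the a; the two choices are independent and
-- each is counted by C(n,k).
balanced-count : ∀ n k → sum2 n (λ b a → ⟦ balanced b a ⟧ ℤ.* ⟦ ∣ b ∣ ≡ᵇ k ⟧) ≡ B n k
balanced-count n k = begin
  sum2 n (λ b a → ⟦ balanced b a ⟧ ℤ.* ⟦ ∣ b ∣ ≡ᵇ k ⟧)
    ≡⟨ sum2-cong n (λ b a → point ∣ b ∣ ∣ a ∣) ⟩
  sum2 n (λ b a → ⟦ ∣ b ∣ ≡ᵇ k ⟧ ℤ.* ⟦ k ℕ.+ ∣ a ∣ ≡ᵇ n ⟧)
    ≡⟨ ∑-cong (subsets n) (λ b → trans (∑-*ˡ (subsets n) ⟦ ∣ b ∣ ≡ᵇ k ⟧ _)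
        (trans (cong (λ z → ⟦ ∣ b ∣ ≡ᵇ k ⟧ ℤ.* z) (∑-cocard n k)) (ℤP.*-comm ⟦ ∣ b ∣ ≡ᵇ k ⟧ (c n k)))) ⟩
  ∑ (subsets n) (λ b → c n k ℤ.* ⟦ ∣ b ∣ ≡ᵇ k ⟧)
    ≡⟨ trans (∑-*ˡ (subsets n) (c n k) _) (cong (λ z → c n k ℤ.* z) (∑-card n k)) ⟩
  c n k ℤ.* c n k ∎
  where
  open ≡-Reasoning
  point : ∀ x y → ⟦ x ℕ.+ y ≡ᵇ n ⟧ ℤ.* ⟦ x ≡ᵇ k ⟧ ≡ ⟦ x ≡ᵇ k ⟧ ℤ.* ⟦ k ℕ.+ y ≡ᵇ n ⟧
  point x y with x ≡ᵇ k in eq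
  ... | false = trans (ℤP.*-zeroʳ ⟦ x ℕ.+ y ≡ᵇ n ⟧) (sym (ℤP.*-zeroˡ ⟦ k ℕ.+ y ≡ᵇ n ⟧))
  ... | true = trans (ℤP.*-comm ⟦ x ℕ.+ y ≡ᵇ n ⟧ (+ 1)) (cong (λ z → + 1 ℤ.* ⟦ z ℕ.+ y ≡ᵇ n ⟧) (≡ᵇ⇒≡ {x} eq))

-- W^1 is a single edge rather than a spoke with a rim edge, so it needs a model of its own: one
-- word over each of its two flats.
edgeModel : KLModel {1} ∣_∣ 1
edgeModel = record
  { matroid = record
    { rk-bound = λ X _ → ℕP.≤-refl
    ; rk-mono = λ X Y _ → p⊆q⇒∣p∣≤∣q∣
    ; rk-submod = λ X Y _ _ → submod X Y }
  ; rank≡n = refl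
  ; Word = Bool
  ; words = false ∷ true ∷ []
  ; ok = λ _ → true
  ; φ = λ b → b ∷ []
  ; wt = 𝟙
  ; φ-flat = flat
  ; r≤wt = λ b _ → ℕP.≤-reflexive (trans (card-∷ b []) (ℕP.+-identityʳ (𝟙 b)))
  ; wt≤n = λ b _ → bound b
  ; degree< = degree<
  ; top = refl
  ; palindromic = pal
  }
  where
  submod : ∀ (X Y : Subset 1) → ∣ X ∪ Y ∣ ℕ.+ ∣ X ∩ Y ∣ ≤ ∣ X ∣ ℕ.+ ∣ Y ∣
  submod (true ∷ []) (true ∷ []) = ℕP.≤-refl
  submod (true ∷ []) (false ∷ []) = ℕP.≤-refl
  submod (false ∷ []) (true ∷ []) = ℕP.≤-refl
  submod (false ∷ []) (false ∷ []) = ℕP.≤-refl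
  flat : ∀ b → true ≡ true → Flat ∣_∣ (b ∷ [])
  flat true _ zero x∉ = ⊥-elim (x∉ V.here)
  flat false _ zero x∉ = s≤s z≤n
  bound : ∀ b → 𝟙 b ≤ 1
  bound true = ℕP.≤-refl
  bound false = z≤n
  degree< : ∀ b → true ≡ true → ∣ b ∷ [] ∣ < 1 → 2 ℕ.* 𝟙 b < 1 ℕ.+ ∣ b ∷ [] ∣
  degree< true _ (s≤s ())
  degree< false _ _ = s≤s z≤n
  swap : ∀ x y → + 1 ℤ.* (+ 1 ℤ.* x) ℤ.+ (+ 1 ℤ.* (+ 1 ℤ.* y) ℤ.+ + 0) ≡ + 1 ℤ.* (+ 1 ℤ.* y) ℤ.+ (+ 1 ℤ.* (+ 1 ℤ.* x) ℤ.+ + 0)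
  swap = solve-∀
  pal : ∀ (X : Subset 1) (ψ : ℕ → ℤ) →
    ∑ (false ∷ true ∷ []) (λ b → ⟦ true ⟧ ℤ.* (⟦ X ⊆ᵇ (b ∷ []) ⟧ ℤ.* ψ (𝟙 b))) ≡
    ∑ (false ∷ true ∷ []) (λ b → ⟦ true ⟧ ℤ.* (⟦ X ⊆ᵇ (b ∷ []) ⟧ ℤ.* ψ (∣ X ∣ ℕ.+ (1 ∸ 𝟙 b))))
  pal (true ∷ []) ψ = refl
  pal (false ∷ []) ψ = swap (ψ 0) (ψ 1)

Zgen-B : (P : RMat → Poly) → IsKL P → ∀ n k → Zgen P n k ≡ B n k
Zgen-B P isKL zero zero = refl
Zgen-B P isKL zero (suc k) = refl
Zgen-B P isKL (suc zero) k = trans (KL.Zpoly-words P isKL edgeModel (rk (Whirl 1))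
    (λ { (true ∷ []) → refl ; (false ∷ []) → refl }) k) (go k)
  where
  go : ∀ k → ∑ (false ∷ true ∷ []) (λ b → + 1 ℤ.* ⟦ 𝟙 b ≡ᵇ k ⟧) ≡ B 1 k
  go zero = refl
  go (suc zero) = refl
  go (suc (suc k)) = refl
Zgen-B P isKL (suc (suc n)) k = trans (KL.Zpoly-words P isKL model (rk (Whirl (suc (suc n)))) (whirl-rank (suc n)) k)
  (trans (∑-words _) (balanced-count (suc (suc n)) k))
  where open Words (suc n)

theorem6p11 : (P : RMat → Poly) → IsKL P →
    ∀ (n k : ℕ) → (Zgen P *S Zgen P *S Dser) n k ≡ oneS n k
theorem6p11 P isKL n k = trans (*S-⊛ (Zgen P *S Zgen P) Dser n k) (trans
  (ℤ[t][u].⊛-cong (λ n k → trans (*S-⊛ (Zgen P) (Zgen P) n k) (trans (ℤ[t][u].⊛-cong Z≡B Z≡B n k) (sym (*S-⊛ B B n k))))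
      (λ _ _ → refl) n k)
  (trans (sym (*S-⊛ (B *S B) Dser n k)) (GeneratingFunction.square-identity n k)))
  where
  Z≡B : ∀ n k → Zgen P n k ≡ B n k
  Z≡B = Zgen-B P isKL
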